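{- (ZF) For every nonempty set $S$, there is no bijection between $\mathrm{seq}(S)$ and $\mathcal{P}(S)$.
   Context: Work in ZF (Zermelo–Fraenkel set theory without the Axiom of Choice). $\mathcal{P}(S)$ is the power set of $S$ and $\mathrm{seq}(S)$ is the set of all finite sequences of elements of $S$ (repetitions allowed). -}

module Defs where

open import Level using (Level) renaming (suc to ℓsuc)
open import Data.Nat using (ℕ) renaming (suc to 1+_)
open import Data.Fin using (Fin; zero; suc)
open import Data.Vec using (Vec; []; _∷_; lookup)
open import Data.Product using (∃; ∃-syntax; _×_; _,_; proj₁; proj₂)
open import Data.Sum using (_⊎_; inj₁; inj₂)
open import Function.Bundles using (_⇔_; mk⇔; module Equivalence)
open import Relation.Binary.PropositionalEquality using (_≡_; refl)
open import Relation.Nullary using (¬_; Dec)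

-- First-order formulas in the language {∈, =} with n free variables
-- (de Bruijn indices).  The schemas of ZF range over these formulas and
-- not over arbitrary Agda predicates.

infix  8 _∈̇_ _≐_
infix  7 ¬̇_
infixr 6 _∧̇_
infixr 5 _∨̇_
infixr 4 _⇒̇_
infix  3 _⇔̇_
infix  2 ∀̇_ ∃̇_

data Formula (n : ℕ) : Set where
  _∈̇_ _≐_                : Fin n → Fin n → Formula n
  ¬̇_                     : Formula n → Formula n
  _∧̇_ _∨̇_ _⇒̇_ _⇔̇_        : Formula n → Formula n → Formula n
  ∀̇_ ∃̇_                  : Formula (1+ n) → Formula n

module Language {ℓ : Level} (V : Set ℓ) (_∈_ : V → V → Set ℓ) where

  Sat : ∀ {n} → Formula n → Vec V n → Set ℓ
  Sat (i ∈̇ j)  ρ = lookup ρ i ∈ lookup ρ j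
  Sat (i ≐ j)  ρ = lookup ρ i ≡ lookup ρ j
  Sat (¬̇ φ)    ρ = ¬ Sat φ ρ
  Sat (φ ∧̇ ψ)  ρ = Sat φ ρ × Sat ψ ρ
  Sat (φ ∨̇ ψ)  ρ = Sat φ ρ ⊎ Sat ψ ρ
  Sat (φ ⇒̇ ψ)  ρ = Sat φ ρ → Sat ψ ρ
  Sat (φ ⇔̇ ψ)  ρ = Sat φ ρ ⇔ Sat ψ ρ
  Sat (∀̇ φ)    ρ = ∀ x → Sat φ (x ∷ ρ)
  Sat (∃̇ φ)    ρ = ∃[ x ] Sat φ (x ∷ ρ)

  _⊆_ : V → V → Set ℓ
  x ⊆ y = ∀ z → z ∈ x → z ∈ y

  IsEmpty : V → Set ℓ
  IsEmpty e = ∀ z → ¬ (z ∈ e)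

  -- w = {x, y}
  IsPair : V → V → V → Set ℓ
  IsPair w x y = ∀ z → z ∈ w ⇔ (z ≡ x ⊎ z ≡ y)

  -- p = ⟨x, y⟩ = {{x}, {x, y}}
  IsOrderedPair : V → V → V → Set ℓ
  IsOrderedPair p x y = ∀ w → w ∈ p ⇔ (IsPair w x x ⊎ IsPair w x y)

  -- y = x ∪ {x}
  IsSuccessor : V → V → Set ℓ
  IsSuccessor y x = ∀ z → z ∈ y ⇔ (z ∈ x ⊎ z ≡ x)

  IsInductive : V → Set ℓ
  IsInductive I = (∃[ e ] IsEmpty e × e ∈ I)
                × (∀ x → x ∈ I → ∃[ y ] IsSuccessor y x × y ∈ I)

  -- von Neumann natural numbers
  IsNatural : V → Set ℓ
  IsNatural n = ∀ I → IsInductive I → n ∈ I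

  -- ⟨x, y⟩ ∈ f
  Maps : V → V → V → Set ℓ
  Maps f x y = ∃[ p ] IsOrderedPair p x y × p ∈ f

  -- f : A → B, as a set of ordered pairs
  IsFunction : V → V → V → Set ℓ
  IsFunction f A B
    = (∀ p → p ∈ f → ∃[ x ] ∃[ y ] x ∈ A × y ∈ B × IsOrderedPair p x y)
    × (∀ x → x ∈ A → ∃[ y ] Maps f x y)
    × (∀ x y y′ → Maps f x y → Maps f x y′ → y ≡ y′)

  IsInjective : V → Set ℓ
  IsInjective f = ∀ x x′ y → Maps f x y → Maps f x′ y → x ≡ x′

  IsSurjectiveOnto : V → V → Set ℓ
  IsSurjectiveOnto f B = ∀ y → y ∈ B → ∃[ x ] Maps f x y

  IsBijection : V → V → V → Set ℓ
  IsBijection f A B = IsFunction f A B × IsInjective f × IsSurjectiveOnto f B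

  -- A finite sequence in S is a function n → S with n a natural number.
  IsFiniteSequence : V → V → Set ℓ
  IsFiniteSequence t S = ∃[ n ] IsNatural n × IsFunction t n S

  -- Choice is not among the axioms.  Classical logic is required only of the
  -- formulas of the language.
  record IsZF : Set ℓ where
    field
      excluded-middle : ∀ {n} (φ : Formula n) ρ → Dec (Sat φ ρ)
      extensionality  : ∀ x y → (∀ z → z ∈ x ⇔ z ∈ y) → x ≡ y
      foundation      : ∀ x → (∃[ y ] y ∈ x) →
                        ∃[ y ] y ∈ x × ¬ (∃[ z ] z ∈ x × z ∈ y)
      pairing         : ∀ x y → ∃[ w ] IsPair w x y
      union           : ∀ x → ∃[ u ] ∀ z → z ∈ u ⇔ (∃[ y ] z ∈ y × y ∈ x)
      power-set       : ∀ x → ∃[ p ] ∀ z → z ∈ p ⇔ z ⊆ x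
      infinity        : ∃[ I ] IsInductive I
      separation      : ∀ {n} (φ : Formula (1+ n)) (ρ : Vec V n) a →
                        ∃[ b ] ∀ x → x ∈ b ⇔ (x ∈ a × Sat φ (x ∷ ρ))
      replacement     : ∀ {n} (φ : Formula (1+ 1+ n)) (ρ : Vec V n) a →
                        (∀ x → x ∈ a → ∀ y y′ →
                           Sat φ (x ∷ y ∷ ρ) → Sat φ (x ∷ y′ ∷ ρ) → y ≡ y′) →
                        ∃[ b ] ∀ y → y ∈ b ⇔ (∃[ x ] x ∈ a × Sat φ (x ∷ y ∷ ρ))

-- Formulas whose satisfaction is, definitionally, the predicate of the
-- corresponding name in Language.

infix 9 ↑_

pattern ↑_ i = suc i
pattern v0 = zero
pattern v1 = suc zero
pattern v2 = suc (suc zero)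

private variable n : ℕ

isEmpty : Fin n → Formula n
isEmpty e = ∀̇ ¬̇ (v0 ∈̇ ↑ e)

isPair isOrderedPair : Fin n → Fin n → Fin n → Formula n
isPair w x y = ∀̇ (v0 ∈̇ ↑ w ⇔̇ v0 ≐ ↑ x ∨̇ v0 ≐ ↑ y)
isOrderedPair p x y =
  ∀̇ (v0 ∈̇ ↑ p ⇔̇ isPair v0 (↑ x) (↑ x) ∨̇ isPair v0 (↑ x) (↑ y))

isSuccessor : Fin n → Fin n → Formula n
isSuccessor y x = ∀̇ (v0 ∈̇ ↑ y ⇔̇ v0 ∈̇ ↑ x ∨̇ v0 ≐ ↑ x)

isInductive isNatural : Fin n → Formula n
isInductive I =
    (∃̇ (isEmpty v0 ∧̇ v0 ∈̇ ↑ I))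
  ∧̇ (∀̇ (v0 ∈̇ ↑ I ⇒̇ (∃̇ (isSuccessor v0 v1 ∧̇ v0 ∈̇ ↑ ↑ I))))
isNatural k = ∀̇ (isInductive v0 ⇒̇ ↑ k ∈̇ v0)

maps isFunction : Fin n → Fin n → Fin n → Formula n
maps f x y = ∃̇ (isOrderedPair v0 (↑ x) (↑ y) ∧̇ v0 ∈̇ ↑ f)
isFunction f A B =
    (∀̇ (v0 ∈̇ ↑ f ⇒̇ (∃̇ ∃̇ (v1 ∈̇ ↑ ↑ ↑ A ∧̇ v0 ∈̇ ↑ ↑ ↑ B ∧̇ isOrderedPair v2 v1 v0))))
  ∧̇ (∀̇ (v0 ∈̇ ↑ A ⇒̇ (∃̇ maps (↑ ↑ f) v1 v0)))
  ∧̇ (∀̇ ∀̇ ∀̇ (maps (↑ ↑ ↑ f) v2 v1 ⇒̇ maps (↑ ↑ ↑ f) v2 v0 ⇒̇ v1 ≐ v0))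

isFiniteSequence : Fin n → Fin n → Formula n
isFiniteSequence t S = ∃̇ (isNatural v0 ∧̇ isFunction (↑ t) v0 (↑ S))

record ZFModel (ℓ : Level) : Set (ℓsuc ℓ) where
  infix 4 _∈_
  field
    V    : Set ℓ
    _∈_  : V → V → Set ℓ
    isZF : Language.IsZF V _∈_

  open Language V _∈_ public
  open IsZF isZF public
  open Equivalence using (to; from)

  𝒫 : V → V
  𝒫 S = proj₁ (power-set S)

  ∈-𝒫 : ∀ S z → z ∈ 𝒫 S ⇔ z ⊆ S
  ∈-𝒫 S = proj₂ (power-set S)

  ⋃ : V → V
  ⋃ x = proj₁ (union x)

  _∪_ : V → V → V
  x ∪ y = ⋃ (proj₁ (pairing x y))

  ∪-inl : ∀ x y z → z ∈ x → z ∈ x ∪ y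
  ∪-inl x y z z∈x =
    from (proj₂ (union _) z) (x , z∈x , from (proj₂ (pairing x y) x) (inj₁ refl))

  ∪-inr : ∀ x y z → z ∈ y → z ∈ x ∪ y
  ∪-inr x y z z∈y =
    from (proj₂ (union _) z) (y , z∈y , from (proj₂ (pairing x y) y) (inj₂ refl))

  ω : V
  ω = proj₁ (separation (isNatural v0) [] (proj₁ infinity))

  ∈-ω : ∀ k → k ∈ ω ⇔ IsNatural k
  ∈-ω k = mk⇔ (λ k∈ω → proj₂ (to ∈-sep k∈ω))
              (λ nat → from ∈-sep (nat _ (proj₂ infinity) , nat))
    where ∈-sep = proj₂ (separation (isNatural v0) [] (proj₁ infinity)) k

  pair⊆ : ∀ {w x y C} → IsPair w x y → x ∈ C → y ∈ C → w ∈ 𝒫 C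
  pair⊆ {C = C} w-pair x∈C y∈C = from (∈-𝒫 C _) λ z z∈w → helper (to (w-pair z) z∈w)
    where
    helper : ∀ {z} → _ → z ∈ C
    helper (inj₁ refl) = x∈C
    helper (inj₂ refl) = y∈C

  orderedPair⊆ : ∀ {p x y C} → IsOrderedPair p x y → x ∈ C → y ∈ C → p ∈ 𝒫 (𝒫 C)
  orderedPair⊆ {C = C} p-pair x∈C y∈C =
    from (∈-𝒫 (𝒫 C) _) λ w w∈p → helper (to (p-pair w) w∈p)
    where
    helper : ∀ {w} → _ → w ∈ 𝒫 C
    helper (inj₁ w-pair) = pair⊆ w-pair x∈C x∈C
    helper (inj₂ w-pair) = pair⊆ w-pair x∈C y∈C

  -- Every finite sequence in S is a subset of ⋃ω × S, hence lies in this set.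
  seqBound : V → V
  seqBound S = 𝒫 (𝒫 (𝒫 (⋃ ω ∪ S)))

  finiteSequence-bounded : ∀ {t S} → IsFiniteSequence t S → t ∈ seqBound S
  finiteSequence-bounded {S = S} (k , k-nat , t⊆ , _) =
    from (∈-𝒫 _ _) λ p p∈t →
      let x , y , x∈k , y∈S , p-pair = t⊆ p p∈t in
      orderedPair⊆ p-pair
        (∪-inl _ _ x (from (proj₂ (union ω) x) (k , x∈k , from (∈-ω k) k-nat)))
        (∪-inr _ _ y y∈S)

  seq : V → V
  seq S = proj₁ (separation (isFiniteSequence v0 v1) (S ∷ []) (seqBound S))

  ∈-seq : ∀ S t → t ∈ seq S ⇔ IsFiniteSequence t S
  ∈-seq S t = mk⇔ (λ t∈ → proj₂ (to ∈-sep t∈))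
                  (λ fs → from ∈-sep (finiteSequence-bounded fs , fs))
    where ∈-sep = proj₂ (separation (isFiniteSequence v0 v1) (S ∷ []) (seqBound S)) t

{-# OPTIONS --safe #-}

-- Let f : seq S → 𝒫 S be a bijection.  Then every ordinal κ injects into S,
-- contradicting Hartogs' theorem.  The constant sequences give infinitely many
-- subsets of S, hence, by Kuratowski's argument, a partial map of S onto ω.
-- Given A ⊆ S and a partial map of S onto seq A, Cantor's diagonal set is not
-- f t for any t ∈ seq A, so its preimage under f has a first entry outside A,
-- which is a canonical new element of S.  To have such maps at every stage of
-- a transfinite recursion without choice, the recursion is indexed by the
-- nonempty finite subsets of κ × ω, ordered by the maximum of the symmetric
-- difference.  A finite sequence of such sets is coded by a single one, and
-- moving the topmost block {k} × ω down into {0} × ω makes the code an earlier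
-- index.  On the lowest block the map onto ω takes over.

module Submission where

open import Level using (Level)
open import Data.Nat using (ℕ) renaming (suc to 1+_)
open import Data.Fin using (Fin; suc)
open import Data.Vec using (Vec; []; _∷_)
open import Data.Product using (∃-syntax; _×_; _,_; proj₁; proj₂)
open import Data.Sum using (_⊎_; inj₁; inj₂; [_,_]′)
open import Data.Empty using (⊥-elim)
open import Function.Bundles using (_⇔_; mk⇔; module Equivalence)
open import Relation.Binary.PropositionalEquality using (_≡_; refl; sym; trans; subst)
open import Relation.Nullary using (¬_; Dec; yes; no)
open import Defs
open Equivalence using (to; from)

-- The diagonal step needs at every stage one definite partial map of `S` onto the sequences of
-- elements found so far; picking an enumeration anew at each stage would be choice. Indexing by
-- finite sets supplies such a map: coding a sequence is a union of images under fixed injections,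
-- without ordinal arithmetic. The price is room. At a stage whose maximum lies in block `k`, the
-- sets to be coded may themselves reach into block `k`, so their codes have to land in strictly
-- lower blocks in order to be earlier indices. The `ω` positions of a block make space for the
-- number of the entry and for a tag that tells moved positions from kept ones. Below the lowest
-- block there is nothing to move into, and an injection of `ω` into `S` is not at hand there;
-- Kuratowski's argument yields only a partial surjection, which is all that Cantor's argument asks
-- for. Separation, replacement and excluded middle range over formulas only. Hence whatever is
-- separated, proved by induction or decided is also written as a formula; the lower-case formulas
-- are the codes of the capitalised predicates used in the reasoning.

pattern v3 = suc v2
pattern v4 = suc v3
pattern v5 = suc v4
pattern v6 = suc v5
pattern v7 = suc v6
pattern v8 = suc v7
pattern v9 = suc v8
pattern v10 = suc v9
pattern v11 = suc v10
pattern v12 = suc v11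
pattern v13 = suc v12
pattern v14 = suc v13

private variable n : ℕ

-- Elementary set constructions, ordered pairs and relations as sets.

module Basics {ℓ : Level} (M : ZFModel ℓ) where
  open ZFModel M

  infix 4 _∈?_ _≟_

  _∈?_ : ∀ x y → Dec (x ∈ y)
  x ∈? y = excluded-middle (v0 ∈̇ v1) (x ∷ y ∷ [])

  _≟_ : ∀ (x y : V) → Dec (x ≡ y)
  x ≟ y = excluded-middle (v0 ≐ v1) (x ∷ y ∷ [])

  nonempty? : ∀ a → (∃[ x ] x ∈ a) ⊎ IsEmpty a
  nonempty? a with excluded-middle (∃̇ v0 ∈̇ v1) (a ∷ [])
  ... | yes p = inj₁ p
  ... | no ¬p = inj₂ λ z z∈a → ¬p (z , z∈a)

  ext : ∀ {x y} → (∀ z → z ∈ x → z ∈ y) → (∀ z → z ∈ y → z ∈ x) → x ≡ y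
  ext p q = extensionality _ _ λ z → mk⇔ (p z) (q z)

  abstract
    sep : ∀ {n} → Formula (1+ n) → Vec V n → V → V
    sep φ ρ a = proj₁ (separation φ ρ a)

    ∈-sep : ∀ {n} (φ : Formula (1+ n)) ρ a x → x ∈ sep φ ρ a ⇔ (x ∈ a × Sat φ (x ∷ ρ))
    ∈-sep φ ρ a = proj₂ (separation φ ρ a)

  sep⁺ : ∀ {n} (φ : Formula (1+ n)) ρ a {x} → x ∈ a → Sat φ (x ∷ ρ) → x ∈ sep φ ρ a
  sep⁺ φ ρ a x∈a s = from (∈-sep φ ρ a _) (x∈a , s)

  sep⁻ : ∀ {n} (φ : Formula (1+ n)) ρ a {x} → x ∈ sep φ ρ a → x ∈ a × Sat φ (x ∷ ρ)
  sep⁻ φ ρ a = to (∈-sep φ ρ a _)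

  ∈-minimal : ∀ a → (∃[ x ] x ∈ a) → ∃[ m ] m ∈ a × (∀ z → z ∈ a → ¬ z ∈ m)
  ∈-minimal a ne = let m , m∈a , p = foundation a ne in m , m∈a , λ z z∈a z∈m → p (z , z∈a , z∈m)

  𝒫⁺ : ∀ {S z} → z ⊆ S → z ∈ 𝒫 S
  𝒫⁺ = from (∈-𝒫 _ _)

  𝒫⁻ : ∀ {S z} → z ∈ 𝒫 S → z ⊆ S
  𝒫⁻ = to (∈-𝒫 _ _)

  -- Separation needs some set to start from, and infinity is the axiom that provides one outright.
  ∅ : V
  ∅ = sep (¬̇ (v0 ≐ v0)) [] (proj₁ infinity)

  ∉∅ : IsEmpty ∅
  ∉∅ z z∈ = proj₂ (sep⁻ (¬̇ (v0 ≐ v0)) [] _ z∈) refl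

  empty≡∅ : ∀ {e} → IsEmpty e → e ≡ ∅
  empty≡∅ p = ext (λ z z∈ → ⊥-elim (p z z∈)) (λ z z∈ → ⊥-elim (∉∅ z z∈))

  abstract
    ⁅_∙_⁆ : V → V → V
    ⁅ x ∙ y ⁆ = proj₁ (pairing x y)

    isPair-⁅⁆ : ∀ x y → IsPair ⁅ x ∙ y ⁆ x y
    isPair-⁅⁆ x y = proj₂ (pairing x y)

  isPair-unique : ∀ {w w′ x y} → IsPair w x y → IsPair w′ x y → w ≡ w′
  isPair-unique p q = ext (λ z z∈ → from (q z) (to (p z) z∈)) (λ z z∈ → from (p z) (to (q z) z∈))

  ⁅_⁆ : V → V
  ⁅ x ⁆ = ⁅ x ∙ x ⁆

  ∈⁅⁆ : ∀ x → x ∈ ⁅ x ⁆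
  ∈⁅⁆ x = from (isPair-⁅⁆ x x x) (inj₁ refl)

  ∈⁅⁆⁻ : ∀ {x y} → y ∈ ⁅ x ⁆ → y ≡ x
  ∈⁅⁆⁻ y∈ with to (isPair-⁅⁆ _ _ _) y∈
  ... | inj₁ e = e
  ... | inj₂ e = e

  ∪⁻ : ∀ {x y z} → z ∈ x ∪ y → z ∈ x ⊎ z ∈ y
  ∪⁻ {x} {y} {z} z∈ with to (proj₂ (union _) z) z∈
  ... | w , z∈w , w∈ with to (proj₂ (pairing x y) w) w∈
  ... | inj₁ refl = inj₁ z∈w
  ... | inj₂ refl = inj₂ z∈w

  infixl 6 _⨾_
  abstract
    _⨾_ : V → V → V
    v ⨾ y = v ∪ ⁅ y ⁆

    ⨾-old : ∀ {v y z} → z ∈ v → z ∈ v ⨾ y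
    ⨾-old = ∪-inl _ _ _

    ⨾-new : ∀ {v y} → y ∈ v ⨾ y
    ⨾-new = ∪-inr _ _ _ (∈⁅⁆ _)

    ⨾⁻ : ∀ {v y z} → z ∈ v ⨾ y → z ∈ v ⊎ z ≡ y
    ⨾⁻ z∈ with ∪⁻ z∈
    ... | inj₁ p = inj₁ p
    ... | inj₂ p = inj₂ (∈⁅⁆⁻ p)

  infixl 6 _−_ _∩_ _∖_
  abstract
    _−_ _∩_ _∖_ : V → V → V
    v − y = sep (¬̇ (v0 ≐ v1)) (y ∷ []) v
    u ∩ v = sep (v0 ∈̇ v1) (v ∷ []) u
    u ∖ v = sep (¬̇ (v0 ∈̇ v1)) (v ∷ []) u

    −⁺ : ∀ {v y z} → z ∈ v → ¬ z ≡ y → z ∈ v − y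
    −⁺ = sep⁺ (¬̇ (v0 ≐ v1)) _ _

    −⁻ : ∀ {v y z} → z ∈ v − y → z ∈ v × ¬ z ≡ y
    −⁻ = sep⁻ (¬̇ (v0 ≐ v1)) _ _

    ∩⁺ : ∀ {v y z} → z ∈ v → z ∈ y → z ∈ v ∩ y
    ∩⁺ = sep⁺ (v0 ∈̇ v1) _ _

    ∩⁻ : ∀ {v y z} → z ∈ v ∩ y → z ∈ v × z ∈ y
    ∩⁻ = sep⁻ (v0 ∈̇ v1) _ _

    ∖⁺ : ∀ {v y z} → z ∈ v → ¬ z ∈ y → z ∈ v ∖ y
    ∖⁺ = sep⁺ (¬̇ (v0 ∈̇ v1)) _ _

    ∖⁻ : ∀ {v y z} → z ∈ v ∖ y → z ∈ v × ¬ z ∈ y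
    ∖⁻ = sep⁻ (¬̇ (v0 ∈̇ v1)) _ _

  abstract
    ⟨_,_⟩ : V → V → V
    ⟨ x , y ⟩ = ⁅ ⁅ x ⁆ ∙ ⁅ x ∙ y ⁆ ⁆

    isOrderedPair-⟨⟩ : ∀ x y → IsOrderedPair ⟨ x , y ⟩ x y
    isOrderedPair-⟨⟩ x y w = mk⇔ left right
      where
      left : w ∈ ⟨ x , y ⟩ → IsPair w x x ⊎ IsPair w x y
      left w∈ with to (isPair-⁅⁆ _ _ w) w∈
      ... | inj₁ refl = inj₁ (isPair-⁅⁆ x x)
      ... | inj₂ refl = inj₂ (isPair-⁅⁆ x y)
      right : IsPair w x x ⊎ IsPair w x y → w ∈ ⟨ x , y ⟩
      right (inj₁ p) = from (isPair-⁅⁆ _ _ w) (inj₁ (isPair-unique p (isPair-⁅⁆ x x)))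
      right (inj₂ p) = from (isPair-⁅⁆ _ _ w) (inj₂ (isPair-unique p (isPair-⁅⁆ x y)))

    orderedPair≡ : ∀ {p x y} → IsOrderedPair p x y → p ≡ ⟨ x , y ⟩
    orderedPair≡ {p} {x} {y} h =
      ext (λ w w∈ → from (isOrderedPair-⟨⟩ x y w) (to (h w) w∈))
          (λ w w∈ → from (h w) (to (isOrderedPair-⟨⟩ x y w) w∈))

  ⁅⁆-injective : ∀ {x y x′ y′} → ⁅ x ∙ y ⁆ ≡ ⁅ x′ ∙ y′ ⁆ → (x ≡ x′ × y ≡ y′) ⊎ (x ≡ y′ × y ≡ x′)
  ⁅⁆-injective {x} {y} {x′} {y′} e
    with to (isPair-⁅⁆ x′ y′ x) (subst (x ∈_) e (from (isPair-⁅⁆ x y x) (inj₁ refl)))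
       | to (isPair-⁅⁆ x′ y′ y) (subst (y ∈_) e (from (isPair-⁅⁆ x y y) (inj₂ refl)))
       | to (isPair-⁅⁆ x y x′) (subst (x′ ∈_) (sym e) (from (isPair-⁅⁆ x′ y′ x′) (inj₁ refl)))
       | to (isPair-⁅⁆ x y y′) (subst (y′ ∈_) (sym e) (from (isPair-⁅⁆ x′ y′ y′) (inj₂ refl)))
  ... | inj₁ refl | inj₂ refl | _ | _ = inj₁ (refl , refl)
  ... | inj₂ refl | inj₁ refl | _ | _ = inj₂ (refl , refl)
  ... | inj₁ refl | inj₁ refl | _ | inj₁ refl = inj₁ (refl , refl)
  ... | inj₁ refl | inj₁ refl | _ | inj₂ refl = inj₁ (refl , refl)
  ... | inj₂ refl | inj₂ refl | inj₁ refl | _ = inj₁ (refl , refl)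
  ... | inj₂ refl | inj₂ refl | inj₂ refl | _ = inj₁ (refl , refl)

  abstract
    ⟨⟩-injective : ∀ {x y x′ y′} → ⟨ x , y ⟩ ≡ ⟨ x′ , y′ ⟩ → x ≡ x′ × y ≡ y′
    ⟨⟩-injective e with ⁅⁆-injective e
    ... | inj₁ (p , q) with ⁅⁆-injective p | ⁅⁆-injective q
    ...   | inj₁ (refl , _) | inj₁ (_ , e′) = refl , e′
    ...   | inj₁ (refl , _) | inj₂ (refl , refl) = refl , refl
    ...   | inj₂ (refl , _) | inj₁ (_ , e′) = refl , e′
    ...   | inj₂ (refl , _) | inj₂ (refl , refl) = refl , refl
    ⟨⟩-injective e | inj₂ (p , q) with ⁅⁆-injective p | ⁅⁆-injective q
    ...   | inj₁ (refl , refl) | inj₁ (refl , refl) = refl , refl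
    ...   | inj₁ (refl , refl) | inj₂ (refl , refl) = refl , refl
    ...   | inj₂ (refl , refl) | inj₁ (refl , refl) = refl , refl
    ...   | inj₂ (refl , refl) | inj₂ (refl , refl) = refl , refl

  orderedPair-injective : ∀ {p x y x′ y′} → IsOrderedPair p x y → IsOrderedPair p x′ y′ → x ≡ x′ × y ≡ y′
  orderedPair-injective h h′ = ⟨⟩-injective (trans (sym (orderedPair≡ h)) (orderedPair≡ h′))

  maps⁺ : ∀ {f x y} → ⟨ x , y ⟩ ∈ f → Maps f x y
  maps⁺ p = _ , isOrderedPair-⟨⟩ _ _ , p

  maps⁻ : ∀ {f x y} → Maps f x y → ⟨ x , y ⟩ ∈ f
  maps⁻ (p , h , p∈) = subst (_∈ _) (orderedPair≡ h) p∈

  -- The variables of φ are b, a, the pair ⟨ a , b ⟩, A, B, and then the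
  -- parameters ρ.
  abstract
    rel : ∀ {n} → Formula (1+ 1+ 1+ 1+ 1+ n) → Vec V n → V → V → V
    rel φ ρ A B =
      sep (∃̇ ∃̇ (isOrderedPair v2 v1 v0 ∧̇ v1 ∈̇ v3 ∧̇ v0 ∈̇ v4 ∧̇ φ)) (A ∷ B ∷ ρ) (𝒫 (𝒫 (A ∪ B)))

    rel⁻ : ∀ {n} (φ : Formula (1+ 1+ 1+ 1+ 1+ n)) ρ A B {p} → p ∈ rel φ ρ A B →
           ∃[ a ] ∃[ b ] IsOrderedPair p a b × a ∈ A × b ∈ B × Sat φ (b ∷ a ∷ p ∷ A ∷ B ∷ ρ)
    rel⁻ φ ρ A B p∈ = proj₂ (sep⁻ (∃̇ ∃̇ (isOrderedPair v2 v1 v0 ∧̇ v1 ∈̇ v3 ∧̇ v0 ∈̇ v4 ∧̇ φ)) _ _ p∈)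

    rel-∈ : ∀ {n} (φ : Formula (1+ 1+ 1+ 1+ 1+ n)) ρ A B {a b} → a ∈ A → b ∈ B →
            Sat φ (b ∷ a ∷ ⟨ a , b ⟩ ∷ A ∷ B ∷ ρ) → ⟨ a , b ⟩ ∈ rel φ ρ A B
    rel-∈ φ ρ A B {a} {b} a∈ b∈ s =
      sep⁺ (∃̇ ∃̇ (isOrderedPair v2 v1 v0 ∧̇ v1 ∈̇ v3 ∧̇ v0 ∈̇ v4 ∧̇ φ)) _ _
        (orderedPair⊆ (isOrderedPair-⟨⟩ a b) (∪-inl _ _ _ a∈) (∪-inr _ _ _ b∈))
        (a , b , isOrderedPair-⟨⟩ a b , a∈ , b∈ , s)

  module _ {n} (φ : Formula (1+ 1+ 1+ 1+ 1+ n)) (ρ : Vec V n) (A B : V) where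

    rel-maps⁻ : ∀ {a b} → Maps (rel φ ρ A B) a b → a ∈ A × b ∈ B × ∃[ p ] Sat φ (b ∷ a ∷ p ∷ A ∷ B ∷ ρ)
    rel-maps⁻ (p , h , p∈) with rel⁻ φ ρ A B p∈
    ... | a , b , h′ , a∈ , b∈ , s with orderedPair-injective h h′
    ... | refl , refl = a∈ , b∈ , p , s

    rel-maps⁺ : ∀ {a b} → a ∈ A → b ∈ B → (∀ p → Sat φ (b ∷ a ∷ p ∷ A ∷ B ∷ ρ)) → Maps (rel φ ρ A B) a b
    rel-maps⁺ a∈ b∈ s = maps⁺ (rel-∈ φ ρ A B a∈ b∈ (s _))

  infixl 7 _⊗_
  abstract
    _⊗_ : V → V → V
    A ⊗ B = rel (v0 ≐ v0) [] A B

    ⊗⁺ : ∀ {A B a b} → a ∈ A → b ∈ B → ⟨ a , b ⟩ ∈ A ⊗ B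
    ⊗⁺ a∈ b∈ = maps⁻ (rel-maps⁺ (v0 ≐ v0) [] _ _ a∈ b∈ λ _ → refl)

    ⊗⁻ : ∀ {A B p} → p ∈ A ⊗ B → ∃[ a ] ∃[ b ] p ≡ ⟨ a , b ⟩ × a ∈ A × b ∈ B
    ⊗⁻ p∈ with rel⁻ (v0 ≐ v0) [] _ _ p∈
    ... | a , b , h , a∈ , b∈ , _ = a , b , orderedPair≡ h , a∈ , b∈

  ⊗⁻′ : ∀ {A B a b} → ⟨ a , b ⟩ ∈ A ⊗ B → a ∈ A × b ∈ B
  ⊗⁻′ p∈ with ⊗⁻ p∈
  ... | a , b , e , a∈ , b∈ with ⟨⟩-injective e
  ... | refl , refl = a∈ , b∈

  maps-⊗ : ∀ {R A B a b} → R ⊆ (A ⊗ B) → Maps R a b → a ∈ A × b ∈ B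
  maps-⊗ R⊆ m = ⊗⁻′ (R⊆ _ (maps⁻ m))

  rel-⊆ : ∀ {n} (φ : Formula (1+ 1+ 1+ 1+ 1+ n)) ρ A B → rel φ ρ A B ⊆ (A ⊗ B)
  rel-⊆ φ ρ A B p p∈ with rel⁻ φ ρ A B p∈
  ... | a , b , h , a∈ , b∈ , _ = subst (_∈ A ⊗ B) (sym (orderedPair≡ h)) (⊗⁺ a∈ b∈)

-- Ordinals, natural numbers and well-orders.

isTransitive isOrdinal : Fin n → Formula n
isTransitive a = ∀̇ (v0 ∈̇ ↑ a ⇒̇ (∀̇ (v0 ∈̇ v1 ⇒̇ v0 ∈̇ ↑ ↑ a)))
isOrdinal a = isTransitive a ∧̇ (∀̇ (v0 ∈̇ ↑ a ⇒̇ isTransitive v0))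

maps₂ : Fin n → Fin n → Fin n → Fin n → Formula n
maps₂ G x y z = ∃̇ (isOrderedPair v0 (↑ x) (↑ y) ∧̇ maps (↑ G) v0 (↑ z))

module Ordinals {ℓ : Level} (M : ZFModel ℓ) where
  open ZFModel M
  open Basics M

  ∈-irrefl : ∀ {x} → ¬ x ∈ x
  ∈-irrefl {x} x∈x with ∈-minimal ⁅ x ⁆ (x , ∈⁅⁆ x)
  ... | m , m∈ , p with ∈⁅⁆⁻ m∈
  ... | refl = p x m∈ x∈x

  ∈-asym : ∀ {x y} → x ∈ y → ¬ y ∈ x
  ∈-asym {x} {y} x∈y y∈x with ∈-minimal (⁅ x ⁆ ⨾ y) (y , ⨾-new)
  ... | m , m∈ , p with ⨾⁻ m∈
  ... | inj₂ refl = p x (⨾-old (∈⁅⁆ x)) x∈y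
  ... | inj₁ m∈′ with ∈⁅⁆⁻ m∈′
  ... | refl = p y ⨾-new y∈x

  -- Foundation already makes membership well-founded, so a transitive set of transitive sets is an
  -- ordinal; linearity is `∈-trichotomy`.
  IsTransitive IsOrdinal : V → Set ℓ
  IsTransitive a = ∀ x → x ∈ a → ∀ y → y ∈ x → y ∈ a
  IsOrdinal a = IsTransitive a × (∀ x → x ∈ a → IsTransitive x)

  ordinal-∈ : ∀ {α β} → IsOrdinal α → β ∈ α → IsOrdinal β
  ordinal-∈ (tα , t) β∈ = t _ β∈ , λ x x∈ → t x (tα _ β∈ x x∈)

  ordinal-suc : ∀ {α} → IsOrdinal α → IsOrdinal (α ⨾ α)
  ordinal-suc {α} (tα , t) = t₁ , t₂
    where
    t₁ : IsTransitive (α ⨾ α)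
    t₁ x x∈ y y∈ with ⨾⁻ x∈
    ... | inj₁ p = ⨾-old (tα x p y y∈)
    ... | inj₂ refl = ⨾-old y∈
    t₂ : ∀ x → x ∈ α ⨾ α → IsTransitive x
    t₂ x x∈ with ⨾⁻ x∈
    ... | inj₁ p = t x p
    ... | inj₂ refl = tα

  Comparable : V → V → Set ℓ
  Comparable x y = x ∈ y ⊎ x ≡ y ⊎ y ∈ x

  private
    comparable : Fin n → Fin n → Formula n
    comparable x y = x ∈̇ y ∨̇ x ≐ y ∨̇ y ∈̇ x

  -- Take a minimal `x` that is incomparable with something, then a minimal `y` incomparable with
  -- `x`. By minimality and transitivity both have the same elements, so they are equal after all.
  -- Working inside the successors of `α` and `β` puts `α` and `β` themselves among the candidates.
  ∈-trichotomy : ∀ {α β} → IsOrdinal α → IsOrdinal β → Comparable α β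
  ∈-trichotomy {α} {β} oα oβ with nonempty? A
    where
    A = sep (∃̇ (v0 ∈̇ v2 ∧̇ ¬̇ (comparable v1 v0))) (β ⨾ β ∷ []) (α ⨾ α)
  ... | inj₂ none with excluded-middle (comparable v0 v1) (α ∷ β ∷ [])
  ...   | yes c = c
  ...   | no ¬c = ⊥-elim (none α (sep⁺ (∃̇ (v0 ∈̇ v2 ∧̇ ¬̇ (comparable v1 v0))) _ _ ⨾-new (β , ⨾-new , ¬c)))
  ∈-trichotomy {α} {β} oα oβ | inj₁ ne with ∈-minimal _ ne
  ... | x , x∈A , x-min with sep⁻ (∃̇ (v0 ∈̇ v2 ∧̇ ¬̇ (comparable v1 v0))) _ _ x∈A
  ... | x∈ , y₀ , y₀∈ , ¬c₀
    with ∈-minimal (sep (¬̇ (comparable v1 v0)) (x ∷ []) (β ⨾ β))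
                   (y₀ , sep⁺ (¬̇ (comparable v1 v0)) _ _ y₀∈ ¬c₀)
  ... | y , y∈B , y-min with sep⁻ (¬̇ (comparable v1 v0)) _ _ y∈B
  ... | y∈ , ¬c = ⊥-elim (¬c (inj₂ (inj₁ (ext x⊆y y⊆x))))
    where
    x⊆y : ∀ z → z ∈ x → z ∈ y
    x⊆y z z∈x with excluded-middle (comparable v0 v1) (z ∷ y ∷ [])
    ... | yes (inj₁ p) = p
    ... | yes (inj₂ (inj₁ refl)) = ⊥-elim (¬c (inj₂ (inj₂ z∈x)))
    ... | yes (inj₂ (inj₂ p)) = ⊥-elim (¬c (inj₂ (inj₂ (proj₂ (ordinal-suc oα) x x∈ z z∈x y p))))
    ... | no ¬p = ⊥-elim (x-min z (sep⁺ (∃̇ (v0 ∈̇ v2 ∧̇ ¬̇ (comparable v1 v0))) _ _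
                            (proj₁ (ordinal-suc oα) x x∈ z z∈x) (y , y∈ , ¬p)) z∈x)
    y⊆x : ∀ z → z ∈ y → z ∈ x
    y⊆x z z∈y with excluded-middle (comparable v0 v1) (x ∷ z ∷ [])
    ... | yes (inj₁ p) = ⊥-elim (¬c (inj₁ (proj₂ (ordinal-suc oβ) y y∈ z z∈y x p)))
    ... | yes (inj₂ (inj₁ refl)) = ⊥-elim (¬c (inj₁ z∈y))
    ... | yes (inj₂ (inj₂ p)) = p
    ... | no ¬p = ⊥-elim (y-min z (sep⁺ (¬̇ (comparable v1 v0)) _ _
                            (proj₁ (ordinal-suc oβ) y y∈ z z∈y) ¬p) z∈y)

  isSuccessor-⨾ : ∀ n → IsSuccessor (n ⨾ n) n
  isSuccessor-⨾ n z = mk⇔ ⨾⁻ λ { (inj₁ p) → ⨾-old p ; (inj₂ refl) → ⨾-new }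

  successor≡ : ∀ {y n} → IsSuccessor y n → y ≡ n ⨾ n
  successor≡ {n = n} s = ext (λ z z∈ → from (isSuccessor-⨾ n z) (to (s z) z∈))
                             (λ z z∈ → from (s z) (to (isSuccessor-⨾ n z) z∈))

  0∈ω : ∅ ∈ ω
  0∈ω = from (∈-ω ∅) λ { I ((e , emp , e∈) , _) → subst (_∈ I) (empty≡∅ emp) e∈ }

  suc∈ω : ∀ {n} → n ∈ ω → n ⨾ n ∈ ω
  suc∈ω {n} n∈ = from (∈-ω _) λ I ind → helper I ind (proj₂ ind n (to (∈-ω n) n∈ I ind))
    where
    helper : ∀ I → IsInductive I → (∃[ y ] IsSuccessor y n × y ∈ I) → n ⨾ n ∈ I
    helper I _ (y , s , y∈) = subst (_∈ I) (successor≡ s) y∈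

  ω-ind : ∀ {k} (φ : Formula (1+ k)) ρ → Sat φ (∅ ∷ ρ) →
          (∀ n → n ∈ ω → Sat φ (n ∷ ρ) → Sat φ (n ⨾ n ∷ ρ)) → ∀ n → n ∈ ω → Sat φ (n ∷ ρ)
  ω-ind φ ρ base step n n∈ = proj₂ (sep⁻ φ ρ ω (to (∈-ω n) n∈ (sep φ ρ ω)
    ((∅ , ∉∅ , sep⁺ φ ρ ω 0∈ω base) , λ x x∈ → let x∈ω , s = sep⁻ φ ρ ω x∈ in
       x ⨾ x , isSuccessor-⨾ x , sep⁺ φ ρ ω (suc∈ω x∈ω) (step x x∈ω s))))

  ω-transitive : IsTransitive ω
  ω-transitive n n∈ = ω-ind (∀̇ (v0 ∈̇ v1 ⇒̇ v0 ∈̇ v2)) (ω ∷ []) (λ y y∈ → ⊥-elim (∉∅ y y∈)) step n n∈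
    where
    step : ∀ n → n ∈ ω → (∀ y → y ∈ n → y ∈ ω) → ∀ y → y ∈ n ⨾ n → y ∈ ω
    step n n∈ ih y y∈ with ⨾⁻ y∈
    ... | inj₁ p = ih y p
    ... | inj₂ refl = n∈

  abstract
    ω-least : ∀ {k} (φ : Formula (1+ k)) ρ n → n ∈ ω → Sat φ (n ∷ ρ) →
              ∃[ m ] m ∈ ω × Sat φ (m ∷ ρ) × (∀ m′ → m′ ∈ m → ¬ Sat φ (m′ ∷ ρ))
    ω-least φ ρ n n∈ s with ∈-minimal (sep φ ρ ω) (n , sep⁺ φ ρ ω n∈ s)
    ... | m , m∈ , least with sep⁻ φ ρ ω m∈
    ... | m∈ω , s′ = m , m∈ω , s′ , λ m′ m′∈ s″ → least m′ (sep⁺ φ ρ ω (ω-transitive m m∈ω m′ m′∈) s″) m′∈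

  nat-ordinal : ∀ {n} → n ∈ ω → IsOrdinal n
  nat-ordinal {n} = ω-ind (isOrdinal v0) [] ((λ x x∈ → ⊥-elim (∉∅ x x∈)) , λ x x∈ → ⊥-elim (∉∅ x x∈))
    (λ _ _ → ordinal-suc) n

  ω-ordinal : IsOrdinal ω
  ω-ordinal = ω-transitive , λ x x∈ → proj₁ (nat-ordinal x∈)

  0-or-suc : ∀ n → n ∈ ω → n ≡ ∅ ⊎ (∃[ m ] m ∈ ω × n ≡ m ⨾ m)
  0-or-suc n n∈ with ω-ind (isEmpty v0 ∨̇ (∃̇ (v0 ∈̇ v2 ∧̇ isSuccessor v1 v0))) (ω ∷ []) (inj₁ ∉∅)
                       (λ m m∈ _ → inj₂ (m , m∈ , isSuccessor-⨾ m)) n n∈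
  ... | inj₁ e = inj₁ (empty≡∅ e)
  ... | inj₂ (m , m∈ , s) = inj₂ (m , m∈ , successor≡ s)

  suc-injective : ∀ {m n} → m ⨾ m ≡ n ⨾ n → m ≡ n
  suc-injective {m} {n} e with ⨾⁻ (subst (m ∈_) e ⨾-new) | ⨾⁻ (subst (n ∈_) (sym e) ⨾-new)
  ... | inj₂ p | _ = p
  ... | inj₁ _ | inj₂ q = sym q
  ... | inj₁ p | inj₁ q = ⊥-elim (∈-asym p q)

  suc≢∅ : ∀ {m} → ¬ m ⨾ m ≡ ∅
  suc≢∅ {m} e = ∉∅ m (subst (m ∈_) e ⨾-new)

  -- Irreflexivity, asymmetry and transitivity are consequences: a cycle of length one, two or three
  -- would be a nonempty set without a minimal element.
  record WellOrder (X R : V) : Set ℓ where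
    field
      field⊆ : ∀ {x y} → Maps R x y → x ∈ X × y ∈ X
      wf     : ∀ U → U ⊆ X → (∃[ x ] x ∈ U) → ∃[ m ] m ∈ U × (∀ z → z ∈ U → ¬ Maps R z m)
      tri    : ∀ {x y} → x ∈ X → y ∈ X → Maps R x y ⊎ x ≡ y ⊎ Maps R y x

    irrefl : ∀ {x} → ¬ Maps R x x
    irrefl {x} r with wf ⁅ x ⁆ (λ z z∈ → subst (_∈ X) (sym (∈⁅⁆⁻ z∈)) (proj₁ (field⊆ r))) (x , ∈⁅⁆ x)
    ... | m , m∈ , p with ∈⁅⁆⁻ m∈
    ... | refl = p x m∈ r

    asym : ∀ {x y} → Maps R x y → ¬ Maps R y x
    asym {x} {y} r s with wf ⁅ x ∙ y ⁆ sub (x , from (isPair-⁅⁆ x y x) (inj₁ refl))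
      where
      sub : ⁅ x ∙ y ⁆ ⊆ X
      sub z z∈ with to (isPair-⁅⁆ x y z) z∈
      ... | inj₁ refl = proj₁ (field⊆ r)
      ... | inj₂ refl = proj₁ (field⊆ s)
    ... | m , m∈ , p with to (isPair-⁅⁆ x y m) m∈
    ... | inj₁ refl = p y (from (isPair-⁅⁆ x y y) (inj₂ refl)) s
    ... | inj₂ refl = p x (from (isPair-⁅⁆ x y x) (inj₁ refl)) r

    transitive : ∀ {x y z} → Maps R x y → Maps R y z → Maps R x z
    transitive {x} {y} {z} r s with tri (proj₁ (field⊆ r)) (proj₂ (field⊆ s))
    ... | inj₁ t = t
    ... | inj₂ (inj₁ refl) = ⊥-elim (asym r s)
    ... | inj₂ (inj₂ t) with wf (⁅ x ∙ y ⁆ ⨾ z) sub (z , ⨾-new)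
      where
      sub : (⁅ x ∙ y ⁆ ⨾ z) ⊆ X
      sub w w∈ with ⨾⁻ w∈
      ... | inj₂ refl = proj₂ (field⊆ s)
      ... | inj₁ q with to (isPair-⁅⁆ x y w) q
      ... | inj₁ refl = proj₁ (field⊆ r)
      ... | inj₂ refl = proj₁ (field⊆ s)
    ... | m , m∈ , p with ⨾⁻ m∈
    ... | inj₂ refl = ⊥-elim (p y (⨾-old (from (isPair-⁅⁆ x y y) (inj₂ refl))) s)
    ... | inj₁ q with to (isPair-⁅⁆ x y m) q
    ... | inj₁ refl = ⊥-elim (p z ⨾-new t)
    ... | inj₂ refl = ⊥-elim (p x (⨾-old (from (isPair-⁅⁆ x y x) (inj₁ refl))) r)

    wf-ind : ∀ {k} (φ : Formula (1+ k)) ρ →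
             (∀ x → x ∈ X → (∀ y → Maps R y x → Sat φ (y ∷ ρ)) → Sat φ (x ∷ ρ)) →
             ∀ x → x ∈ X → Sat φ (x ∷ ρ)
    wf-ind φ ρ prog x x∈ with excluded-middle φ (x ∷ ρ)
    ... | yes s = s
    ... | no ¬s with wf (sep (¬̇ φ) ρ X) (λ z z∈ → proj₁ (sep⁻ (¬̇ φ) ρ X z∈)) (x , sep⁺ (¬̇ φ) ρ X x∈ ¬s)
    ... | m , m∈ , p with sep⁻ (¬̇ φ) ρ X m∈
    ... | m∈X , ¬m = ⊥-elim (¬m (prog m m∈X λ y r → case y r (excluded-middle φ (y ∷ ρ))))
      where
      case : ∀ y → Maps R y m → Dec (Sat φ (y ∷ ρ)) → Sat φ (y ∷ ρ)
      case y r (yes s) = s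
      case y r (no ¬s) = ⊥-elim (p y (sep⁺ (¬̇ φ) ρ X (proj₁ (field⊆ r)) ¬s) r)

  ∈-on : V → V
  ∈-on α = rel (v1 ∈̇ v0) [] α α

  ∈-on⁺ : ∀ {α x y} → x ∈ α → y ∈ α → x ∈ y → Maps (∈-on α) x y
  ∈-on⁺ x∈ y∈ p = rel-maps⁺ (v1 ∈̇ v0) [] _ _ x∈ y∈ λ _ → p

  ∈-on⁻ : ∀ {α x y} → Maps (∈-on α) x y → x ∈ α × y ∈ α × x ∈ y
  ∈-on⁻ m with rel-maps⁻ (v1 ∈̇ v0) [] _ _ m
  ... | x∈ , y∈ , _ , p = x∈ , y∈ , p

  ordinal-wellOrder : ∀ {α} → IsOrdinal α → WellOrder α (∈-on α)
  ordinal-wellOrder {α} oα = record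
    { field⊆ = λ m → let x∈ , y∈ , _ = ∈-on⁻ m in x∈ , y∈
    ; wf = λ U U⊆ ne → let m , m∈ , p = ∈-minimal U ne in
                        m , m∈ , λ z z∈ r → p z z∈ (proj₂ (proj₂ (∈-on⁻ r)))
    ; tri = tri
    }
    where
    tri : ∀ {x y} → x ∈ α → y ∈ α → Maps (∈-on α) x y ⊎ x ≡ y ⊎ Maps (∈-on α) y x
    tri x∈ y∈ with ∈-trichotomy (ordinal-∈ oα x∈) (ordinal-∈ oα y∈)
    ... | inj₁ p = inj₁ (∈-on⁺ x∈ y∈ p)
    ... | inj₂ (inj₁ e) = inj₂ (inj₁ e)
    ... | inj₂ (inj₂ p) = inj₂ (inj₂ (∈-on⁺ y∈ x∈ p))

  abstract
    ω-wellOrder : WellOrder ω (∈-on ω)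
    ω-wellOrder = ordinal-wellOrder ω-ordinal

-- Transfinite recursion along a well-order.

module Recursion {ℓ : Level} (M : ZFModel ℓ) where
  open ZFModel M
  open Basics M
  open Ordinals M

  Maps₂ : V → V → V → V → Set ℓ
  Maps₂ G x y z = ∃[ p ] IsOrderedPair p x y × Maps G p z

  maps₂-⟨⟩ : ∀ {G x y z} → Maps G ⟨ x , y ⟩ z → Maps₂ G x y z
  maps₂-⟨⟩ m = _ , isOrderedPair-⟨⟩ _ _ , m

  maps₂⁻ : ∀ {G x y z} → Maps₂ G x y z → Maps G ⟨ x , y ⟩ z
  maps₂⁻ (p , h , m) = subst (λ p → Maps _ p _) (orderedPair≡ h) m

  Functional : V → Set ℓ
  Functional f = ∀ {x y y′} → Maps f x y → Maps f x y′ → y ≡ y′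

  -- G ⟨ g , u ⟩ is the value at u prescribed when g is the restriction of the
  -- function under construction to the predecessors of u.
  module _ {X R : V} (wo : WellOrder X R) (Y G : V) where
    open WellOrder wo

    IsRestriction : V → V → V → Set ℓ
    IsRestriction g a v = ∀ p → p ∈ g ⇔ (p ∈ a × ∃[ w ] ∃[ r ] IsOrderedPair p w r × Maps R w v)

    private
      isRestriction : Fin n → Fin n → Fin n → Fin n → Formula n
      isRestriction R g a v =
        ∀̇ (v0 ∈̇ ↑ g ⇔̇ (v0 ∈̇ ↑ a ∧̇ (∃̇ ∃̇ (isOrderedPair v2 v1 v0 ∧̇ maps (↑ ↑ ↑ R) v1 (↑ ↑ ↑ v)))))

      isApproximation : Fin n → Fin n → Fin n → Formula n
      isApproximation R G a
        = (∀̇ ∀̇ (maps (↑ ↑ a) v1 v0 ⇒̇ (∀̇ (maps (↑ ↑ ↑ R) v0 v2 ⇒̇ (∃̇ maps (↑ ↑ ↑ ↑ a) v1 v0)))))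
        ∧̇ (∀̇ ∀̇ (maps (↑ ↑ a) v1 v0 ⇒̇ (∃̇ (isRestriction (↑ ↑ ↑ R) v0 (↑ ↑ ↑ a) v2 ∧̇ maps₂ (↑ ↑ ↑ G) v0 v2 v1))))

    abstract
      IsApproximation : V → Set ℓ
      IsApproximation a
        = (∀ v s → Maps a v s → ∀ w → Maps R w v → ∃[ r ] Maps a w r)
        × (∀ v s → Maps a v s → ∃[ g ] IsRestriction g a v × Maps₂ G g v s)

      approximation-closed : ∀ {a} → IsApproximation a → ∀ v s → Maps a v s → ∀ w → Maps R w v → ∃[ r ] Maps a w r
      approximation-closed = proj₁

      _↾_ : V → V → V
      a ↾ v = sep (∃̇ ∃̇ (isOrderedPair v2 v1 v0 ∧̇ maps v4 v1 v3)) (v ∷ R ∷ []) a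

      isRestriction-↾ : ∀ a v → IsRestriction (a ↾ v) a v
      isRestriction-↾ a v = ∈-sep (∃̇ ∃̇ (isOrderedPair v2 v1 v0 ∧̇ maps v4 v1 v3)) (v ∷ R ∷ []) a

    restriction≡ : ∀ {g a v} → IsRestriction g a v → g ≡ a ↾ v
    restriction≡ {a = a} {v} h = ext (λ p p∈ → from (isRestriction-↾ a v p) (to (h p) p∈))
                               (λ p p∈ → from (h p) (to (isRestriction-↾ a v p) p∈))

    ↾⁺ : ∀ {a v w r} → Maps a w r → Maps R w v → Maps (a ↾ v) w r
    ↾⁺ {a} {v} {w} {r} m lt = maps⁺ (from (isRestriction-↾ a v _) (maps⁻ m , w , r , isOrderedPair-⟨⟩ w r , lt))

    ↾⁻ : ∀ {a v w r} → Maps (a ↾ v) w r → Maps a w r × Maps R w v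
    ↾⁻ {a} {v} m with to (isRestriction-↾ a v _) (maps⁻ m)
    ... | p∈ , w , r , h , lt with orderedPair-injective h (isOrderedPair-⟨⟩ _ _)
    ... | refl , refl = maps⁺ p∈ , lt

    ↾-⊆ : ∀ {a v} → (a ↾ v) ⊆ a
    ↾-⊆ {a} {v} p p∈ = proj₁ (to (isRestriction-↾ a v p) p∈)

    ↾-cong : ∀ {a b v} → (∀ {w r} → Maps R w v → Maps a w r → Maps b w r) →
             (∀ {w r} → Maps R w v → Maps b w r → Maps a w r) → a ↾ v ≡ b ↾ v
    ↾-cong {a} {b} {v} h h′ = ext (sub h) (sub h′)
      where
      sub : ∀ {a b} → (∀ {w r} → Maps R w v → Maps a w r → Maps b w r) → ∀ p → p ∈ a ↾ v → p ∈ b ↾ v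
      sub {a} {b} h p p∈ with to (isRestriction-↾ a v p) p∈
      ... | p∈a , w , r , op , lt with orderedPair≡ op
      ... | refl = maps⁻ (↾⁺ (h lt (maps⁺ p∈a)) lt)

    abstract
      approximation-value : ∀ {a v s} → IsApproximation a → Maps a v s → Maps₂ G (a ↾ v) v s
      approximation-value (_ , val) m with val _ _ m
      ... | g , h , q with restriction≡ h
      ... | refl = q

      approximation⁺ : ∀ {a} → (∀ v s → Maps a v s → ∀ w → Maps R w v → ∃[ r ] Maps a w r) →
                       (∀ v s → Maps a v s → Maps₂ G (a ↾ v) v s) → IsApproximation a
      approximation⁺ {a} c d = c , λ v s m → a ↾ v , isRestriction-↾ a v , d v s m

    module _ (G-functional : ∀ {g u s s′} → Functional g → Maps₂ G g u s → Maps₂ G g u s′ → s ≡ s′) where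

      -- By induction the restrictions of `a` and `b` to the predecessors of `v` coincide, so `G`
      -- prescribes the same value for both.
      approximations-agree : ∀ {a b} → IsApproximation a → IsApproximation b →
                             ∀ v → v ∈ X → ∀ s s′ → Maps a v s → Maps b v s′ → s ≡ s′
      approximations-agree {a} {b} aa ab =
        wf-ind (∀̇ ∀̇ (maps v3 v2 v1 ⇒̇ maps v4 v2 v0 ⇒̇ v1 ≐ v0)) (a ∷ b ∷ []) step
        where
        step : ∀ v → v ∈ X → (∀ w → Maps R w v → ∀ s s′ → Maps a w s → Maps b w s′ → s ≡ s′) →
               ∀ s s′ → Maps a v s → Maps b v s′ → s ≡ s′
        step v v∈ ih s s′ m m′ =
          G-functional fun (approximation-value aa m)
            (subst (λ g → Maps₂ G g v s′) (sym (↾-cong l r)) (approximation-value ab m′))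
          where
          -- Approximations are not assumed functional. Two values of `a` at a predecessor are
          -- compared through the value of `b` there, with which both agree by induction.
          fun : Functional (a ↾ v)
          fun q q′ = let q₁ , lt = ↾⁻ q ; q₂ , _ = ↾⁻ q′ ; _ , q₃ = approximation-closed ab v s′ m′ _ lt in
            trans (ih _ lt _ _ q₁ q₃) (sym (ih _ lt _ _ q₂ q₃))
          l : ∀ {w r} → Maps R w v → Maps a w r → Maps b w r
          l lt q with approximation-closed ab v s′ m′ _ lt
          ... | r′ , q′ with ih _ lt _ _ q q′
          ... | refl = q′
          r : ∀ {w r} → Maps R w v → Maps b w r → Maps a w r
          r lt q with approximation-closed aa v s m _ lt
          ... | r′ , q′ with ih _ lt _ _ q′ q
          ... | refl = q′

      private
        φ : Formula 6
        φ = ∃̇ (v0 ∈̇ v2 ∧̇ isApproximation v3 v4 v0 ∧̇ v1 ∈̇ v0)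

        ρ : Vec V 5
        ρ = 𝒫 (X ⊗ Y) ∷ R ∷ G ∷ X ∷ Y ∷ []

      abstract
        -- The union of all approximations. Asking them to be subsets of `X ⊗ Y` is what lets a
        -- formula with parameters quantify over them.
        H : V
        H = sep φ ρ (X ⊗ Y)

        H-⊆ : H ⊆ (X ⊗ Y)
        H-⊆ p p∈ = proj₁ (sep⁻ φ ρ _ p∈)

        H⁻ : ∀ {v s} → Maps H v s → ∃[ a ] a ⊆ (X ⊗ Y) × IsApproximation a × Maps a v s
        H⁻ m with sep⁻ φ ρ _ (maps⁻ m)
        ... | _ , a , a∈ , ap , p∈ = a , 𝒫⁻ a∈ , ap , maps⁺ p∈

        H⁺ : ∀ {a v s} → a ⊆ (X ⊗ Y) → IsApproximation a → Maps a v s → Maps H v s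
        H⁺ {a} a⊆ ap m = maps⁺ (sep⁺ φ ρ _ (a⊆ _ (maps⁻ m)) (a , 𝒫⁺ a⊆ , ap , maps⁻ m))

      H-functional : Functional H
      H-functional m m′ with H⁻ m | H⁻ m′
      ... | a , a⊆ , aa , q | b , _ , ab , q′ = approximations-agree aa ab _ (proj₁ (maps-⊗ a⊆ q)) _ _ q q′

      H-approximation : IsApproximation H
      H-approximation = approximation⁺ closed value
        where
        closed : ∀ v s → Maps H v s → ∀ w → Maps R w v → ∃[ r ] Maps H w r
        closed v s m w lt with H⁻ m
        ... | a , a⊆ , aa , q with approximation-closed aa v s q w lt
        ... | r , q′ = r , H⁺ a⊆ aa q′
        value : ∀ v s → Maps H v s → Maps₂ G (H ↾ v) v s
        value v s m with H⁻ m
        ... | a , a⊆ , aa , q = subst (λ g → Maps₂ G g v s) (↾-cong l r) (approximation-value aa q)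
          where
          l : ∀ {w r} → Maps R w v → Maps a w r → Maps H w r
          l _ = H⁺ a⊆ aa
          r : ∀ {w r} → Maps R w v → Maps H w r → Maps a w r
          r lt q′ with approximation-closed aa v s q _ lt
          ... | r′ , q″ with H-functional q′ (H⁺ a⊆ aa q″)
          ... | refl = q″

      ↾-approximation : ∀ {a} v → IsApproximation a → IsApproximation (a ↾ v)
      ↾-approximation {a} v ap = approximation⁺ closed value
        where
        closed : ∀ w s → Maps (a ↾ v) w s → ∀ x → Maps R x w → ∃[ r ] Maps (a ↾ v) x r
        closed w s m x lt with ↾⁻ m
        ... | q , lt′ with approximation-closed ap w s q x lt
        ... | r , q′ = r , ↾⁺ q′ (transitive lt lt′)
        value : ∀ w s → Maps (a ↾ v) w s → Maps₂ G ((a ↾ v) ↾ w) w s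
        value w s m with ↾⁻ m
        ... | q , lt′ = subst (λ g → Maps₂ G g w s)
                (↾-cong (λ lt q′ → ↾⁺ q′ (transitive lt lt′)) (λ lt q′ → proj₁ (↾⁻ q′)))
                (approximation-value ap q)

      -- One more pair at `v` leaves the restriction to `w` unchanged unless `v` precedes `w`, so
      -- the old values stay correct. The enlarged set is again an approximation and is therefore
      -- contained in `H`.
      extension : ∀ v s → v ∈ X → s ∈ Y → (∀ w → Maps R w v → ∃[ r ] Maps H w r) → ¬ (∃[ r ] Maps H v r) →
                  Maps₂ G (H ↾ v) v s → Maps H v s
      extension v s v∈ s∈ ih ¬d val = H⁺ K⊆ K-approximation (maps⁺ ⨾-new)
        where
        K : V
        K = H ⨾ ⟨ v , s ⟩
        K⊆ : K ⊆ (X ⊗ Y)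
        K⊆ p p∈ with ⨾⁻ p∈
        ... | inj₁ q = H-⊆ p q
        ... | inj₂ refl = ⊗⁺ v∈ s∈
        K⁻ : ∀ {w r} → Maps K w r → Maps H w r ⊎ (w ≡ v × r ≡ s)
        K⁻ m with ⨾⁻ (maps⁻ m)
        ... | inj₁ q = inj₁ (maps⁺ q)
        ... | inj₂ e = inj₂ (⟨⟩-injective e)
        K⁺ : ∀ {w r} → Maps H w r → Maps K w r
        K⁺ m = maps⁺ (⨾-old (maps⁻ m))
        restrict : ∀ {w} → ¬ Maps R v w → H ↾ w ≡ K ↾ w
        restrict {w} v≮w = ↾-cong (λ _ → K⁺) l
          where
          l : ∀ {x r} → Maps R x w → Maps K x r → Maps H x r
          l lt m with K⁻ m
          ... | inj₁ q = q
          ... | inj₂ (refl , refl) = ⊥-elim (v≮w lt)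
        closed : ∀ w r → Maps K w r → ∀ x → Maps R x w → ∃[ q ] Maps K x q
        closed w r m x lt with K⁻ m
        ... | inj₁ q = let t , q′ = approximation-closed H-approximation w r q x lt in t , K⁺ q′
        ... | inj₂ (refl , refl) = let t , q′ = ih x lt in t , K⁺ q′
        value : ∀ w r → Maps K w r → Maps₂ G (K ↾ w) w r
        value w r m with K⁻ m
        -- If `v` preceded `w`, closure of `H` under predecessors would already give `H` a value at
        -- `v`.
        ... | inj₁ q = subst (λ g → Maps₂ G g w r) (restrict (λ lt → ¬d (approximation-closed H-approximation w r q v lt)))
                         (approximation-value H-approximation q)
        ... | inj₂ (refl , refl) = subst (λ g → Maps₂ G g w r) (restrict irrefl) val
        K-approximation : IsApproximation K
        K-approximation = approximation⁺ closed value

      module _ (step : ∀ u g → u ∈ X → g ⊆ (X ⊗ Y) → IsApproximation g → Functional g →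
                       (∀ {w r} → Maps g w r → Maps R w u) → (∀ w → Maps R w u → ∃[ r ] Maps g w r) →
                       ∃[ s ] s ∈ Y × Maps₂ G g u s) where

        H-total : ∀ v → v ∈ X → ∃[ s ] Maps H v s
        H-total = wf-ind (∃̇ maps v2 v1 v0) (H ∷ []) prog
          where
          prog : ∀ v → v ∈ X → (∀ w → Maps R w v → ∃[ s ] Maps H w s) → ∃[ s ] Maps H v s
          prog v v∈ ih with excluded-middle (∃̇ maps v2 v1 v0) (v ∷ H ∷ [])
          ... | yes d = d
          ... | no ¬d =
            let s , s∈ , val =
                  step v (H ↾ v) v∈ (λ p p∈ → H-⊆ p (↾-⊆ p p∈)) (↾-approximation v H-approximation)
                    (λ m m′ → H-functional (proj₁ (↾⁻ m)) (proj₁ (↾⁻ m′)))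
                    (λ m → proj₂ (↾⁻ m)) (λ w lt → let r , m = ih w lt in r , ↾⁺ m lt)
            in s , extension v s v∈ s∈ ih ¬d val

        transfinite-recursion : ∃[ h ] h ⊆ (X ⊗ Y) × IsApproximation h × Functional h × (∀ v → v ∈ X → ∃[ s ] Maps h v s)
        transfinite-recursion = H , H-⊆ , H-approximation , H-functional , H-total

    -- Of two arguments with the same value, the earlier one belongs to the restriction that the
    -- value at the later one had to avoid.
    approximation-injective : (∀ {g u s} → Maps₂ G g u s → ¬ (∃[ w ] Maps g w s)) →
      ∀ {a v w s} → a ⊆ (X ⊗ Y) → IsApproximation a → Maps a v s → Maps a w s → v ≡ w
    approximation-injective fresh {a} {v} {w} a⊆ ap m m′ with tri (proj₁ (maps-⊗ a⊆ m)) (proj₁ (maps-⊗ a⊆ m′))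
    ... | inj₁ lt = ⊥-elim (fresh (approximation-value ap m′) (v , ↾⁺ m lt))
    ... | inj₂ (inj₁ e) = e
    ... | inj₂ (inj₂ lt) = ⊥-elim (fresh (approximation-value ap m) (w , ↾⁺ m′ lt))

-- Iteration of a function along `ω`.

module Omega {ℓ : Level} (M : ZFModel ℓ) where
  open ZFModel M
  open Basics M
  open Ordinals M
  open Recursion M
  module _ (T t₀ N : V) (t₀∈ : t₀ ∈ T) (N⊆ : N ⊆ (T ⊗ T)) (N-functional : Functional N)
                     (N-total : ∀ t → t ∈ T → ∃[ t′ ] Maps N t t′) where

    private
      φ : Formula 9
      φ = ∃̇ ∃̇ (isOrderedPair v3 v1 v0 ∧̇
            ((isEmpty v0 ∧̇ v2 ≐ v7) ∨̇ (∃̇ ∃̇ (isSuccessor v2 v1 ∧̇ maps v3 v1 v0 ∧̇ maps v10 v0 v4))))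

      Value : V → V → V → Set ℓ
      Value g n t = (n ≡ ∅ × t ≡ t₀) ⊎ (∃[ m ] ∃[ r ] n ≡ m ⨾ m × Maps g m r × Maps N r t)

      abstract
        G : V
        G = rel φ (t₀ ∷ N ∷ ω ∷ T ∷ []) (𝒫 (ω ⊗ T) ⊗ ω) T

        G⁻ : ∀ {g n t} → Maps₂ G g n t → n ∈ ω × Value g n t
        G⁻ m with rel-maps⁻ φ _ _ _ (maps₂⁻ m)
        ... | gn∈ , _ , _ , g , n , h , val with orderedPair-injective h (isOrderedPair-⟨⟩ _ _)
        ... | refl , refl with val
        ... | inj₁ (e , q) = proj₂ (⊗⁻′ gn∈) , inj₁ (empty≡∅ e , q)
        ... | inj₂ (k , r , s , q , q′) = proj₂ (⊗⁻′ gn∈) , inj₂ (k , r , successor≡ s , q , q′)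

        G⁺ : ∀ {g n t} → g ⊆ (ω ⊗ T) → n ∈ ω → t ∈ T → Value g n t → Maps₂ G g n t
        G⁺ {g} {n} {t} g⊆ n∈ t∈ val =
          maps₂-⟨⟩ (rel-maps⁺ φ _ _ _ (⊗⁺ (𝒫⁺ g⊆) n∈) t∈ λ _ → g , n , isOrderedPair-⟨⟩ g n , conv val)
          where
          conv : Value g n t → (IsEmpty n × t ≡ t₀) ⊎ (∃[ m ] ∃[ r ] IsSuccessor n m × Maps g m r × Maps N r t)
          conv (inj₁ (refl , q)) = inj₁ (∉∅ , q)
          conv (inj₂ (k , r , refl , q)) = inj₂ (k , r , isSuccessor-⨾ k , q)

      G-functional : ∀ {g u s s′} → Functional g → Maps₂ G g u s → Maps₂ G g u s′ → s ≡ s′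
      G-functional fun m m′ with proj₂ (G⁻ m) | proj₂ (G⁻ m′)
      ... | inj₁ (_ , refl) | inj₁ (_ , refl) = refl
      ... | inj₁ (refl , _) | inj₂ (_ , _ , e , _) = ⊥-elim (suc≢∅ (sym e))
      ... | inj₂ (_ , _ , e , _) | inj₁ (refl , _) = ⊥-elim (suc≢∅ (sym e))
      ... | inj₂ (_ , _ , refl , q , p) | inj₂ (_ , _ , e , q′ , p′) with suc-injective e
      ... | refl with fun q q′
      ... | refl = N-functional p p′

      step : ∀ u g → u ∈ ω → g ⊆ (ω ⊗ T) → IsApproximation ω-wellOrder T G g → Functional g →
             (∀ {w r} → Maps g w r → Maps (∈-on ω) w u) →
             (∀ w → Maps (∈-on ω) w u → ∃[ r ] Maps g w r) → ∃[ s ] s ∈ T × Maps₂ G g u s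
      step u g u∈ g⊆ _ _ _ tot with 0-or-suc u u∈
      ... | inj₁ refl = t₀ , t₀∈ , G⁺ g⊆ u∈ t₀∈ (inj₁ (refl , refl))
      ... | inj₂ (m , m∈ , refl) with tot m (∈-on⁺ m∈ u∈ ⨾-new)
      ... | r , q with N-total r (proj₂ (maps-⊗ g⊆ q))
      ... | t , p = let t∈ = proj₂ (maps-⊗ N⊆ p) in t , t∈ , G⁺ g⊆ u∈ t∈ (inj₂ (m , r , refl , q , p))

      module _ (E : V) (E⊆ : E ⊆ (ω ⊗ T)) (ap : IsApproximation ω-wellOrder T G E) (fun : Functional E)
               (tot : ∀ n → n ∈ ω → ∃[ t ] Maps E n t) where

        value : ∀ {n t} → Maps E n t → n ∈ ω × Value (_↾_ ω-wellOrder T G E n) n t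
        value m = G⁻ (approximation-value ω-wellOrder T G ap m)
        zero′ : Maps E ∅ t₀
        zero′ with tot ∅ 0∈ω
        ... | t , m with proj₂ (value m)
        ... | inj₁ (_ , refl) = m
        ... | inj₂ (_ , _ , e , _) = ⊥-elim (suc≢∅ (sym e))
        suc′ : ∀ {n r t} → Maps E n r → Maps N r t → Maps E (n ⨾ n) t
        suc′ {n} m p with tot (n ⨾ n) (suc∈ω (proj₁ (maps-⊗ E⊆ m)))
        ... | t , m′ with proj₂ (value m′)
        ... | inj₁ (e , _) = ⊥-elim (suc≢∅ e)
        ... | inj₂ (_ , _ , e , q , p′) with suc-injective e
        ... | refl with fun m (proj₁ (↾⁻ ω-wellOrder T G q))
        ... | refl with N-functional p p′
        ... | refl = m′

    -- An instance of transfinite recursion in which the value at a successor is read off from the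
    -- restriction at its predecessor. It serves to count binary numerals and to iterate
    -- Kuratowski's splitting step.
    ω-recursion : ∃[ E ] E ⊆ (ω ⊗ T) × Functional E × (∀ n → n ∈ ω → ∃[ t ] Maps E n t) × Maps E ∅ t₀ ×
                  (∀ {n r t} → Maps E n r → Maps N r t → Maps E (n ⨾ n) t)
    ω-recursion =
      let E , E⊆ , ap , fun , tot = transfinite-recursion ω-wellOrder T G G-functional step in
      E , E⊆ , fun , tot , zero′ E E⊆ ap fun tot , suc′ E E⊆ ap fun tot

-- Finite sets.

module FiniteSets {ℓ : Level} (M : ZFModel ℓ) where
  open ZFModel M
  open Basics M
  open Ordinals M
  open Recursion M

  IsAdjunction : V → V → V → Set ℓ
  IsAdjunction w v y = ∀ z → z ∈ w ⇔ (z ∈ v ⊎ z ≡ y)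

  isAdjunction-⨾ : ∀ v y → IsAdjunction (v ⨾ y) v y
  isAdjunction-⨾ v y z = mk⇔ ⨾⁻ λ { (inj₁ p) → ⨾-old p ; (inj₂ refl) → ⨾-new }

  adjunction≡ : ∀ {w v y} → IsAdjunction w v y → w ≡ v ⨾ y
  adjunction≡ {v = v} {y} h = ext (λ z z∈ → from (isAdjunction-⨾ v y z) (to (h z) z∈))
                                  (λ z z∈ → from (h z) (to (isAdjunction-⨾ v y z) z∈))

  private
    isAdjunction : Fin n → Fin n → Fin n → Formula n
    isAdjunction w v y = ∀̇ (v0 ∈̇ ↑ w ⇔̇ v0 ∈̇ ↑ v ∨̇ v0 ≐ ↑ y)

    φ : Formula 3
    φ = ∀̇ (v3 ∈̇ v0 ⇒̇
            (∀̇ (v0 ∈̇ v1 ⇒̇ (∀̇ (v0 ∈̇ v4 ⇒̇ (∀̇ (isAdjunction v0 v2 v1 ⇒̇ v0 ∈̇ v3)))))) ⇒̇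
            v1 ∈̇ v0)

  -- The Kuratowski finite subsets of Z.
  abstract
    fin : V → V
    fin Z = sep φ (Z ∷ ∅ ∷ []) (𝒫 Z)

    fin-⊆ : ∀ {Z u} → u ∈ fin Z → u ⊆ Z
    fin-⊆ {Z} u∈ = 𝒫⁻ (proj₁ (sep⁻ φ _ _ u∈))

    fin-∅ : ∀ {Z} → ∅ ∈ fin Z
    fin-∅ = sep⁺ φ _ _ (𝒫⁺ λ z z∈ → ⊥-elim (∉∅ z z∈)) λ 𝓕 ∅∈ _ → ∅∈

    fin-⨾ : ∀ {Z v y} → v ∈ fin Z → y ∈ Z → v ⨾ y ∈ fin Z
    fin-⨾ {Z} {v} {y} v∈ y∈ = sep⁺ φ _ _ (𝒫⁺ sub) λ 𝓕 ∅∈ closed →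
        closed v (proj₂ (sep⁻ φ _ _ v∈) 𝓕 ∅∈ closed) y y∈ _ (isAdjunction-⨾ v y)
      where
      sub : (v ⨾ y) ⊆ Z
      sub z z∈ with ⨾⁻ z∈
      ... | inj₁ p = fin-⊆ v∈ z p
      ... | inj₂ refl = y∈

    fin-ind : ∀ {k} (ψ : Formula (1+ k)) ρ {Z} → Sat ψ (∅ ∷ ρ) →
              (∀ v y → v ∈ fin Z → y ∈ Z → Sat ψ (v ∷ ρ) → Sat ψ (v ⨾ y ∷ ρ)) →
              ∀ u → u ∈ fin Z → Sat ψ (u ∷ ρ)
    fin-ind ψ ρ {Z} base step u u∈ = proj₂ (sep⁻ ψ ρ (fin Z)
      (proj₂ (sep⁻ φ _ _ u∈) (sep ψ ρ (fin Z)) (sep⁺ ψ ρ _ fin-∅ base) closed))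
      where
      closed : ∀ v → v ∈ sep ψ ρ (fin Z) → ∀ y → y ∈ Z → ∀ w → IsAdjunction w v y → w ∈ sep ψ ρ (fin Z)
      closed v v∈ y y∈ w h with sep⁻ ψ ρ _ v∈ | adjunction≡ h
      ... | v∈′ , s | refl = sep⁺ ψ ρ _ (fin-⨾ v∈′ y∈) (step v y v∈′ y∈ s)

  fin-⁅⁆ : ∀ {Z y} → y ∈ Z → ∅ ⨾ y ∈ fin Z
  fin-⁅⁆ = fin-⨾ fin-∅

  fin-mono : ∀ {Z Z′ u} → u ∈ fin Z → u ⊆ Z′ → u ∈ fin Z′
  fin-mono {Z} {Z′} {u} u∈ =
    fin-ind ((∀̇ (v0 ∈̇ v1 ⇒̇ v0 ∈̇ v2)) ⇒̇ v0 ∈̇ v2) (Z′ ∷ fin Z′ ∷ []) (λ _ → fin-∅)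
      (λ v y _ _ ih sub → fin-⨾ (ih λ z z∈ → sub z (⨾-old z∈)) (sub y ⨾-new)) u u∈

  ⨾-remove : ∀ {v y} → y ∈ v → v ≡ (v − y) ⨾ y
  ⨾-remove {v} {y} y∈ = ext l r
    where
    l : ∀ z → z ∈ v → z ∈ (v − y) ⨾ y
    l z z∈ with z ≟ y
    ... | yes refl = ⨾-new
    ... | no z≢y = ⨾-old (−⁺ z∈ z≢y)
    r : ∀ z → z ∈ (v − y) ⨾ y → z ∈ v
    r z z∈ with ⨾⁻ z∈
    ... | inj₁ p = proj₁ (−⁻ p)
    ... | inj₂ refl = y∈

  -- The induction treats all subsets at once, because its step passes from `w` to `w − y`.
  fin-sub : ∀ {Z u w} → u ∈ fin Z → w ⊆ u → w ∈ fin Z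
  fin-sub {Z} {u} {w} u∈ =
    fin-ind (∀̇ ((∀̇ (v0 ∈̇ v1 ⇒̇ v0 ∈̇ v2)) ⇒̇ v0 ∈̇ v2)) (fin Z ∷ [])
      (λ w sub → subst (_∈ fin Z) (sym (empty≡∅ λ z z∈ → ∉∅ z (sub z z∈))) fin-∅) step u u∈ w
    where
    step : ∀ v y → v ∈ fin Z → y ∈ Z → (∀ w → (∀ z → z ∈ w → z ∈ v) → w ∈ fin Z) →
           ∀ w → (∀ z → z ∈ w → z ∈ v ⨾ y) → w ∈ fin Z
    step v y _ y∈ ih w sub with y ∈? w
    ... | yes y∈w = subst (_∈ fin Z) (sym (⨾-remove y∈w)) (fin-⨾ (ih (w − y) sub′) y∈)
      where
      sub′ : ∀ z → z ∈ w − y → z ∈ v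
      sub′ z z∈ with −⁻ z∈
      ... | z∈w , z≢y with ⨾⁻ (sub z z∈w)
      ... | inj₁ p = p
      ... | inj₂ e = ⊥-elim (z≢y e)
    ... | no y∉w = ih w sub′
      where
      sub′ : ∀ z → z ∈ w → z ∈ v
      sub′ z z∈ with ⨾⁻ (sub z z∈)
      ... | inj₁ p = p
      ... | inj₂ refl = ⊥-elim (y∉w z∈)

  -- The induction only produces a finite superset of the union, which is easily put as a formula;
  -- `fin-sub` then cuts it down.
  fin-∪ : ∀ {Z u v} → u ∈ fin Z → v ∈ fin Z → u ∪ v ∈ fin Z
  fin-∪ {Z} {u} {v} u∈ v∈ with fin-ind (∃̇ (v0 ∈̇ v2 ∧̇ (∀̇ (v0 ∈̇ v2 ∨̇ v0 ∈̇ v4 ⇒̇ v0 ∈̇ v1)))) (fin Z ∷ v ∷ [])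
                                 (v , v∈ , λ { z (inj₁ p) → ⊥-elim (∉∅ z p) ; z (inj₂ p) → p }) step u u∈
    where
    step : ∀ w y → w ∈ fin Z → y ∈ Z → (∃[ W ] W ∈ fin Z × (∀ z → z ∈ w ⊎ z ∈ v → z ∈ W)) →
           ∃[ W ] W ∈ fin Z × (∀ z → z ∈ w ⨾ y ⊎ z ∈ v → z ∈ W)
    step w y _ y∈ (W , W∈ , h) = W ⨾ y , fin-⨾ W∈ y∈ , h′
      where
      h′ : ∀ z → z ∈ w ⨾ y ⊎ z ∈ v → z ∈ W ⨾ y
      h′ z (inj₂ p) = ⨾-old (h z (inj₂ p))
      h′ z (inj₁ p) with ⨾⁻ p
      ... | inj₁ q = ⨾-old (h z (inj₁ q))
      ... | inj₂ refl = ⨾-new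
  ... | W , W∈ , h = fin-sub W∈ λ z z∈ → h z (∪⁻ z∈)

  -- Each step of the induction opens a single existential, so the covering sets of the sections are
  -- never chosen simultaneously. The clause `v ⊆ u` is carried along because `sections` speaks only
  -- of elements of `u`.
  fin-⋃ : ∀ {Z Y} R u → u ∈ fin Z →
          (∀ i → i ∈ u → ∃[ W ] W ∈ fin Y × (∀ z → Maps R i z → z ∈ W)) →
          ∃[ W ] W ∈ fin Y × (∀ i → i ∈ u → ∀ z → Maps R i z → z ∈ W)
  fin-⋃ {Z} {Y} R u u∈ sections =
    fin-ind ((∀̇ (v0 ∈̇ v1 ⇒̇ v0 ∈̇ v2)) ⇒̇
             (∃̇ (v0 ∈̇ v3 ∧̇ (∀̇ (v0 ∈̇ v2 ⇒̇ (∀̇ (maps v6 v1 v0 ⇒̇ v0 ∈̇ v2)))))))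
      (u ∷ fin Y ∷ R ∷ []) (λ _ → ∅ , fin-∅ , λ i i∈ → ⊥-elim (∉∅ i i∈)) step u u∈ (λ _ p → p)
    where
    step : ∀ v y → v ∈ fin Z → y ∈ Z →
           (v ⊆ u → ∃[ W ] W ∈ fin Y × (∀ i → i ∈ v → ∀ z → Maps R i z → z ∈ W)) →
           (v ⨾ y) ⊆ u → ∃[ W ] W ∈ fin Y × (∀ i → i ∈ v ⨾ y → ∀ z → Maps R i z → z ∈ W)
    step v y _ _ ih sub with ih (λ z z∈ → sub z (⨾-old z∈)) | sections y (sub y ⨾-new)
    ... | W , W∈ , h | W′ , W′∈ , h′ = W ∪ W′ , fin-∪ W∈ W′∈ , h″
      where
      h″ : ∀ i → i ∈ v ⨾ y → ∀ z → Maps R i z → z ∈ W ∪ W′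
      h″ i i∈ z m with ⨾⁻ i∈
      ... | inj₁ p = ∪-inl _ _ _ (h i p z m)
      ... | inj₂ refl = ∪-inr _ _ _ (h′ z m)

  abstract
    image : V → V → V → V
    image R u Y = sep (∃̇ (v0 ∈̇ v2 ∧̇ maps v3 v0 v1)) (u ∷ R ∷ []) Y

    image⁺ : ∀ {R u Y i z} → i ∈ u → z ∈ Y → Maps R i z → z ∈ image R u Y
    image⁺ i∈ z∈ m = sep⁺ (∃̇ (v0 ∈̇ v2 ∧̇ maps v3 v0 v1)) _ _ z∈ (_ , i∈ , m)

    image⁻ : ∀ {R u Y z} → z ∈ image R u Y → z ∈ Y × ∃[ i ] i ∈ u × Maps R i z
    image⁻ = sep⁻ (∃̇ (v0 ∈̇ v2 ∧̇ maps v3 v0 v1)) _ _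

  fin-image : ∀ {Z Y} R u → Functional R → (∀ {x y} → Maps R x y → y ∈ Y) → u ∈ fin Z → image R u Y ∈ fin Y
  fin-image {Z} {Y} R u fun R⊆ u∈ with fin-⋃ R u u∈ sections
    where
    sections : ∀ i → i ∈ u → ∃[ W ] W ∈ fin Y × (∀ z → Maps R i z → z ∈ W)
    sections i i∈ with excluded-middle (∃̇ maps v1 v2 v0) (R ∷ i ∷ [])
    ... | yes (y , m) = ∅ ⨾ y , fin-⁅⁆ (R⊆ m) , λ z m′ → subst (_∈ ∅ ⨾ y) (fun m m′) ⨾-new
    ... | no none = ∅ , fin-∅ , λ z m → ⊥-elim (none (z , m))
  ... | W , W∈ , h = fin-sub W∈ λ z z∈ → let _ , i , i∈ , m = image⁻ z∈ in h i i∈ z m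

  fin-max : ∀ {X R} → WellOrder X R → ∀ u → u ∈ fin X → (∃[ x ] x ∈ u) →
            ∃[ m ] m ∈ u × (∀ x → x ∈ u → ¬ Maps R m x)
  fin-max {X} {R} wo u u∈ =
    fin-ind ((∃̇ v0 ∈̇ v1) ⇒̇ (∃̇ (v0 ∈̇ v1 ∧̇ (∀̇ (v0 ∈̇ v2 ⇒̇ ¬̇ (maps v3 v1 v0)))))) (R ∷ [])
      (λ { (x , x∈) → ⊥-elim (∉∅ x x∈) }) step u u∈
    where
    open WellOrder wo
    step : ∀ v y → v ∈ fin X → y ∈ X →
           ((∃[ x ] x ∈ v) → ∃[ m ] m ∈ v × (∀ x → x ∈ v → ¬ Maps R m x)) →
           (∃[ x ] x ∈ v ⨾ y) → ∃[ m ] m ∈ v ⨾ y × (∀ x → x ∈ v ⨾ y → ¬ Maps R m x)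
    step v y v∈ y∈ ih _ with nonempty? v
    ... | inj₂ emp = y , ⨾-new , bound
      where
      bound : ∀ x → x ∈ v ⨾ y → ¬ Maps R y x
      bound x x∈ with ⨾⁻ x∈
      ... | inj₁ p = ⊥-elim (emp x p)
      ... | inj₂ refl = irrefl
    ... | inj₁ ne with ih ne
    ... | m , m∈ , h with excluded-middle (maps v0 v1 v2) (R ∷ m ∷ y ∷ [])
    ... | no m≮y = m , ⨾-old m∈ , bound
      where
      bound : ∀ x → x ∈ v ⨾ y → ¬ Maps R m x
      bound x x∈ with ⨾⁻ x∈
      ... | inj₁ p = h x p
      ... | inj₂ refl = m≮y
    ... | yes m<y = y , ⨾-new , bound
      where
      bound : ∀ x → x ∈ v ⨾ y → ¬ Maps R y x
      bound x x∈ with ⨾⁻ x∈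
      ... | inj₁ p = λ y<x → h x p (transitive m<y y<x)
      ... | inj₂ refl = irrefl

  nat-fin : ∀ n → n ∈ ω → n ∈ fin ω
  nat-fin = ω-ind (v0 ∈̇ v1) (fin ω ∷ []) fin-∅ λ n n∈ ih → fin-⨾ ih n∈

  ω∉fin : ¬ ω ∈ fin ω
  ω∉fin ω∈ with fin-max ω-wellOrder ω ω∈ (∅ , 0∈ω)
  ... | m , m∈ , h = h (m ⨾ m) (suc∈ω m∈) (∈-on⁺ m∈ (suc∈ω m∈) ⨾-new)

-- The well-order of the finite subsets of a well-ordered set.

module FiniteOrder {ℓ : Level} (M : ZFModel ℓ) where
  open ZFModel M
  open Basics M
  open Ordinals M
  open Recursion M
  open FiniteSets M

  module _ {L R : V} (wo : WellOrder L R) where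
    open WellOrder wo

    -- The witness `x` is the maximum of the symmetric difference. For `L` equal to `ω` this
    -- compares binary numerals.
    _≺_ : V → V → Set ℓ
    u ≺ v = ∃[ x ] x ∈ v × ¬ x ∈ u × (∀ y → Maps R x y → y ∈ u ⇔ y ∈ v)

    IsMax : V → V → Set ℓ
    IsMax m u = m ∈ u × (∀ x → x ∈ u → ¬ Maps R m x)

    private
      φ : Formula 6
      φ = ∃̇ (v0 ∈̇ v1 ∧̇ ¬̇ (v0 ∈̇ v2) ∧̇ (∀̇ (maps v7 v1 v0 ⇒̇ (v0 ∈̇ v3 ⇔̇ v0 ∈̇ v2))))

    max< : ∀ {m u x} → u ⊆ L → IsMax m u → x ∈ u → ¬ x ≡ m → Maps R x m
    max< {m} {u} {x} u⊆ (m∈ , h) x∈ x≢m with tri (u⊆ x x∈) (u⊆ m m∈)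
    ... | inj₁ lt = lt
    ... | inj₂ (inj₁ e) = ⊥-elim (x≢m e)
    ... | inj₂ (inj₂ gt) = ⊥-elim (h x x∈ gt)

    abstract
      finOrder : V
      finOrder = rel φ (R ∷ []) (fin L) (fin L)

      finOrder⁺ : ∀ {u v} → u ∈ fin L → v ∈ fin L → u ≺ v → Maps finOrder u v
      finOrder⁺ u∈ v∈ h = rel-maps⁺ φ (R ∷ []) _ _ u∈ v∈ λ _ → h

      finOrder⁻ : ∀ {u v} → Maps finOrder u v → u ∈ fin L × v ∈ fin L × u ≺ v
      finOrder⁻ m = let u∈ , v∈ , _ , h = rel-maps⁻ φ (R ∷ []) _ _ m in u∈ , v∈ , h

    HasMinimum : V → Set ℓ
    HasMinimum U = ∃[ m ] m ∈ U × (∀ z → z ∈ U → ¬ Maps finOrder z m)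

    WellFoundedBelow : V → Set ℓ
    WellFoundedBelow l = ∀ U → (∀ u → u ∈ U → u ∈ fin L) → (∀ u → u ∈ U → ∀ x → x ∈ u → Maps R x l) →
                         (∃[ u ] u ∈ U) → HasMinimum U

    private
      hasMinimum : Fin n → Fin n → Formula n
      hasMinimum O U = ∃̇ (v0 ∈̇ ↑ U ∧̇ (∀̇ (v0 ∈̇ ↑ ↑ U ⇒̇ ¬̇ (maps (↑ ↑ O) v0 v1))))

      wellFoundedBelow : Fin n → Fin n → Fin n → Fin n → Formula n
      wellFoundedBelow F R O l =
        ∀̇ ((∀̇ (v0 ∈̇ v1 ⇒̇ v0 ∈̇ ↑ ↑ F)) ⇒̇
           (∀̇ (v0 ∈̇ v1 ⇒̇ (∀̇ (v0 ∈̇ v1 ⇒̇ maps (↑ ↑ ↑ R) v0 (↑ ↑ ↑ l))))) ⇒̇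
           (∃̇ v0 ∈̇ v1) ⇒̇ hasMinimum (↑ O) v0)

      ψ : Formula 4
      ψ = ∃̇ (v0 ∈̇ v2 ∧̇ (∀̇ (v0 ∈̇ v1 ⇔̇ v0 ∈̇ v2 ∨̇ v0 ≐ v4)) ∧̇ (∀̇ (v0 ∈̇ v2 ⇒̇ maps v5 v0 v4)))

    abstract
      maxima : V → V
      maxima U = sep (∃̇ (v0 ∈̇ v2 ∧̇ v1 ∈̇ v0 ∧̇ (∀̇ (v0 ∈̇ v1 ⇒̇ ¬̇ (maps v4 v2 v0))))) (U ∷ R ∷ []) L

      maxima⁺ : ∀ {U u m} → u ∈ U → m ∈ L → IsMax m u → m ∈ maxima U
      maxima⁺ u∈ m∈ h = sep⁺ (∃̇ (v0 ∈̇ v2 ∧̇ v1 ∈̇ v0 ∧̇ (∀̇ (v0 ∈̇ v1 ⇒̇ ¬̇ (maps v4 v2 v0))))) _ _ m∈ (_ , u∈ , h)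

      maxima⁻ : ∀ {U m} → m ∈ maxima U → m ∈ L × ∃[ u ] u ∈ U × IsMax m u
      maxima⁻ = sep⁻ (∃̇ (v0 ∈̇ v2 ∧̇ v1 ∈̇ v0 ∧̇ (∀̇ (v0 ∈̇ v1 ⇒̇ ¬̇ (maps v4 v2 v0))))) _ _

      beheaded : V → V → V
      beheaded U l = sep ψ (U ∷ l ∷ R ∷ []) (fin L)

      beheaded⁺ : ∀ {U l w} → w ∈ fin L → w ⨾ l ∈ U → (∀ x → x ∈ w → Maps R x l) → w ∈ beheaded U l
      beheaded⁺ w∈ wl∈ h = sep⁺ ψ _ _ w∈ (_ , wl∈ , isAdjunction-⨾ _ _ , h)

      beheaded⁻ : ∀ {U l w} → w ∈ beheaded U l → w ∈ fin L × w ⨾ l ∈ U × (∀ x → x ∈ w → Maps R x l)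
      beheaded⁻ w∈ with sep⁻ ψ _ _ w∈
      ... | w∈F , u , u∈ , a , h with adjunction≡ a
      ... | refl = w∈F , u∈ , h

    beheaded-− : ∀ {U u l} → u ∈ U → u ∈ fin L → IsMax l u → u − l ∈ beheaded U l
    beheaded-− {U} {u} {l} u∈U u∈ mx = beheaded⁺ (fin-sub u∈ λ z z∈ → proj₁ (−⁻ z∈))
      (subst (_∈ U) (⨾-remove (proj₁ mx)) u∈U)
      λ x x∈ → let x∈u , x≢l = −⁻ x∈ in max< (fin-⊆ u∈) mx x∈u x≢l

    nonempty⇒max : ∀ {u} → u ∈ fin L → ¬ u ≡ ∅ → ∃[ m ] IsMax m u
    nonempty⇒max {u} u∈ u≢∅ with nonempty? u
    ... | inj₁ ne = fin-max wo u u∈ ne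
    ... | inj₂ emp = ⊥-elim (u≢∅ (empty≡∅ emp))

    behead-≺ : ∀ {z w l} → (∀ x → x ∈ w → Maps R x l) → l ∈ z → z ≺ (w ⨾ l) → (z − l) ≺ w
    behead-≺ {z} {w} {l} w<l l∈z (x , x∈ , x∉z , agree) with ⨾⁻ x∈
    ... | inj₂ refl = ⊥-elim (x∉z l∈z)
    ... | inj₁ x∈w = x , x∈w , (λ p → x∉z (proj₁ (−⁻ p))) , λ y x<y → mk⇔ (f y x<y) (g y x<y)
      where
      f : ∀ y → Maps R x y → y ∈ z − l → y ∈ w
      f y x<y y∈ with −⁻ y∈
      ... | y∈z , y≢l with ⨾⁻ (to (agree y x<y) y∈z)
      ... | inj₁ p = p
      ... | inj₂ e = ⊥-elim (y≢l e)
      g : ∀ y → Maps R x y → y ∈ w → y ∈ z − l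
      g y x<y y∈ = −⁺ (from (agree y x<y) (⨾-old y∈)) λ { refl → irrefl (w<l y y∈) }

    -- The witness of `v ≺ u` lies in `u`, hence not beyond `l`. So `v` agrees with `u` beyond `l`,
    -- where `u` has nothing.
    ≺-max : ∀ {v u l} → (∀ x → x ∈ u → x ∈ L) → IsMax l u → v ≺ u → ∀ y → y ∈ v → ¬ Maps R l y
    ≺-max {v} {u} {l} u⊆ mx (x , x∈ , x∉v , agree) y y∈ l<y with x ≟ l
    ... | yes refl = proj₂ mx y (to (agree y l<y) y∈) l<y
    ... | no x≢l = proj₂ mx y (to (agree y (transitive (max< u⊆ mx x∈ x≢l) l<y)) y∈) l<y

    -- If `∅` belongs to `U`, it is the minimum. Otherwise let `l` be the least maximum of a member
    -- of `U`, and remove `l` from the members that have it as maximum. What remains lies below `l`,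
    -- so the hypothesis yields a minimum `w` of these remainders, and `w ⨾ l` is a minimum of `U`:
    -- no member has a smaller maximum, and one with a larger maximum is larger.
    minimum-by-max : ∀ U → (∀ u → u ∈ U → u ∈ fin L) →
                     (∀ u → u ∈ U → ∀ l → l ∈ u → WellFoundedBelow l) → (∃[ u ] u ∈ U) → HasMinimum U
    minimum-by-max U U⊆ wfb (u₀ , u₀∈) with ∅ ∈? U
    ... | yes ∅∈ = ∅ , ∅∈ , λ z z∈ lt → let _ , _ , x , x∈ , _ = finOrder⁻ lt in ∉∅ x x∈
    ... | no ∅∉ with nonempty⇒max (U⊆ u₀ u₀∈) (λ { refl → ∅∉ u₀∈ })
    ... | m₀ , mx₀ with wf (maxima U) (λ z z∈ → proj₁ (maxima⁻ z∈))
                          (m₀ , maxima⁺ u₀∈ (fin-⊆ (U⊆ u₀ u₀∈) m₀ (proj₁ mx₀)) mx₀)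
    ... | l , l∈ , l-min with maxima⁻ l∈
    ... | l∈L , u , u∈ , mx with wfb u u∈ l (proj₁ mx) (beheaded U l) (λ w w∈ → proj₁ (beheaded⁻ w∈))
                                   (λ w w∈ → proj₂ (proj₂ (beheaded⁻ w∈))) (u − l , beheaded-− u∈ (U⊆ u u∈) mx)
    ... | w , w∈ , w-min with beheaded⁻ w∈
    ... | w∈F , wl∈ , w<l = w ⨾ l , wl∈ , least
      where
      mxw : IsMax l (w ⨾ l)
      mxw = ⨾-new , bound
        where
        bound : ∀ x → x ∈ w ⨾ l → ¬ Maps R l x
        bound x x∈ with ⨾⁻ x∈
        ... | inj₁ p = asym (w<l x p)
        ... | inj₂ refl = irrefl
      least : ∀ z → z ∈ U → ¬ Maps finOrder z (w ⨾ l)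
      least z z∈ lt with finOrder⁻ lt | nonempty⇒max (U⊆ z z∈) (λ { refl → ∅∉ z∈ })
      ... | _ , _ , z≺ | m , mz with tri (fin-⊆ (U⊆ z z∈) m (proj₁ mz)) l∈L
      ... | inj₁ m<l = l-min m (maxima⁺ z∈ (proj₁ (field⊆ m<l)) mz) m<l
      ... | inj₂ (inj₂ l<m) = ≺-max (fin-⊆ (U⊆ _ wl∈)) mxw z≺ m (proj₁ mz) l<m
      ... | inj₂ (inj₁ refl) = w-min (z − l) (beheaded-− z∈ (U⊆ z z∈) mz)
            (finOrder⁺ (fin-sub (U⊆ z z∈) λ x x∈ → proj₁ (−⁻ x∈)) w∈F (behead-≺ w<l (proj₁ mz) z≺))

    -- In a family bounded by `l` every element of every member precedes `l`, so the induction
    -- hypothesis is exactly what `minimum-by-max` asks for.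
    wellFounded-below : ∀ l → l ∈ L → WellFoundedBelow l
    wellFounded-below = wf-ind (wellFoundedBelow v1 v2 v3 v0) (fin L ∷ R ∷ finOrder ∷ [])
      λ l l∈ ih U U⊆ U<l → minimum-by-max U U⊆ λ u u∈ x x∈ → ih x (U<l u u∈ x x∈)

    ≺-trichotomy : ∀ {u v} → u ∈ fin L → v ∈ fin L → Maps finOrder u v ⊎ u ≡ v ⊎ Maps finOrder v u
    ≺-trichotomy {u} {v} u∈ v∈ with nonempty? ((u ∖ v) ∪ (v ∖ u))
    ... | inj₂ emp = inj₂ (inj₁ (ext (half (∪-inl _ _ _)) (half (∪-inr _ _ _))))
      where
      half : ∀ {a b} → (∀ {z} → z ∈ a ∖ b → z ∈ (u ∖ v) ∪ (v ∖ u)) → ∀ z → z ∈ a → z ∈ b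
      half {b = b} h z z∈ with z ∈? b
      ... | yes p = p
      ... | no ¬p = ⊥-elim (emp z (h (∖⁺ z∈ ¬p)))
    ... | inj₁ ne with fin-max wo _ (fin-∪ (fin-sub u∈ λ z z∈ → proj₁ (∖⁻ z∈)) (fin-sub v∈ λ z z∈ → proj₁ (∖⁻ z∈))) ne
    ... | m , m∈ , bound = split (∪⁻ m∈)
      where
      agree : ∀ y → Maps R m y → (y ∈ u → y ∈ v) × (y ∈ v → y ∈ u)
      agree y m<y = f , g
        where
        f : y ∈ u → y ∈ v
        f y∈ with y ∈? v
        ... | yes p = p
        ... | no ¬p = ⊥-elim (bound y (∪-inl _ _ _ (∖⁺ y∈ ¬p)) m<y)
        g : y ∈ v → y ∈ u
        g y∈ with y ∈? u
        ... | yes p = p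
        ... | no ¬p = ⊥-elim (bound y (∪-inr _ _ _ (∖⁺ y∈ ¬p)) m<y)
      split : m ∈ u ∖ v ⊎ m ∈ v ∖ u → Maps finOrder u v ⊎ u ≡ v ⊎ Maps finOrder v u
      split (inj₁ p) = let a , b = ∖⁻ p in
        inj₂ (inj₂ (finOrder⁺ v∈ u∈ (m , a , b , λ y m<y → let f , g = agree y m<y in mk⇔ g f)))
      split (inj₂ p) = let a , b = ∖⁻ p in
        inj₁ (finOrder⁺ u∈ v∈ (m , a , b , λ y m<y → let f , g = agree y m<y in mk⇔ f g))

    abstract
      fin-wellOrder : WellOrder (fin L) finOrder
      fin-wellOrder = record
        { field⊆ = λ m → let u∈ , v∈ , _ = finOrder⁻ m in u∈ , v∈
        ; wf = λ U U⊆ → minimum-by-max U U⊆ λ u u∈ l l∈ → wellFounded-below l (fin-⊆ (U⊆ u u∈) l l∈)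
        ; tri = ≺-trichotomy
        }

    -- In the main recursion this makes every finite set strictly below the maximum of `u` an
    -- earlier index, whatever the rest of `u` is.
    below-max : ∀ {y u l} → IsMax l u → (∀ x → x ∈ y → Maps R x l) → y ≺ u
    below-max {y} {u} {l} (l∈ , h) y<l =
      l , l∈ , (λ p → irrefl (y<l l p)) , λ z l<z →
        mk⇔ (λ z∈ → ⊥-elim (asym l<z (y<l z z∈))) (λ z∈ → ⊥-elim (h z z∈ l<z))

  abstract
    restrictOrder : V → V → V
    restrictOrder R X = rel (maps v5 v1 v0) (R ∷ []) X X

    restrictOrder⁺ : ∀ {R X x y} → x ∈ X → y ∈ X → Maps R x y → Maps (restrictOrder R X) x y
    restrictOrder⁺ x∈ y∈ m = rel-maps⁺ (maps v5 v1 v0) _ _ _ x∈ y∈ λ _ → m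

    restrictOrder⁻ : ∀ {R X x y} → Maps (restrictOrder R X) x y → x ∈ X × y ∈ X × Maps R x y
    restrictOrder⁻ m = let x∈ , y∈ , _ , h = rel-maps⁻ (maps v5 v1 v0) _ _ _ m in x∈ , y∈ , h

    restrict-wellOrder : ∀ {R X X′} → WellOrder X R → X′ ⊆ X → WellOrder X′ (restrictOrder R X′)
    restrict-wellOrder {R} {X} {X′} wo sub = record
      { field⊆ = λ m → let x∈ , y∈ , _ = restrictOrder⁻ m in x∈ , y∈
      ; wf = λ U U⊆ ne → let m , m∈ , h = wf U (λ z z∈ → sub z (U⊆ z z∈)) ne in
                          m , m∈ , λ z z∈ r → h z z∈ (proj₂ (proj₂ (restrictOrder⁻ r)))
      ; tri = λ x∈ y∈ → [ (λ r → inj₁ (restrictOrder⁺ x∈ y∈ r))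
                        , [ (λ e → inj₂ (inj₁ e)) , (λ r → inj₂ (inj₂ (restrictOrder⁺ y∈ x∈ r))) ]′
                        ]′ (tri (sub _ x∈) (sub _ y∈))
      }
      where open WellOrder wo

-- Countability of the finite subsets of `ω`, and a pairing function.

module Countability {ℓ : Level} (M : ZFModel ℓ) where
  open ZFModel M
  open Basics M
  open Ordinals M
  open Recursion M
  open Omega M
  open FiniteSets M
  open FiniteOrder M

  -- Increment of binary numerals, a finite u ⊆ ω standing for the number with
  -- ones in the places u.
  private
    Increment : V → V → Set ℓ
    Increment u u′ = ∃[ n ] n ∈ ω × ¬ n ∈ u × (∀ m → m ∈ n → m ∈ u) ×
                     (∀ m → m ∈ u′ ⇔ (m ≡ n ⊎ (m ∈ u × n ∈ m)))

    increment : Formula 6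
    increment = ∃̇ (v0 ∈̇ v6 ∧̇ ¬̇ (v0 ∈̇ v2) ∧̇ (∀̇ (v0 ∈̇ v1 ⇒̇ v0 ∈̇ v3)) ∧̇
                   (∀̇ (v0 ∈̇ v2 ⇔̇ v0 ≐ v1 ∨̇ (v0 ∈̇ v3 ∧̇ v1 ∈̇ v0))))

    abstract
      N : V
      N = rel increment (ω ∷ []) (fin ω) (fin ω)

      N⁺ : ∀ {u u′} → u ∈ fin ω → u′ ∈ fin ω → Increment u u′ → Maps N u u′
      N⁺ u∈ u′∈ h = rel-maps⁺ increment _ _ _ u∈ u′∈ λ _ → h

      N⁻ : ∀ {u u′} → Maps N u u′ → Increment u u′
      N⁻ m = let _ , _ , _ , h = rel-maps⁻ increment _ _ _ m in h

      N⊆ : N ⊆ (fin ω ⊗ fin ω)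
      N⊆ = rel-⊆ increment _ _ _

    N-functional : Functional N
    N-functional m m′ with N⁻ m | N⁻ m′
    ... | n , n∈ , n∉ , low , h | n′ , n′∈ , n′∉ , low′ , h′ with ∈-trichotomy (nat-ordinal n∈) (nat-ordinal n′∈)
    ... | inj₁ p = ⊥-elim (n∉ (low′ n p))
    ... | inj₂ (inj₂ p) = ⊥-elim (n′∉ (low n′ p))
    ... | inj₂ (inj₁ refl) = ext (λ z z∈ → from (h′ z) (to (h z) z∈)) (λ z z∈ → from (h z) (to (h′ z) z∈))

    -- Since `ω` is not finite, some place of `u` holds a zero; the carry stops at the least such
    -- place `n` and clears the places below it.
    N-total : ∀ u → u ∈ fin ω → ∃[ u′ ] Maps N u u′
    N-total u u∈ with nonempty? (ω ∖ u)
    ... | inj₂ emp = ⊥-elim (ω∉fin (fin-sub u∈ full))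
      where
      full : ω ⊆ u
      full z z∈ with z ∈? u
      ... | yes p = p
      ... | no ¬p = ⊥-elim (emp z (∖⁺ z∈ ¬p))
    ... | inj₁ ne with ∈-minimal _ ne
    ... | n , n∈ , n-min with ∖⁻ n∈
    ... | n∈ω , n∉u = high ⨾ n , N⁺ u∈ (fin-⨾ (fin-sub u∈ λ z z∈ → proj₁ (sep⁻ (v1 ∈̇ v0) _ _ z∈)) n∈ω)
                        (n , n∈ω , n∉u , low , λ m → mk⇔ (f m) (g m))
      where
      high : V
      high = sep (v1 ∈̇ v0) (n ∷ []) u
      low : ∀ m → m ∈ n → m ∈ u
      low m m∈ with m ∈? u
      ... | yes p = p
      ... | no ¬p = ⊥-elim (n-min m (∖⁺ (ω-transitive n n∈ω m m∈) ¬p) m∈)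
      f : ∀ m → m ∈ high ⨾ n → m ≡ n ⊎ (m ∈ u × n ∈ m)
      f m m∈ with ⨾⁻ m∈
      ... | inj₁ p = inj₂ (sep⁻ (v1 ∈̇ v0) _ _ p)
      ... | inj₂ e = inj₁ e
      g : ∀ m → m ≡ n ⊎ (m ∈ u × n ∈ m) → m ∈ high ⨾ n
      g m (inj₁ refl) = ⨾-new
      g m (inj₂ (p , q)) = ⨾-old (sep⁺ (v1 ∈̇ v0) _ _ p q)

    decrement : ∀ u n → u ∈ fin ω → n ∈ u → (∀ z → z ∈ u → ¬ z ∈ n) →
                ∃[ u′ ] Maps N u′ u × Maps (finOrder ω-wellOrder) u′ u
    decrement u n u∈ n∈u n-min =
      u′ , N⁺ u′∈ u∈ (n , n∈ω , n∉u′ , (λ m m∈ → ∪-inl _ _ _ m∈) , λ m → mk⇔ (f m) (g m)) ,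
      finOrder⁺ ω-wellOrder u′∈ u∈ (n , n∈u , n∉u′ , λ y n<y → let _ , _ , n∈y = ∈-on⁻ n<y in mk⇔ (k y n∈y) (k′ y n∈y))
      where
      n∈ω : n ∈ ω
      n∈ω = fin-⊆ u∈ n n∈u
      u′ : V
      -- The borrow: the lowest one moves out of place `n`, and all places below `n` become ones. As
      -- a von Neumann numeral, `n` is itself the set of those places.
      u′ = n ∪ (u − n)
      u′∈ : u′ ∈ fin ω
      u′∈ = fin-∪ (nat-fin n n∈ω) (fin-sub u∈ λ z z∈ → proj₁ (−⁻ z∈))
      n∉u′ : ¬ n ∈ u′
      n∉u′ p with ∪⁻ p
      ... | inj₁ q = ∈-irrefl q
      ... | inj₂ q = proj₂ (−⁻ q) refl
      k : ∀ y → n ∈ y → y ∈ u′ → y ∈ u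
      k y n∈y p with ∪⁻ p
      ... | inj₁ q = ⊥-elim (∈-asym n∈y q)
      ... | inj₂ q = proj₁ (−⁻ q)
      k′ : ∀ y → n ∈ y → y ∈ u → y ∈ u′
      k′ y n∈y p = ∪-inr _ _ _ (−⁺ p λ { refl → ∈-irrefl n∈y })
      f : ∀ m → m ∈ u → m ≡ n ⊎ (m ∈ u′ × n ∈ m)
      f m m∈ with ∈-trichotomy (nat-ordinal (fin-⊆ u∈ m m∈)) (nat-ordinal n∈ω)
      ... | inj₁ p = ⊥-elim (n-min m m∈ p)
      ... | inj₂ (inj₁ e) = inj₁ e
      ... | inj₂ (inj₂ p) = inj₂ (k′ m p m∈ , p)
      g : ∀ m → m ≡ n ⊎ (m ∈ u′ × n ∈ m) → m ∈ u
      g m (inj₁ refl) = n∈u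
      g m (inj₂ (p , q)) = k m q p

    -- Every nonempty numeral is the increment of a numeral that is smaller in the well-order of
    -- `fin ω`, so counting up from `∅` omits none.
    numerals-onto : ∀ E → Maps E ∅ ∅ → (∀ {n r t} → Maps E n r → Maps N r t → Maps E (n ⨾ n) t) →
                    ∀ u → u ∈ fin ω → ∃[ m ] Maps E m u
    numerals-onto E E-zero E-suc = WellOrder.wf-ind (fin-wellOrder ω-wellOrder) (∃̇ maps v2 v0 v1) (E ∷ []) prog
      where
      prog : ∀ u → u ∈ fin ω → (∀ v → Maps (finOrder ω-wellOrder) v u → ∃[ m ] Maps E m v) → ∃[ m ] Maps E m u
      prog u u∈ ih with nonempty? u
      ... | inj₂ emp = ∅ , subst (Maps E ∅) (sym (empty≡∅ emp)) E-zero
      ... | inj₁ ne with ∈-minimal u ne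
      ... | n , n∈ , n-min with decrement u n u∈ n∈ n-min
      ... | u′ , inc , lt with ih u′ lt
      ... | m , q = m ⨾ m , E-suc q inc

  fin-countable : ∃[ E ] E ⊆ (ω ⊗ fin ω) × Functional E × (∀ u → u ∈ fin ω → ∃[ m ] Maps E m u)
  fin-countable =
    let E , E⊆ , fun , _ , E-zero , E-suc = ω-recursion (fin ω) ∅ N fin-∅ N⊆ N-functional N-total
    in E , E⊆ , fun , numerals-onto E E-zero E-suc

  -- A Kuratowski pair of natural numbers is a finite set of finite sets of
  -- natural numbers, and there are only countably many of those.
  module _ (E : V) (E⊆ : E ⊆ (ω ⊗ fin ω)) (E-functional : Functional E)
           (E-onto : ∀ u → u ∈ fin ω → ∃[ m ] Maps E m u) where

    private
      -- `E` is applied twice: `m` codes a finite set of numbers, each of which codes an element of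
      -- `p`.
      Decodes : V → V → Set ℓ
      Decodes m p = ∃[ w ] Maps E m w × (∀ z → z ∈ p ⇔ (∃[ j ] j ∈ w × Maps E j z))

      decodes : Formula 6
      decodes = ∃̇ (maps v6 v2 v0 ∧̇ (∀̇ (v0 ∈̇ v2 ⇔̇ (∃̇ (v0 ∈̇ v2 ∧̇ maps v8 v0 v1)))))

      abstract
        Q : V
        Q = rel decodes (E ∷ []) ω (ω ⊗ ω)

        Q⁺ : ∀ {m p} → m ∈ ω → p ∈ ω ⊗ ω → Decodes m p → Maps Q m p
        Q⁺ m∈ p∈ h = rel-maps⁺ decodes _ _ _ m∈ p∈ λ _ → h

        Q⁻ : ∀ {m p} → Maps Q m p → m ∈ ω × p ∈ ω ⊗ ω × Decodes m p
        Q⁻ q = let m∈ , p∈ , _ , h = rel-maps⁻ decodes _ _ _ q in m∈ , p∈ , h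

      Q-functional : Functional Q
      Q-functional q q′ with Q⁻ q | Q⁻ q′
      ... | _ , _ , w , e , h | _ , _ , w′ , e′ , h′ with E-functional e e′
      ... | refl = ext (λ z z∈ → from (h′ z) (to (h z) z∈)) (λ z z∈ → from (h z) (to (h′ z) z∈))

      Q-onto : ∀ i j → i ∈ ω → j ∈ ω → ∃[ m ] Maps Q m ⟨ i , j ⟩
      Q-onto i j i∈ j∈ with E-onto ⁅ i ∙ i ⁆ (pair-fin i∈ i∈) | E-onto ⁅ i ∙ j ⁆ (pair-fin i∈ j∈)
        where
        pair-fin : ∀ {i j} → i ∈ ω → j ∈ ω → ⁅ i ∙ j ⁆ ∈ fin ω
        pair-fin {i} {j} i∈ j∈ = fin-sub (fin-⨾ (fin-⁅⁆ i∈) j∈) sub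
          where
          sub : ∀ z → z ∈ ⁅ i ∙ j ⁆ → z ∈ ∅ ⨾ i ⨾ j
          sub z z∈ with to (isPair-⁅⁆ i j z) z∈
          ... | inj₁ refl = ⨾-old ⨾-new
          ... | inj₂ refl = ⨾-new
      ... | a , ea | b , eb with E-onto (∅ ⨾ a ⨾ b) (fin-⨾ (fin-⁅⁆ (proj₁ (maps-⊗ E⊆ ea))) (proj₁ (maps-⊗ E⊆ eb)))
      ... | m , em = m , Q⁺ (proj₁ (maps-⊗ E⊆ em)) (⊗⁺ i∈ j∈) (∅ ⨾ a ⨾ b , em , λ z → mk⇔ (f z) (g z))
        where
        f : ∀ z → z ∈ ⟨ i , j ⟩ → ∃[ k ] k ∈ ∅ ⨾ a ⨾ b × Maps E k z
        f z z∈ with to (isOrderedPair-⟨⟩ i j z) z∈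
        ... | inj₁ h with isPair-unique h (isPair-⁅⁆ i i)
        ... | refl = a , ⨾-old ⨾-new , ea
        f z z∈ | inj₂ h with isPair-unique h (isPair-⁅⁆ i j)
        ... | refl = b , ⨾-new , eb
        g : ∀ z → (∃[ k ] k ∈ ∅ ⨾ a ⨾ b × Maps E k z) → z ∈ ⟨ i , j ⟩
        g z (k , k∈ , e) with ⨾⁻ k∈
        ... | inj₂ refl with E-functional e eb
        ... | refl = from (isOrderedPair-⟨⟩ i j z) (inj₂ (isPair-⁅⁆ i j))
        g z (k , k∈ , e) | inj₁ k∈′ with ⨾⁻ k∈′
        ... | inj₁ p = ⊥-elim (∉∅ k p)
        ... | inj₂ refl with E-functional e ea
        ... | refl = from (isOrderedPair-⟨⟩ i j z) (inj₁ (isPair-⁅⁆ i i))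

      -- The shift by one keeps `∅` out of the range of `P`. The free number later provides a
      -- position that is no code.
      LeastCode : V → V → Set ℓ
      LeastCode p k = ∃[ m ] IsSuccessor k m × Maps Q m p × (∀ m′ → m′ ∈ m → ¬ Maps Q m′ p)

      leastCode : Formula 6
      leastCode = ∃̇ (isSuccessor v1 v0 ∧̇ maps v6 v0 v2 ∧̇ (∀̇ (v0 ∈̇ v1 ⇒̇ ¬̇ (maps v7 v0 v3))))

      abstract
        P : V
        P = rel leastCode (Q ∷ []) (ω ⊗ ω) ω

        P⁺ : ∀ {p k} → p ∈ ω ⊗ ω → k ∈ ω → LeastCode p k → Maps P p k
        P⁺ p∈ k∈ h = rel-maps⁺ leastCode _ _ _ p∈ k∈ λ _ → h

        P⁻ : ∀ {p k} → Maps P p k → LeastCode p k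
        P⁻ q = let _ , _ , _ , h = rel-maps⁻ leastCode _ _ _ q in h

        P⊆ : P ⊆ ((ω ⊗ ω) ⊗ ω)
        P⊆ = rel-⊆ leastCode _ _ _

      P-functional : Functional P
      P-functional q q′ with P⁻ q | P⁻ q′
      ... | m , s , c , l | m′ , s′ , c′ , l′
        with ∈-trichotomy (nat-ordinal (proj₁ (Q⁻ c))) (nat-ordinal (proj₁ (Q⁻ c′)))
      ... | inj₁ p = ⊥-elim (l′ m p c)
      ... | inj₂ (inj₁ refl) = trans (successor≡ s) (sym (successor≡ s′))
      ... | inj₂ (inj₂ p) = ⊥-elim (l m′ p c′)

      P-injective : ∀ {p p′ k} → Maps P p k → Maps P p′ k → p ≡ p′
      P-injective q q′ with P⁻ q | P⁻ q′
      ... | m , s , c , l | m′ , s′ , c′ , l′ with suc-injective (trans (sym (successor≡ s)) (successor≡ s′))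
      ... | refl = Q-functional c c′

      P-nonzero : ∀ {p} → ¬ Maps P p ∅
      P-nonzero q with P⁻ q
      ... | m , s , _ = suc≢∅ (sym (successor≡ s))

      P-total : ∀ i j → i ∈ ω → j ∈ ω → ∃[ k ] Maps P ⟨ i , j ⟩ k
      P-total i j i∈ j∈ =
        let m₀ , c₀ = Q-onto i j i∈ j∈
            m , m∈ , c , least = ω-least (maps v1 v0 v2) (Q ∷ ⟨ i , j ⟩ ∷ []) m₀ (proj₁ (Q⁻ c₀)) c₀
        in m ⨾ m , P⁺ (⊗⁺ i∈ j∈) (suc∈ω m∈) (m , isSuccessor-⨾ m , c , least)

    pairing-function : ∃[ P ] P ⊆ ((ω ⊗ ω) ⊗ ω) × Functional P × (∀ {p p′ k} → Maps P p k → Maps P p′ k → p ≡ p′) ×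
                       (∀ {p} → ¬ Maps P p ∅) × (∀ i j → i ∈ ω → j ∈ ω → ∃[ k ] Maps P ⟨ i , j ⟩ k)
    pairing-function = P , P⊆ , P-functional , P-injective , P-nonzero , P-total

-- From infinitely many subsets of `S` to a partial map of `S` onto `ω`.

module Kuratowski {ℓ : Level} (M : ZFModel ℓ) where
  open ZFModel M
  open Basics M
  open Ordinals M
  open Recursion M
  open Omega M
  open FiniteSets M

  IsIntersection IsDifference : V → V → V → Set ℓ
  IsIntersection Z X Y = ∀ x → x ∈ Z ⇔ (x ∈ X × x ∈ Y)
  IsDifference Z X Y = ∀ x → x ∈ Z ⇔ (x ∈ X × ¬ x ∈ Y)

  isIntersection-∩ : ∀ X Y → IsIntersection (X ∩ Y) X Y
  isIntersection-∩ X Y x = mk⇔ ∩⁻ λ { (p , q) → ∩⁺ p q }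

  isDifference-∖ : ∀ X Y → IsDifference (X ∖ Y) X Y
  isDifference-∖ X Y x = mk⇔ ∖⁻ λ { (p , q) → ∖⁺ p q }

  intersection≡ : ∀ {Z X Y} → IsIntersection Z X Y → Z ≡ X ∩ Y
  intersection≡ {X = X} {Y} h = ext (λ z z∈ → from (isIntersection-∩ X Y z) (to (h z) z∈))
                                    (λ z z∈ → from (h z) (to (isIntersection-∩ X Y z) z∈))

  difference≡ : ∀ {Z X Y} → IsDifference Z X Y → Z ≡ X ∖ Y
  difference≡ {X = X} {Y} h = ext (λ z z∈ → from (isDifference-∖ X Y z) (to (h z) z∈))
                                  (λ z z∈ → from (h z) (to (isDifference-∖ X Y z) z∈))

  private
    isIntersection isDifference : Fin n → Fin n → Fin n → Formula n
    isIntersection Z X Y = ∀̇ (v0 ∈̇ ↑ Z ⇔̇ (v0 ∈̇ ↑ X ∧̇ v0 ∈̇ ↑ Y))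
    isDifference Z X Y = ∀̇ (v0 ∈̇ ↑ Z ⇔̇ (v0 ∈̇ ↑ X ∧̇ ¬̇ (v0 ∈̇ ↑ Y)))

    isUnion : Fin n → Fin n → Fin n → Formula n
    isUnion Z X Y = ∀̇ (v0 ∈̇ ↑ Z ⇔̇ v0 ∈̇ ↑ X ∨̇ v0 ∈̇ ↑ Y)

  union-unique : ∀ {Z Z′ X Y} → (∀ x → x ∈ Z ⇔ (x ∈ X ⊎ x ∈ Y)) → (∀ x → x ∈ Z′ ⇔ (x ∈ X ⊎ x ∈ Y)) → Z ≡ Z′
  union-unique h h′ = ext (λ x x∈ → from (h′ x) (to (h x) x∈)) (λ x x∈ → from (h x) (to (h′ x) x∈))

  isUnion-∪ : ∀ X Y x → x ∈ X ∪ Y ⇔ (x ∈ X ⊎ x ∈ Y)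
  isUnion-∪ X Y x = mk⇔ ∪⁻ λ { (inj₁ p) → ∪-inl _ _ _ p ; (inj₂ p) → ∪-inr _ _ _ p }

  -- For fixed `Z₀` the unions form the image of the finite `W₁` under a function, and `fin-⋃` then
  -- runs over `Z₀`.
  pairwise-unions-finite : ∀ {S W₀ W₁} → W₀ ∈ fin (𝒫 S) → W₁ ∈ fin (𝒫 S) →
    ∃[ W ] W ∈ fin (𝒫 S) × (∀ Z₀ Z₁ → Z₀ ∈ W₀ → Z₁ ∈ W₁ → Z₀ ∪ Z₁ ∈ W)
  pairwise-unions-finite {S} {W₀} {W₁} W₀∈ W₁∈ =
    let W , W∈ , h = fin-⋃ R W₀ W₀∈ sections in
    W , W∈ , λ Z₀ Z₁ Z₀∈ Z₁∈ → h Z₀ Z₀∈ _ (rel-maps⁺ φ _ _ _ (fin-⊆ W₀∈ _ Z₀∈) (∪⊆ Z₀∈ Z₁∈)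
                                          λ _ → Z₁ , Z₁∈ , isUnion-∪ Z₀ Z₁)
    where
    φ : Formula 6
    φ = ∃̇ (v0 ∈̇ v6 ∧̇ isUnion v1 v2 v0)
    R : V
    R = rel φ (W₁ ∷ []) (𝒫 S) (𝒫 S)
    ∪⊆ : ∀ {Z₀ Z₁} → Z₀ ∈ W₀ → Z₁ ∈ W₁ → Z₀ ∪ Z₁ ∈ 𝒫 S
    ∪⊆ Z₀∈ Z₁∈ = 𝒫⁺ λ x x∈ → [ 𝒫⁻ (fin-⊆ W₀∈ _ Z₀∈) x , 𝒫⁻ (fin-⊆ W₁∈ _ Z₁∈) x ]′ (∪⁻ x∈)
    sections : ∀ Z₀ → Z₀ ∈ W₀ → ∃[ W ] W ∈ fin (𝒫 S) × (∀ Z → Maps R Z₀ Z → Z ∈ W)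
    sections Z₀ Z₀∈ = image R₀ W₁ (𝒫 S) , fin-image R₀ W₁ functional (λ m → proj₁ (R₀⁻ m)) W₁∈ , covers
      where
      R₀ : V
      R₀ = rel (isUnion v0 v5 v1) (Z₀ ∷ []) (𝒫 S) (𝒫 S)
      R₀⁻ : ∀ {Z₁ Z} → Maps R₀ Z₁ Z → Z ∈ 𝒫 S × (∀ x → x ∈ Z ⇔ (x ∈ Z₀ ⊎ x ∈ Z₁))
      R₀⁻ m = let _ , b , _ , h = rel-maps⁻ (isUnion v0 v5 v1) _ _ _ m in b , h
      functional : Functional R₀
      functional m m′ = union-unique (proj₂ (R₀⁻ m)) (proj₂ (R₀⁻ m′))
      covers : ∀ Z → Maps R Z₀ Z → Z ∈ image R₀ W₁ (𝒫 S)
      covers Z m = let _ , Z∈ , _ , Z₁ , Z₁∈ , h = rel-maps⁻ φ _ _ _ m in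
        image⁺ Z₁∈ Z∈ (rel-maps⁺ (isUnion v0 v5 v1) _ _ _ (fin-⊆ W₁∈ _ Z₁∈) Z∈ λ _ → h)

  module _ (S F : V) (F⊆ : F ⊆ (ω ⊗ 𝒫 S)) (F-functional : Functional F)
           (F-total : ∀ n → n ∈ ω → ∃[ Y ] Maps F n Y)
           (F-injective : ∀ {m n Y} → Maps F m Y → Maps F n Y → m ≡ n) where

    private
      𝓕 : V
      𝓕 = image F ω (𝒫 S)

      𝓕⁺ : ∀ {n Y} → Maps F n Y → Y ∈ 𝓕
      𝓕⁺ m = let n∈ , Y∈ = maps-⊗ F⊆ m in image⁺ n∈ Y∈ m

      -- The sets of `𝓕` leave only finitely many traces on `C`. The construction stays among the
      -- sets in `T`, on which infinitely many traces remain.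
      Small : V → Set ℓ
      Small C = ∃[ W ] W ∈ fin (𝒫 S) × (∀ Y → Y ∈ 𝓕 → Y ∩ C ∈ W)

      small : Formula 3
      small = ∃̇ (v0 ∈̇ v2 ∧̇ (∀̇ (v0 ∈̇ v4 ⇒̇ (∃̇ (isIntersection v0 v1 v3 ∧̇ v0 ∈̇ v2)))))

      abstract
        T : V
        T = sep (¬̇ small) (fin (𝒫 S) ∷ 𝓕 ∷ []) (𝒫 S)

        T⁺ : ∀ {C} → C ⊆ S → ¬ Small C → C ∈ T
        T⁺ {C} C⊆ ¬s = sep⁺ (¬̇ small) _ _ (𝒫⁺ C⊆) λ { (W , W∈ , h) → ¬s (W , W∈ , λ Y Y∈ → conv W Y (h Y Y∈)) }
          where
          conv : ∀ W Y → (∃[ Z ] IsIntersection Z Y C × Z ∈ W) → Y ∩ C ∈ W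
          conv W Y (Z , i , Z∈) = subst (_∈ W) (intersection≡ i) Z∈

        T⁻ : ∀ {C} → C ∈ T → C ⊆ S × ¬ Small C
        T⁻ C∈ = let a , b = sep⁻ (¬̇ small) _ _ C∈ in
          𝒫⁻ a , λ { (W , W∈ , h) → b (W , W∈ , λ Y Y∈ → _ , isIntersection-∩ Y _ , h Y Y∈) }

      -- `Small` contains the term `Y ∩ C` and is thus not literally a formula that excluded middle
      -- decides; its double negation suffices, being used only towards a contradiction.
      ∉T⇒¬¬small : ∀ {C} → C ⊆ S → ¬ C ∈ T → ¬ ¬ Small C
      ∉T⇒¬¬small C⊆ C∉ ¬s = C∉ (T⁺ C⊆ ¬s)

      -- A trace on `C` is the union of the traces on the two parts. Consequently, however a member
      -- of `T` is cut in two, one half stays in `T`.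
      small-split : ∀ {C} Y → Small (C ∩ Y) → Small (C ∖ Y) → Small C
      small-split {C} Y (W₀ , W₀∈ , h₀) (W₁ , W₁∈ , h₁) =
        let W , W∈ , h = pairwise-unions-finite W₀∈ W₁∈ in
        W , W∈ , λ X X∈ → subst (_∈ W) (ext (l X) (r X)) (h _ _ (h₀ X X∈) (h₁ X X∈))
        where
        l : ∀ X x → x ∈ (X ∩ (C ∩ Y)) ∪ (X ∩ (C ∖ Y)) → x ∈ X ∩ C
        l X x x∈ with ∪⁻ x∈
        ... | inj₁ p = let a , b = ∩⁻ p in ∩⁺ a (proj₁ (∩⁻ b))
        ... | inj₂ p = let a , b = ∩⁻ p in ∩⁺ a (proj₁ (∖⁻ b))
        r : ∀ X x → x ∈ X ∩ C → x ∈ (X ∩ (C ∩ Y)) ∪ (X ∩ (C ∖ Y))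
        r X x x∈ with ∩⁻ x∈ | x ∈? Y
        ... | a , b | yes p = ∪-inl _ _ _ (∩⁺ a (∩⁺ b p))
        ... | a , b | no ¬p = ∪-inr _ _ _ (∩⁺ a (∖⁺ b ¬p))

      -- The traces on `S` are the sets `F n` themselves. A finite family containing them would pull
      -- back along the injective `F` to a finite set containing `ω`.
      S∈T : S ∈ T
      S∈T = T⁺ (λ _ p → p) λ { (W , W∈ , h) → ω∉fin (fin-sub (preimage W W∈) (covers W h)) }
        where
        F⁻¹ : V
        F⁻¹ = rel (maps v5 v0 v1) (F ∷ []) (𝒫 S) ω
        F⁻¹⁻ : ∀ {Y n} → Maps F⁻¹ Y n → n ∈ ω × Maps F n Y
        F⁻¹⁻ m = let _ , n∈ , _ , h = rel-maps⁻ (maps v5 v0 v1) _ _ _ m in n∈ , h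
        preimage : ∀ W → W ∈ fin (𝒫 S) → image F⁻¹ W ω ∈ fin ω
        preimage W = fin-image F⁻¹ W (λ m m′ → F-injective (proj₂ (F⁻¹⁻ m)) (proj₂ (F⁻¹⁻ m′))) (λ m → proj₁ (F⁻¹⁻ m))
        covers : ∀ W → (∀ Y → Y ∈ 𝓕 → Y ∩ S ∈ W) → ω ⊆ image F⁻¹ W ω
        covers W h n n∈ =
          let Y , m = F-total n n∈
              Y∈ = proj₂ (maps-⊗ F⊆ m)
              Y∩S≡Y = ext (λ x x∈ → proj₁ (∩⁻ x∈)) (λ x x∈ → ∩⁺ x∈ (𝒫⁻ Y∈ x x∈))
          in image⁺ (subst (_∈ W) Y∩S≡Y (h Y (𝓕⁺ m))) n∈ (rel-maps⁺ (maps v5 v0 v1) _ _ _ Y∈ n∈ λ _ → m)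

      Splits : V → V → Set ℓ
      Splits C m = ∃[ Y ] Maps F m Y × (∃[ x ] x ∈ C × x ∈ Y) × (∃[ x ] x ∈ C × ¬ x ∈ Y)

      splits : Fin n → Fin n → Fin n → Formula n
      splits F C m = ∃̇ (maps (↑ F) (↑ m) v0 ∧̇ (∃̇ (v0 ∈̇ ↑ ↑ C ∧̇ v0 ∈̇ v1)) ∧̇ (∃̇ (v0 ∈̇ ↑ ↑ C ∧̇ ¬̇ (v0 ∈̇ v1))))

      -- If no set of `𝓕` splits `C`, each trace on `C` is `∅` or `C`, and two traces are finitely
      -- many.
      T-splits : ∀ C → C ∈ T → ∃[ m ] m ∈ ω × Splits C m
      T-splits C C∈ with excluded-middle (∃̇ (v0 ∈̇ v3 ∧̇ splits v2 v1 v0)) (C ∷ F ∷ ω ∷ [])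
      ... | yes p = p
      ... | no none = ⊥-elim (proj₂ (T⁻ C∈) (∅ ⨾ ∅ ⨾ C , W∈ , covers))
        where
        W∈ : ∅ ⨾ ∅ ⨾ C ∈ fin (𝒫 S)
        W∈ = fin-⨾ (fin-⁅⁆ (𝒫⁺ λ z z∈ → ⊥-elim (∉∅ z z∈))) (𝒫⁺ (proj₁ (T⁻ C∈)))
        covers : ∀ Y → Y ∈ 𝓕 → Y ∩ C ∈ ∅ ⨾ ∅ ⨾ C
        covers Y Y∈ with nonempty? (C ∩ Y) | nonempty? (C ∖ Y)
        ... | inj₁ (x , x∈) | inj₁ (y , y∈) =
          let _ , m , m∈ , q = image⁻ Y∈ in ⊥-elim (none (m , m∈ , Y , q , (x , ∩⁻ x∈) , (y , ∖⁻ y∈)))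
        ... | inj₂ emp | _ =
          subst (_∈ _) (sym (empty≡∅ λ z z∈ → let a , b = ∩⁻ z∈ in emp z (∩⁺ b a))) (⨾-old ⨾-new)
        ... | inj₁ _ | inj₂ emp = subst (_∈ _) (sym (ext (λ z z∈ → proj₂ (∩⁻ z∈)) r)) ⨾-new
          where
          r : ∀ z → z ∈ C → z ∈ Y ∩ C
          r z z∈ with z ∈? Y
          ... | yes p = ∩⁺ p z∈
          ... | no ¬p = ⊥-elim (emp z (∖⁺ z∈ ¬p))

      -- Using the first F m that splits C, and preferring the half inside F m,
      -- makes C′ a function of C.
      Half : V → V → V → Set ℓ
      Half C C′ Y = C′ ≡ C ∩ Y ⊎ (¬ C ∩ Y ∈ T × C′ ≡ C ∖ Y)

      Next : V → V → Set ℓ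
      Next C C′ = ∃[ m ] m ∈ ω × Splits C m × (∀ m′ → m′ ∈ m → ¬ Splits C m′) × (∃[ Y ] Maps F m Y × Half C C′ Y)

      half : Fin n → Fin n → Fin n → Fin n → Formula n
      half T C C′ Y = isIntersection C′ C Y ∨̇
        ((∀̇ (isIntersection v0 (↑ C) (↑ Y) ⇒̇ ¬̇ (v0 ∈̇ ↑ T))) ∧̇ isDifference C′ C Y)

      next : Formula 7
      next = ∃̇ (v0 ∈̇ v7 ∧̇ splits v6 v2 v0 ∧̇ (∀̇ (v0 ∈̇ v1 ⇒̇ ¬̇ (splits v7 v3 v0))) ∧̇
                (∃̇ (maps v7 v1 v0 ∧̇ half v5 v3 v2 v0)))

      abstract
        N : V
        N = rel next (F ∷ ω ∷ []) T T

        N⁺ : ∀ {C C′} → C ∈ T → C′ ∈ T → Next C C′ → Maps N C C′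
        N⁺ {C} {C′} C∈ C′∈ (m , m∈ , s , l , Y , q , h) =
          rel-maps⁺ next _ _ _ C∈ C′∈ λ _ → m , m∈ , s , l , Y , q , conv h
          where
          conv : Half C C′ Y → IsIntersection C′ C Y ⊎ ((∀ I → IsIntersection I C Y → ¬ I ∈ T) × IsDifference C′ C Y)
          conv (inj₁ refl) = inj₁ (isIntersection-∩ C Y)
          conv (inj₂ (¬t , refl)) =
            inj₂ ((λ I i I∈ → ¬t (subst (_∈ T) (intersection≡ i) I∈)) , isDifference-∖ C Y)

        N⁻ : ∀ {C C′} → Maps N C C′ → Next C C′
        N⁻ {C} {C′} q with rel-maps⁻ next _ _ _ q
        ... | _ , _ , _ , m , m∈ , s , l , Y , q′ , inj₁ i = m , m∈ , s , l , Y , q′ , inj₁ (intersection≡ i)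
        ... | _ , _ , _ , m , m∈ , s , l , Y , q′ , inj₂ (¬t , d) =
          m , m∈ , s , l , Y , q′ , inj₂ (¬t _ (isIntersection-∩ C Y) , difference≡ d)

        N⊆ : N ⊆ (T ⊗ T)
        N⊆ = rel-⊆ next _ _ _

      N-functional : Functional N
      N-functional q q′ with N⁻ q | N⁻ q′
      ... | m , m∈ , s , l , Y , f , h | m′ , m′∈ , s′ , l′ , Y′ , f′ , h′
        with ∈-trichotomy (nat-ordinal m∈) (nat-ordinal m′∈)
      ... | inj₁ p = ⊥-elim (l′ m p s)
      ... | inj₂ (inj₂ p) = ⊥-elim (l m′ p s′)
      ... | inj₂ (inj₁ refl) with F-functional f f′
      ... | refl with h | h′
      ... | inj₁ e | inj₁ e′ = trans e (sym e′)
      ... | inj₂ (_ , e) | inj₂ (_ , e′) = trans e (sym e′)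
      ... | inj₁ refl | inj₂ (¬t , _) = ⊥-elim (¬t (proj₂ (maps-⊗ N⊆ q)))
      ... | inj₂ (¬t , _) | inj₁ refl = ⊥-elim (¬t (proj₂ (maps-⊗ N⊆ q′)))

      N-total : ∀ C → C ∈ T → ∃[ C′ ] Maps N C C′
      N-total C C∈ =
        let m₀ , m₀∈ , s₀ = T-splits C C∈
            m , m∈ , s@(Y , f , _) , l = ω-least (splits v1 v2 v0) (F ∷ C ∷ []) m₀ m₀∈ s₀
        in choose m m∈ s l Y f (C ∩ Y ∈? T)
        where
        choose : ∀ m → m ∈ ω → Splits C m → (∀ m′ → m′ ∈ m → ¬ Splits C m′) → ∀ Y → Maps F m Y →
                 Dec (C ∩ Y ∈ T) → ∃[ C′ ] Maps N C C′
        choose m m∈ s l Y f (yes t) = C ∩ Y , N⁺ C∈ t (m , m∈ , s , l , Y , f , inj₁ refl)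
        choose m m∈ s l Y f (no ¬t) = C ∖ Y , N⁺ C∈ other (m , m∈ , s , l , Y , f , inj₂ (¬t , refl))
          where
          C⊆ : C ⊆ S
          C⊆ = proj₁ (T⁻ C∈)
          other : C ∖ Y ∈ T
          other = T⁺ (λ x x∈ → C⊆ x (proj₁ (∖⁻ x∈))) λ s₁ →
            ∉T⇒¬¬small (λ x x∈ → C⊆ x (proj₁ (∩⁻ x∈))) ¬t λ s₀ → proj₂ (T⁻ C∈) (small-split Y s₀ s₁)

      N-shrinks : ∀ {C C′} → Maps N C C′ → (∀ x → x ∈ C′ → x ∈ C) × (∃[ x ] x ∈ C × ¬ x ∈ C′)
      N-shrinks q with N⁻ q
      ... | m , m∈ , (Y , f , (x , x∈C , x∈Y) , (y , y∈C , y∉Y)) , l , Y′ , f′ , h with F-functional f f′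
      N-shrinks q | m , m∈ , (Y , f , (x , x∈C , x∈Y) , (y , y∈C , y∉Y)) , l , Y′ , f′ , inj₁ refl | refl =
        (λ z z∈ → proj₁ (∩⁻ z∈)) , y , y∈C , λ p → y∉Y (proj₂ (∩⁻ p))
      N-shrinks q | m , m∈ , (Y , f , (x , x∈C , x∈Y) , (y , y∈C , y∉Y)) , l , Y′ , f′ , inj₂ (_ , refl) | refl =
        (λ z z∈ → proj₁ (∖⁻ z∈)) , x , x∈C , λ p → proj₂ (∖⁻ p) x∈Y

      module _ (E : V) (E⊆ : E ⊆ (ω ⊗ T)) (E-functional : Functional E) (E-total : ∀ n → n ∈ ω → ∃[ C ] Maps E n C)
               (E-suc : ∀ {n C C′} → Maps E n C → Maps N C C′ → Maps E (n ⨾ n) C′) where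

        -- An element lost in the step after `n` is thus in no later set of the sequence, which
        -- makes its level unique.
        E-antitone : ∀ m → m ∈ ω → ∀ n → n ∈ m → ∀ C C′ D → Maps E n C → Maps N C C′ → Maps E m D →
                     ∀ x → x ∈ D → x ∈ C′
        E-antitone = ω-ind (∀̇ (v0 ∈̇ v1 ⇒̇ (∀̇ ∀̇ ∀̇ (maps v5 v3 v2 ⇒̇ maps v6 v2 v1 ⇒̇ maps v5 v4 v0 ⇒̇ (∀̇ (v0 ∈̇ v1 ⇒̇ v0 ∈̇ v2))))))
          (E ∷ N ∷ []) (λ n n∈ → ⊥-elim (∉∅ n n∈)) step
          where
          step : ∀ m → m ∈ ω →
                 (∀ n → n ∈ m → ∀ C C′ D → Maps E n C → Maps N C C′ → Maps E m D → ∀ x → x ∈ D → x ∈ C′) →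
                 ∀ n → n ∈ m ⨾ m → ∀ C C′ D → Maps E n C → Maps N C C′ → Maps E (m ⨾ m) D → ∀ x → x ∈ D → x ∈ C′
          step m m∈ ih n n∈ C C′ D e q d x x∈ with E-total m m∈
          ... | B , b with N-total B (proj₂ (maps-⊗ E⊆ b))
          ... | B′ , q′ with E-functional (E-suc b q′) d
          ... | refl with ⨾⁻ n∈
          ... | inj₁ p = ih n p C C′ B e q b x (proj₁ (N-shrinks q′) x x∈)
          ... | inj₂ refl with E-functional e b
          ... | refl with N-functional q q′
          ... | refl = x∈

        -- The layers between consecutive sets of the sequence are disjoint and nonempty. Elements
        -- common to all sets of the sequence have no level, so `level` is only a partial map.
        Dropped : V → V → Set ℓ
        Dropped x n = ∃[ C ] ∃[ C′ ] Maps E n C × Maps N C C′ × x ∈ C × ¬ x ∈ C′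

        dropped : Formula 7
        dropped = ∃̇ ∃̇ (maps v7 v2 v1 ∧̇ maps v8 v1 v0 ∧̇ v3 ∈̇ v1 ∧̇ ¬̇ (v3 ∈̇ v0))

        abstract
          level : V
          level = rel dropped (E ∷ N ∷ []) S ω

          level⁺ : ∀ {x n} → x ∈ S → n ∈ ω → Dropped x n → Maps level x n
          level⁺ x∈ n∈ h = rel-maps⁺ dropped _ _ _ x∈ n∈ λ _ → h

          level⁻ : ∀ {x n} → Maps level x n → n ∈ ω × Dropped x n
          level⁻ m = let _ , n∈ , _ , h = rel-maps⁻ dropped _ _ _ m in n∈ , h

          level⊆ : level ⊆ (S ⊗ ω)
          level⊆ = rel-⊆ dropped _ _ _

        level-functional : Functional level
        level-functional q q′ with level⁻ q | level⁻ q′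
        ... | n∈ , C , C′ , e , s , x∈ , x∉ | m∈ , D , D′ , e′ , s′ , x∈′ , x∉′
          with ∈-trichotomy (nat-ordinal n∈) (nat-ordinal m∈)
        ... | inj₁ p = ⊥-elim (x∉ (E-antitone _ m∈ _ p C C′ D e s e′ _ x∈′))
        ... | inj₂ (inj₁ p) = p
        ... | inj₂ (inj₂ p) = ⊥-elim (x∉′ (E-antitone _ n∈ _ p D D′ C e′ s′ e _ x∈))

        level-onto : ∀ n → n ∈ ω → ∃[ x ] Maps level x n
        level-onto n n∈ =
          let C , e = E-total n n∈
              C∈ = proj₂ (maps-⊗ E⊆ e)
              C′ , s = N-total C C∈
              _ , x , x∈ , x∉ = N-shrinks s
          in x , level⁺ (proj₁ (T⁻ C∈) x x∈) n∈ (C , C′ , e , s , x∈ , x∉)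

    maps-onto-ω : ∃[ q ] q ⊆ (S ⊗ ω) × Functional q × (∀ n → n ∈ ω → ∃[ x ] Maps q x n)
    maps-onto-ω =
      let E , E⊆ , fun , tot , _ , E-suc = ω-recursion T S N S∈T N⊆ N-functional N-total in
      level E E⊆ fun tot E-suc , level⊆ E E⊆ fun tot E-suc ,
      level-functional E E⊆ fun tot E-suc , level-onto E E⊆ fun tot E-suc

-- The diagonal recursion over nonempty finite sets of indices.

code : Fin n → Fin n → Fin n → Fin n → Fin n → Formula n
code C l i x y = ∃̇ ∃̇ (isOrderedPair v1 (↑ ↑ l) (↑ ↑ i) ∧̇ isOrderedPair v0 (↑ ↑ x) (↑ ↑ y) ∧̇ maps (↑ ↑ C) v1 v0)

module Diagonalisation {ℓ : Level} (M : ZFModel ℓ) where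
  open ZFModel M
  open Basics M
  open Ordinals M
  open Recursion M
  open FiniteSets M
  open FiniteOrder M

  Code : V → V → V → V → V → Set ℓ
  Code C l i x y = ∃[ p ] ∃[ q ] IsOrderedPair p l i × IsOrderedPair q x y × Maps C p q

  -- C l i is an injection of the l-th initial segment of L into a smaller one
  -- (or into B when l ∈ B), and these have disjoint ranges for distinct i.
  record IsCoding (L R B C j : V) : Set ℓ where
    field
      base⊆        : B ⊆ L
      injective    : ∀ {l i i′ x x′ y} → Code C l i x y → Code C l i′ x′ y → i ≡ i′ × x ≡ x′
      functional   : ∀ {l i x y y′} → Code C l i x y → Code C l i x y′ → y ≡ y′
      total        : ∀ {l i x} → l ∈ L → i ∈ ω → x ∈ L → ¬ Maps R l x → ∃[ y ] Code C l i x y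
      range        : ∀ {l i x y} → Code C l i x y → x ∈ L × y ∈ L
      range-base   : ∀ {l i x y} → l ∈ B → Code C l i x y → y ∈ B
      range-below  : ∀ {l i x y} → ¬ l ∈ B → Code C l i x y → Maps R y l
      unused       : ∀ {l i x} → ¬ Code C l i x j
      unused-base  : j ∈ B
      unused-below : ∀ {l} → l ∈ L → ¬ l ∈ B → Maps R j l

  seq⁻ : ∀ {S t} → t ∈ seq S →
         ∃[ n ] n ∈ ω × t ⊆ (n ⊗ S) × (∀ i → i ∈ n → ∃[ x ] Maps t i x) × Functional t
  seq⁻ {S} {t} t∈ with to (∈-seq S t) t∈
  ... | n , nat , pairs , tot , fun = n , from (∈-ω n) nat , sub , tot , λ m m′ → fun _ _ _ m m′
    where
    sub : t ⊆ (n ⊗ S)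
    sub p p∈ with pairs p p∈
    ... | x , y , x∈ , y∈ , h with orderedPair≡ h
    ... | refl = ⊗⁺ x∈ y∈

  seq-ext : ∀ {S t t′} → t ∈ seq S → t′ ∈ seq S → (∀ i x → Maps t i x → Maps t′ i x) →
            (∀ i x → Maps t′ i x → Maps t i x) → t ≡ t′
  seq-ext t∈ t′∈ h h′ = ext (sub t∈ h) (sub t′∈ h′)
    where
    sub : ∀ {S t t′} → t ∈ seq S → (∀ i x → Maps t i x → Maps t′ i x) → ∀ p → p ∈ t → p ∈ t′
    sub t∈ h p p∈ =
      let _ , _ , t⊆ , _ = seq⁻ t∈
          i , x , e , _ = ⊗⁻ (t⊆ p p∈)
      in subst (_∈ _) (sym e) (maps⁻ (h i x (maps⁺ (subst (_∈ _) e p∈))))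

  seq-index : ∀ {S t i x} → t ∈ seq S → Maps t i x → i ∈ ω × x ∈ S
  seq-index t∈ m = let n , n∈ , t⊆ , _ = seq⁻ t∈ ; i∈ , x∈ = maps-⊗ t⊆ m in ω-transitive n n∈ _ i∈ , x∈

  module _ (S f : V) (f-dom : ∀ {t z} → Maps f t z → t ∈ seq S) (f-functional : Functional f)
           (f-injective : ∀ {t t′ z} → Maps f t z → Maps f t′ z → t ≡ t′)
           (f-onto : ∀ z → z ⊆ S → ∃[ t ] Maps f t z)
           {L R : V} (wo : WellOrder L R) {B C j : V} (coding : IsCoding L R B C j)
           (q : V) (q-dom : ∀ {s y} → Maps q s y → s ∈ S) (q-functional : Functional q)
           (q-onto : ∀ y → y ∈ fin B → ∃[ s ] Maps q s y) where

    private
      module C = IsCoding coding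
      open WellOrder wo using (tri)

    X O : V
    X = fin L − ∅
    O = restrictOrder (finOrder wo) X

    abstract
      X-wellOrder : WellOrder X O
      X-wellOrder = restrict-wellOrder (fin-wellOrder wo) λ z z∈ → proj₁ (−⁻ z∈)

    -- A partial map from `s` to finite subsets `y` of `L`: the inverse of the function `g` built so
    -- far, replaced by `q` when `l` lies in the base.
    Carries : V → V → V → V → Set ℓ
    Carries g l s y = (¬ l ∈ B × Maps g y s) ⊎ (l ∈ B × Maps q s y)

    -- The i-th entry of t is g v for v = { z | C l i z ∈ y }; an empty v, which
    -- is not in the domain of g, means that there is no i-th entry.
    Decodes : V → V → V → V → Set ℓ
    Decodes g l y t = t ∈ seq S ×
      (∀ i x → Maps t i x ⇔ (∃[ v ] Maps g v x × (∀ z → z ∈ v ⇔ (∃[ w ] w ∈ y × Code C l i z w))))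

    -- `Carries` followed by `Decodes` sends `s` to a sequence `t`; this is Cantor's condition that
    -- `s` is not in the value of `f` at `t`.
    Diagonal : V → V → V → Set ℓ
    Diagonal g l s = ∃[ y ] ∃[ t ] ∃[ z ] Carries g l s y × Decodes g l y t × Maps f t z × ¬ s ∈ z

    Fresh : V → V → V → Set ℓ
    Fresh g D s = ∃[ t ] Maps f t D × (∃[ i ] Maps t i s × (∀ w → ¬ Maps g w s) ×
                    (∀ k → k ∈ i → ∀ x → Maps t k x → ∃[ w ] Maps g w x))

    private
      carries : Fin n → Fin n → Fin n → Fin n → Fin n → Fin n → Formula n
      carries B q g l s y = (¬̇ (l ∈̇ B) ∧̇ maps g y s) ∨̇ (l ∈̇ B ∧̇ maps q s y)

      decodes : Fin n → Fin n → Fin n → Fin n → Fin n → Fin n → Formula n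
      decodes Q C g l y t = t ∈̇ Q ∧̇
        (∀̇ ∀̇ (maps (↑ ↑ t) v1 v0 ⇔̇
          (∃̇ (maps (↑ ↑ ↑ g) v0 v1 ∧̇
            (∀̇ (v0 ∈̇ v1 ⇔̇ (∃̇ (v0 ∈̇ ↑ ↑ ↑ ↑ ↑ y ∧̇ code (↑ ↑ ↑ ↑ ↑ C) (↑ ↑ ↑ ↑ ↑ l) v4 v1 v0))))))))

      δ : Formula 10
      δ = ∃̇ ∃̇ (isOrderedPair v3 v1 v0 ∧̇
            (∃̇ ∃̇ ∃̇ (carries v10 v11 v4 v3 v5 v2 ∧̇ decodes v12 v13 v4 v3 v2 v1 ∧̇ maps v14 v1 v0 ∧̇ ¬̇ (v5 ∈̇ v0))))

      abstract
        Δ : V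
        Δ = rel δ (B ∷ q ∷ seq S ∷ C ∷ f ∷ []) (𝒫 (X ⊗ S) ⊗ L) S

        Δ⁺ : ∀ {g l s} → g ⊆ (X ⊗ S) → l ∈ L → s ∈ S → Diagonal g l s → Maps₂ Δ g l s
        Δ⁺ {g} {l} g⊆ l∈ s∈ h =
          maps₂-⟨⟩ (rel-maps⁺ δ _ _ _ (⊗⁺ (𝒫⁺ g⊆) l∈) s∈ λ _ → g , l , isOrderedPair-⟨⟩ g l , h)

        Δ⁻ : ∀ {g l s} → Maps₂ Δ g l s → Diagonal g l s
        Δ⁻ m with rel-maps⁻ δ _ _ _ (maps₂⁻ m)
        ... | _ , _ , _ , g , l , e , h with orderedPair-injective e (isOrderedPair-⟨⟩ _ _)
        ... | refl , refl = h

        D : V → V → V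
        D g l = sep (maps₂ v1 v2 v3 v0) (Δ ∷ g ∷ l ∷ []) S

        D-spec : ∀ g l s → s ∈ D g l ⇔ (s ∈ S × Maps₂ Δ g l s)
        D-spec g l = ∈-sep (maps₂ v1 v2 v3 v0) (Δ ∷ g ∷ l ∷ []) S

      D⁺ : ∀ {g l s} → g ⊆ (X ⊗ S) → l ∈ L → s ∈ S → Diagonal g l s → s ∈ D g l
      D⁺ g⊆ l∈ s∈ h = from (D-spec _ _ _) (s∈ , Δ⁺ g⊆ l∈ s∈ h)

      D⁻ : ∀ {g l s} → s ∈ D g l → s ∈ S × Diagonal g l s
      D⁻ s∈ = let a , b = to (D-spec _ _ _) s∈ in a , Δ⁻ b

      decodes-functional : ∀ {g l y t t′} → Decodes g l y t → Decodes g l y t′ → t ≡ t′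
      decodes-functional (t∈ , h) (t′∈ , h′) =
        seq-ext t∈ t′∈ (λ i x m → from (h′ i x) (to (h i x) m)) (λ i x m → from (h i x) (to (h′ i x) m))

      module _ (g l : V) (g⊆ : g ⊆ (X ⊗ S)) (g-functional : Functional g)
               (g-injective : ∀ {v w s} → Maps g v s → Maps g w s → v ≡ w) (l∈ : l ∈ L)
               (g-bounded : ∀ {v s} → Maps g v s → ∀ z → z ∈ v → ¬ Maps R l z) where

        carries-functional : ∀ {s y y′} → Carries g l s y → Carries g l s y′ → y ≡ y′
        carries-functional (inj₁ (_ , m)) (inj₁ (_ , m′)) = g-injective m m′
        carries-functional (inj₂ (_ , m)) (inj₂ (_ , m′)) = q-functional m m′
        carries-functional (inj₁ (l∉ , _)) (inj₂ (l∈B , _)) = ⊥-elim (l∉ l∈B)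
        carries-functional (inj₂ (l∈B , _)) (inj₁ (l∉ , _)) = ⊥-elim (l∉ l∈B)

        -- Cantor's contradiction: `s` would belong to `D g l` exactly if it did not. When `s` is in
        -- `D g l`, the witnesses of its membership are `y` and `t` again, because carrying,
        -- decoding and `f` are all functional.
        not-decoded : ∀ {t s y} → Maps f t (D g l) → s ∈ S → Carries g l s y → ¬ Decodes g l y t
        not-decoded {t} {s} {y} ft s∈ c d with s ∈? D g l
        ... | no s∉ = s∉ (D⁺ g⊆ l∈ s∈ (y , t , D g l , c , d , ft , s∉))
        ... | yes s∈D =
          let _ , y′ , t′ , z , c′ , d′ , ft′ , s∉z = D⁻ s∈D
              y≡y′ = carries-functional c c′
              t≡t′ = decodes-functional d (subst (λ y → Decodes g l y t′) (sym y≡y′) d′)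
              D≡z = f-functional ft (subst (λ t → Maps f t z) (sym t≡t′) ft′)
          in s∉z (subst (s ∈_) D≡z s∈D)

        abstract
          codeOf : V → V
          codeOf i = rel (code v5 v6 v7 v1 v0) (C ∷ l ∷ i ∷ []) L L

          codeOf⁺ : ∀ {i z w} → Code C l i z w → Maps (codeOf i) z w
          codeOf⁺ c = let z∈ , w∈ = C.range c in rel-maps⁺ (code v5 v6 v7 v1 v0) _ _ _ z∈ w∈ λ _ → c

          codeOf⁻ : ∀ {i z w} → Maps (codeOf i) z w → w ∈ L × Code C l i z w
          codeOf⁻ m = let _ , w∈ , _ , h = rel-maps⁻ (code v5 v6 v7 v1 v0) _ _ _ m in w∈ , h

        module _ (t : V) where

          Entry : V → V → Set ℓ
          Entry i w = ∃[ x ] ∃[ v ] ∃[ z ] Maps t i x × Maps g v x × z ∈ v × Code C l i z w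

          entry : Formula 9
          entry = ∃̇ ∃̇ ∃̇ (maps v8 v4 v2 ∧̇ maps v9 v1 v2 ∧̇ v0 ∈̇ v1 ∧̇ code v10 v11 v4 v0 v3)

          abstract
            K : V
            K = rel entry (t ∷ g ∷ C ∷ l ∷ []) ω L

            K⁺ : ∀ {i w} → i ∈ ω → w ∈ L → Entry i w → Maps K i w
            K⁺ i∈ w∈ h = rel-maps⁺ entry _ _ _ i∈ w∈ λ _ → h

            K⁻ : ∀ {i w} → Maps K i w → i ∈ ω × w ∈ L × Entry i w
            K⁻ m = let i∈ , w∈ , _ , h = rel-maps⁻ entry _ _ _ m in i∈ , w∈ , h

          -- The code of `t`. The extra `j` makes it nonempty even for the empty sequence, as
          -- membership in `X` demands; since `j` is never a value of `C`, decoding ignores it.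
          y : V
          y = image K ω L ⨾ j

        module _ (t : V) (t∈ : t ∈ seq S) (t-range : ∀ i x → Maps t i x → ∃[ v ] Maps g v x) where

          t-functional : Functional t
          t-functional = let _ , _ , _ , _ , fun = seq⁻ t∈ in fun

          entry-unique : ∀ {i x v w} → Maps t i x → Maps g v x → Entry t i w → ∃[ z ] z ∈ v × Code C l i z w
          entry-unique m m′ (x , v , z , n , n′ , z∈ , c) =
            let v≡ = g-injective m′ (subst (Maps g v) (sym (t-functional m n)) n′) in
            z , subst (z ∈_) (sym v≡) z∈ , c

          sections : ∀ n → (∀ i → i ∈ n → ∃[ x ] Maps t i x) →
                     ∀ i → i ∈ n → ∃[ W ] W ∈ fin L × (∀ w → Maps (K t) i w → w ∈ W)
          sections n tot i i∈ =
            let x , m = tot i i∈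
                v , m′ = t-range i x m
                v∈ = proj₁ (−⁻ (proj₁ (maps-⊗ g⊆ m′)))
            in image (codeOf i) v L ,
               fin-image (codeOf i) v (λ c c′ → C.functional (proj₂ (codeOf⁻ c)) (proj₂ (codeOf⁻ c′)))
                 (λ c → proj₁ (codeOf⁻ c)) v∈ ,
               λ w k → let _ , w∈ , e = K⁻ t k ; z , z∈ , c = entry-unique m m′ e in image⁺ z∈ w∈ (codeOf⁺ c)

          y∈fin : y t ∈ fin L
          y∈fin =
            let n , n∈ , t⊆ , tot , _ = seq⁻ t∈
                W , W∈ , h = fin-⋃ (K t) n (nat-fin n n∈) (sections n tot)
            in fin-⨾ (fin-sub W∈ λ w w∈ →
                 let _ , i , _ , k = image⁻ w∈
                     _ , _ , x , _ , _ , m , _ = K⁻ t k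
                 in h i (proj₁ (maps-⊗ t⊆ m)) w k) (C.base⊆ j C.unused-base)

          y-old : ∀ {w} → w ∈ image (K t) ω L → ∃[ i ] ∃[ z ] Code C l i z w
          y-old w∈ =
            let _ , i , _ , k = image⁻ w∈
                _ , _ , _ , _ , z , _ , _ , _ , c = K⁻ t k
            in i , z , c

          -- The injections for distinct `i` have disjoint ranges, so an element of the code reveals
          -- the entry it was made for.
          y⁻ : ∀ {i z w} → w ∈ y t → Code C l i z w → Entry t i w
          y⁻ {i} {z} {w} w∈ c = [ old , (λ e → ⊥-elim (C.unused (subst (Code C l i z) e c))) ]′ (⨾⁻ w∈)
            where
            old : w ∈ image (K t) ω L → Entry t i w
            old w∈ =
              let _ , i′ , _ , k = image⁻ w∈
                  _ , _ , e = K⁻ t k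
                  _ , _ , _ , _ , _ , _ , c′ = e
              in subst (λ i → Entry t i w) (sym (proj₁ (C.injective c c′))) e

          y⁺ : ∀ {i w} → Entry t i w → w ∈ y t
          y⁺ e@(_ , _ , _ , m , _ , _ , c) =
            let i∈ = proj₁ (seq-index t∈ m) ; w∈ = proj₂ (C.range c) in ⨾-old (image⁺ i∈ w∈ (K⁺ t i∈ w∈ e))

          decode-entry : ∀ {i x v} → Maps t i x → Maps g v x →
                         ∀ z → z ∈ v ⇔ (∃[ w ] w ∈ y t × Code C l i z w)
          decode-entry {i} {x} {v} m m′ z = mk⇔ left right
            where
            left : z ∈ v → ∃[ w ] w ∈ y t × Code C l i z w
            left z∈ =
              let z∈L = fin-⊆ (proj₁ (−⁻ (proj₁ (maps-⊗ g⊆ m′)))) z z∈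
                  w , c = C.total l∈ (proj₁ (seq-index t∈ m)) z∈L (g-bounded m′ z z∈)
              in w , y⁺ (x , v , z , m , m′ , z∈ , c) , c
            right : (∃[ w ] w ∈ y t × Code C l i z w) → z ∈ v
            right (w , w∈ , c) =
              let z′ , z′∈ , c′ = entry-unique m m′ (y⁻ w∈ c) in
              subst (_∈ v) (sym (proj₂ (C.injective c c′))) z′∈

          y-decodes : Decodes g l (y t) t
          y-decodes = t∈ , λ i x → mk⇔ (left i x) (right i x)
            where
            left : ∀ i x → Maps t i x → ∃[ v ] Maps g v x × (∀ z → z ∈ v ⇔ (∃[ w ] w ∈ y t × Code C l i z w))
            left i x m = let v , m′ = t-range i x m in v , m′ , decode-entry m m′
            right : ∀ i x → (∃[ v ] Maps g v x × (∀ z → z ∈ v ⇔ (∃[ w ] w ∈ y t × Code C l i z w))) → Maps t i x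
            -- Any element of `v` has its code in `y t`, which forces `t` to have an `i`-th entry.
            -- An empty `v` is impossible because `g` lives on nonempty sets.
            right i x (v , m , h) = [ inhabited , (λ emp → ⊥-elim (proj₂ (−⁻ (proj₁ (maps-⊗ g⊆ m))) (empty≡∅ emp))) ]′ (nonempty? v)
              where
              inhabited : (∃[ z ] z ∈ v) → Maps t i x
              inhabited (z , z∈) =
                let w , w∈ , c = to (h z) z∈
                    x′ , v′ , _ , n , n′ , _ = y⁻ w∈ c
                    v≡v′ = ext {v} {v′} (λ z z∈ → from (decode-entry n n′ z) (to (h z) z∈))
                                        (λ z z∈ → from (h z) (to (decode-entry n n′ z) z∈))
                    x≡x′ = g-functional m (subst (λ v → Maps g v x′) (sym v≡v′) n′)
                in subst (Maps t i) (sym x≡x′) n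

          -- Outside the base all elements of the code precede `l`, so the code is an earlier index
          -- and `g` has a value there. In the base they only stay in the base, and `q` is used
          -- instead, being onto `fin B`.
          y-carried : (∀ v → v ∈ X → (∀ z → z ∈ v → Maps R z l) → ∃[ s ] Maps g v s) →
                      ∃[ s ] s ∈ S × Carries g l s (y t)
          y-carried g-total with l ∈? B
          ... | no l∉ = let s , m = g-total (y t) (−⁺ y∈fin y≢∅) below in s , proj₂ (maps-⊗ g⊆ m) , inj₁ (l∉ , m)
            where
            y≢∅ : ¬ y t ≡ ∅
            y≢∅ e = ∉∅ j (subst (j ∈_) e ⨾-new)
            below : ∀ z → z ∈ y t → Maps R z l
            below z z∈ = [ (λ p → C.range-below l∉ (proj₂ (proj₂ (y-old p))))
                         , (λ e → subst (λ z → Maps R z l) (sym e) (C.unused-below l∈ l∉)) ]′ (⨾⁻ z∈)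
          ... | yes l∈B = let s , m = q-onto (y t) (fin-mono y∈fin sub) in s , q-dom m , inj₂ (l∈B , m)
            where
            sub : y t ⊆ B
            sub z z∈ = [ (λ p → C.range-base l∈B (proj₂ (proj₂ (y-old p))))
                       , (λ e → subst (_∈ B) (sym e) C.unused-base) ]′ (⨾⁻ z∈)

        -- A sequence with all entries in the range of `g` is decoded from its own code, which some
        -- `s` carries, contrary to `not-decoded`. So a new entry exists, and `ω-least` finds the
        -- first.
        fresh-entry : (∀ v → v ∈ X → (∀ z → z ∈ v → Maps R z l) → ∃[ s ] Maps g v s) →
                      ∀ t → Maps f t (D g l) → ∃[ s ] s ∈ S × Fresh g (D g l) s
        fresh-entry g-total t ft =
          search (excluded-middle (∃̇ ∃̇ (maps v2 v1 v0 ∧̇ (∀̇ ¬̇ (maps v4 v0 v1)))) (t ∷ g ∷ []))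
          where
          t∈ : t ∈ seq S
          t∈ = f-dom ft
          old : ∀ {i x} → ¬ (∃[ x ] Maps t i x × (∀ w → ¬ Maps g w x)) → Maps t i x → ∃[ w ] Maps g w x
          old {i} {x} none m with excluded-middle (∃̇ maps v1 v0 v2) (g ∷ x ∷ [])
          ... | yes p = p
          ... | no ¬p = ⊥-elim (none (x , m , λ w m′ → ¬p (w , m′)))
          range : ¬ (∃[ i ] ∃[ x ] Maps t i x × (∀ w → ¬ Maps g w x)) → ∀ i x → Maps t i x → ∃[ w ] Maps g w x
          range none i x m = old (λ { (x , m , h) → none (i , x , m , h) }) m
          first : ∀ i → (∃[ x ] Maps t i x × (∀ w → ¬ Maps g w x)) →
                  (∀ k → k ∈ i → ¬ (∃[ x ] Maps t k x × (∀ w → ¬ Maps g w x))) → ∃[ s ] s ∈ S × Fresh g (D g l) s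
          first i (s , m , h) least = s , proj₂ (seq-index t∈ m) , t , ft , i , m , h , λ k k∈ x m′ → old (least k k∈) m′
          search : Dec (∃[ i ] ∃[ x ] Maps t i x × (∀ w → ¬ Maps g w x)) → ∃[ s ] s ∈ S × Fresh g (D g l) s
          search (yes (i₀ , x₀ , m₀ , h₀)) =
            let i , i∈ , new , least = ω-least (∃̇ (maps v2 v1 v0 ∧̇ (∀̇ ¬̇ (maps v4 v0 v1)))) (t ∷ g ∷ []) i₀
                                         (proj₁ (seq-index t∈ m₀)) (x₀ , m₀ , h₀)
            in first i new least
          search (no none) = let s , s∈ , c = y-carried t t∈ (range none) g-total in
            ⊥-elim (not-decoded ft s∈ c (y-decodes t t∈ (range none)))

        fresh-exists : (∀ v → v ∈ X → (∀ z → z ∈ v → Maps R z l) → ∃[ s ] Maps g v s) →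
                       ∃[ s ] s ∈ S × Fresh g (D g l) s
        fresh-exists g-total = let t , ft = f-onto (D g l) (λ s s∈ → proj₁ (D⁻ s∈)) in fresh-entry g-total t ft

      -- Injectivity of `f` fixes the sequence and being first fixes the position; this is what
      -- replaces choice.
      fresh-functional : ∀ {g D s s′} → Fresh g D s → Fresh g D s′ → s ≡ s′
      fresh-functional {s = s} {s′} (t , ft , i , m , h , l) (t′ , ft′ , i′ , m′ , h′ , l′) =
        compare (∈-trichotomy (nat-ordinal (proj₁ (seq-index (f-dom ft) m))) (nat-ordinal (proj₁ (seq-index (f-dom ft′) m′))))
        where
        t≡t′ : t ≡ t′
        t≡t′ = f-injective ft ft′
        compare : Comparable i i′ → s ≡ s′
        compare (inj₁ p) = let w , n = l′ i p s (subst (λ t → Maps t i s) t≡t′ m) in ⊥-elim (h w n)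
        compare (inj₂ (inj₂ p)) = let w , n = l i′ p s′ (subst (λ t → Maps t i′ s′) (sym t≡t′) m′) in ⊥-elim (h′ w n)
        compare (inj₂ (inj₁ e)) =
          let _ , _ , _ , _ , fun = seq⁻ (f-dom ft) in
          fun m (subst (λ t → Maps t i s′) (sym t≡t′) (subst (λ i → Maps t′ i s′) (sym e) m′))

      -- The index `u` enters only through its maximum `l`. The diagonal set is given by its
      -- elements, since formulas have no term for `D g l`.
      Value : V → V → V → Set ℓ
      Value g u s = ∃[ l ] ∃[ D′ ] IsMax wo l u × (∀ z → z ∈ D′ ⇔ (z ∈ S × Maps₂ Δ g l z)) × Fresh g D′ s

      isMax : Fin n → Fin n → Fin n → Formula n
      isMax R m u = m ∈̇ u ∧̇ (∀̇ (v0 ∈̇ ↑ u ⇒̇ ¬̇ (maps (↑ R) (↑ m) v0)))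

      fresh : Fin n → Fin n → Fin n → Fin n → Formula n
      fresh f g D s = ∃̇ (maps (↑ f) v0 (↑ D) ∧̇ (∃̇ (maps v1 v0 (↑ ↑ s) ∧̇ (∀̇ ¬̇ (maps (↑ ↑ ↑ g) v0 (↑ ↑ ↑ s))) ∧̇
                          (∀̇ (v0 ∈̇ v1 ⇒̇ (∀̇ (maps v3 v1 v0 ⇒̇ (∃̇ maps (↑ ↑ ↑ ↑ ↑ g) v0 v1))))))))

      γ : Formula 8
      γ = ∃̇ ∃̇ (isOrderedPair v3 v1 v0 ∧̇
            (∃̇ ∃̇ (isMax v9 v1 v2 ∧̇ (∀̇ (v0 ∈̇ v1 ⇔̇ (v0 ∈̇ v9 ∧̇ maps₂ v11 v4 v2 v0))) ∧̇ fresh v11 v3 v0 v4)))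

      abstract
        G : V
        G = rel γ (R ∷ Δ ∷ f ∷ []) (𝒫 (X ⊗ S) ⊗ X) S

        G⁺ : ∀ {g u s} → g ⊆ (X ⊗ S) → u ∈ X → s ∈ S → Value g u s → Maps₂ G g u s
        G⁺ {g} {u} g⊆ u∈ s∈ h =
          maps₂-⟨⟩ (rel-maps⁺ γ _ _ _ (⊗⁺ (𝒫⁺ g⊆) u∈) s∈ λ _ → g , u , isOrderedPair-⟨⟩ g u , h)

        G⁻ : ∀ {g u s} → Maps₂ G g u s → u ∈ X × Value g u s
        G⁻ m with rel-maps⁻ γ _ _ _ (maps₂⁻ m)
        ... | gu∈ , _ , _ , g , u , e , h with orderedPair-injective e (isOrderedPair-⟨⟩ _ _)
        ... | refl , refl = proj₂ (⊗⁻′ gu∈) , h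

      max-unique : ∀ {u l l′} → u ⊆ L → IsMax wo l u → IsMax wo l′ u → l ≡ l′
      max-unique u⊆ (l∈ , h) (l′∈ , h′) with tri (u⊆ _ l∈) (u⊆ _ l′∈)
      ... | inj₁ lt = ⊥-elim (h _ l′∈ lt)
      ... | inj₂ (inj₁ e) = e
      ... | inj₂ (inj₂ lt) = ⊥-elim (h′ _ l∈ lt)

      value-functional : ∀ {g u s s′} → u ⊆ L → Value g u s → Value g u s′ → s ≡ s′
      value-functional {g} {s′ = s′} u⊆ (l , D₁ , mx , h , fr) (l′ , D₂ , mx′ , h′ , fr′) =
        fresh-functional fr (subst (λ D → Fresh g D s′) (sym D₁≡D₂) fr′)
        where
        l≡l′ : l ≡ l′
        l≡l′ = max-unique u⊆ mx mx′
        D₁≡D₂ : D₁ ≡ D₂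
        D₁≡D₂ = ext
          (λ z z∈ → let a , b = to (h z) z∈ in from (h′ z) (a , subst (λ l → Maps₂ Δ g l z) l≡l′ b))
          (λ z z∈ → let a , b = to (h′ z) z∈ in from (h z) (a , subst (λ l → Maps₂ Δ g l z) (sym l≡l′) b))

      G-functional : ∀ {g u s s′} → Functional g → Maps₂ G g u s → Maps₂ G g u s′ → s ≡ s′
      G-functional _ m m′ = let u∈ , v = G⁻ m ; _ , v′ = G⁻ m′ in value-functional (fin-⊆ (proj₁ (−⁻ u∈))) v v′

      G-fresh : ∀ {g u s} → Maps₂ G g u s → ¬ (∃[ w ] Maps g w s)
      G-fresh m (w , q) = let _ , _ , _ , _ , _ , _ , _ , _ , _ , h , _ = G⁻ m in h w q

      O⁻ : ∀ {v u} → Maps O v u → v ∈ X × u ∈ X × _≺_ wo v u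
      O⁻ m = let v∈ , u∈ , lt = restrictOrder⁻ m ; _ , _ , p = finOrder⁻ wo lt in v∈ , u∈ , p

      step : ∀ u g → u ∈ X → g ⊆ (X ⊗ S) → IsApproximation X-wellOrder S G g → Functional g →
             (∀ {w r} → Maps g w r → Maps O w u) → (∀ w → Maps O w u → ∃[ r ] Maps g w r) →
             ∃[ s ] s ∈ S × Maps₂ G g u s
      step u g u∈ g⊆ ap fun dom tot =
        let u∈F , u≢∅ = −⁻ u∈
            l , mx = nonempty⇒max wo u∈F u≢∅
        in at-max l mx
        where
        u⊆ : u ⊆ L
        u⊆ = fin-⊆ (proj₁ (−⁻ u∈))
        at-max : ∀ l → IsMax wo l u → ∃[ s ] s ∈ S × Maps₂ G g u s
        at-max l mx =
          -- Injectivity of `g` comes from the freshness of its earlier values. By `≺-max` no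
          -- earlier index reaches beyond `l`, so the injections for `l` are defined on all its
          -- elements; by `below`, every index strictly below `l` already has a value.
          let s , s∈ , fr = fresh-exists g l g⊆ fun (approximation-injective X-wellOrder S G G-fresh g⊆ ap)
                              (u⊆ l (proj₁ mx)) (λ m → ≺-max wo u⊆ mx (proj₂ (proj₂ (O⁻ (dom m))))) below
          in s , s∈ , G⁺ g⊆ u∈ s∈ (l , D g l , mx , D-spec g l , fr)
          where
          below : ∀ v → v ∈ X → (∀ z → z ∈ v → Maps R z l) → ∃[ s ] Maps g v s
          below v v∈ v<l = tot v (restrictOrder⁺ v∈ u∈
            (finOrder⁺ wo (proj₁ (−⁻ v∈)) (proj₁ (−⁻ u∈)) (below-max wo mx v<l)))

    fin-injects : ∃[ h ] h ⊆ (X ⊗ S) × (∀ v → v ∈ X → ∃[ s ] Maps h v s) × Functional h ×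
                         (∀ {v w s} → Maps h v s → Maps h w s → v ≡ w)
    fin-injects =
      let h , h⊆ , ap , fun , tot = transfinite-recursion X-wellOrder S G G-functional step
      in h , h⊆ , tot , fun , approximation-injective X-wellOrder S G G-fresh h⊆ ap

-- The lexicographic order of `κ ⊗ ω` and its coding functions.

module Lexicographic {ℓ : Level} (M : ZFModel ℓ) where
  open ZFModel M
  open Basics M
  open Ordinals M
  open Recursion M
  open Diagonalisation M

  0∈ordinal : ∀ {α} → IsOrdinal α → ¬ α ≡ ∅ → ∅ ∈ α
  0∈ordinal {α} oα α≢∅ with ∈-trichotomy (nat-ordinal 0∈ω) oα
  ... | inj₁ p = p
  ... | inj₂ (inj₁ e) = ⊥-elim (α≢∅ (sym e))
  ... | inj₂ (inj₂ p) = ⊥-elim (∉∅ α p)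

  module _ (κ : V) (oκ : IsOrdinal κ) (0∈κ : ∅ ∈ κ) where

    private
      φ : Formula 5
      φ = ∃̇ ∃̇ ∃̇ ∃̇ (isOrderedPair v5 v3 v2 ∧̇ isOrderedPair v4 v1 v0 ∧̇ (v3 ∈̇ v1 ∨̇ (v3 ≐ v1 ∧̇ v2 ∈̇ v0)))

      L : V
      L = κ ⊗ ω

    Lex : V → V → V → V → Set ℓ
    Lex k n k′ n′ = k ∈ k′ ⊎ (k ≡ k′ × n ∈ n′)

    abstract
      lex : V
      lex = rel φ [] L L

      lex⁺ : ∀ {k n k′ n′} → k ∈ κ → n ∈ ω → k′ ∈ κ → n′ ∈ ω → Lex k n k′ n′ → Maps lex ⟨ k , n ⟩ ⟨ k′ , n′ ⟩
      lex⁺ k∈ n∈ k′∈ n′∈ h = rel-maps⁺ φ _ _ _ (⊗⁺ k∈ n∈) (⊗⁺ k′∈ n′∈)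
        λ _ → _ , _ , _ , _ , isOrderedPair-⟨⟩ _ _ , isOrderedPair-⟨⟩ _ _ , h

      lex-dom : ∀ {x y} → Maps lex x y → x ∈ L × y ∈ L
      lex-dom m = let a , b , _ = rel-maps⁻ φ _ _ _ m in a , b

      lex⁻ : ∀ {k n k′ n′} → Maps lex ⟨ k , n ⟩ ⟨ k′ , n′ ⟩ → Lex k n k′ n′
      lex⁻ m with rel-maps⁻ φ _ _ _ m
      ... | _ , _ , _ , _ , _ , _ , _ , e , e′ , h
        with orderedPair-injective e (isOrderedPair-⟨⟩ _ _) | orderedPair-injective e′ (isOrderedPair-⟨⟩ _ _)
      ... | refl , refl | refl , refl = h

    private
      lex-wf : ∀ U → U ⊆ L → (∃[ x ] x ∈ U) → ∃[ m ] m ∈ U × (∀ z → z ∈ U → ¬ Maps lex z m)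
      lex-wf U U⊆ (x , x∈) with ⊗⁻ (U⊆ x x∈)
      ... | k₀ , n₀ , refl , k₀∈ , n₀∈
        with ∈-minimal (sep (∃̇ maps v2 v1 v0) (U ∷ []) κ) (k₀ , sep⁺ (∃̇ maps v2 v1 v0) _ _ k₀∈ (n₀ , maps⁺ x∈))
      ... | k , k∈ , k-min with sep⁻ (∃̇ maps v2 v1 v0) _ _ k∈
      ... | k∈κ , n₁ , m₁
        with ∈-minimal (sep (maps v1 v2 v0) (U ∷ k ∷ []) ω)
               (n₁ , sep⁺ (maps v1 v2 v0) _ _ (proj₂ (⊗⁻′ (U⊆ _ (maps⁻ m₁)))) m₁)
      ... | n , n∈ , n-min with sep⁻ (maps v1 v2 v0) _ _ n∈
      ... | n∈ω , m = ⟨ k , n ⟩ , maps⁻ m , least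
        where
        least : ∀ z → z ∈ U → ¬ Maps lex z ⟨ k , n ⟩
        least z z∈ lt with ⊗⁻ (U⊆ z z∈)
        ... | k′ , n′ , refl , k′∈ , n′∈ with lex⁻ lt
        ... | inj₁ p = k-min k′ (sep⁺ (∃̇ maps v2 v1 v0) _ _ k′∈ (n′ , maps⁺ z∈)) p
        ... | inj₂ (refl , p) = n-min n′ (sep⁺ (maps v1 v2 v0) _ _ n′∈ (maps⁺ z∈)) p

      lex-tri : ∀ {x y} → x ∈ L → y ∈ L → Maps lex x y ⊎ x ≡ y ⊎ Maps lex y x
      lex-tri x∈ y∈ with ⊗⁻ x∈ | ⊗⁻ y∈
      ... | k , n , refl , k∈ , n∈ | k′ , n′ , refl , k′∈ , n′∈
        with ∈-trichotomy (ordinal-∈ oκ k∈) (ordinal-∈ oκ k′∈)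
      ... | inj₁ p = inj₁ (lex⁺ k∈ n∈ k′∈ n′∈ (inj₁ p))
      ... | inj₂ (inj₂ p) = inj₂ (inj₂ (lex⁺ k′∈ n′∈ k∈ n∈ (inj₁ p)))
      ... | inj₂ (inj₁ refl) with ∈-trichotomy (nat-ordinal n∈) (nat-ordinal n′∈)
      ... | inj₁ p = inj₁ (lex⁺ k∈ n∈ k′∈ n′∈ (inj₂ (refl , p)))
      ... | inj₂ (inj₁ refl) = inj₂ (inj₁ refl)
      ... | inj₂ (inj₂ p) = inj₂ (inj₂ (lex⁺ k′∈ n′∈ k∈ n∈ (inj₂ (refl , p))))

    abstract
      lex-wellOrder : WellOrder (κ ⊗ ω) lex
      lex-wellOrder = record { field⊆ = lex-dom ; wf = lex-wf ; tri = lex-tri }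

    module _ (P : V) (P⊆ : P ⊆ ((ω ⊗ ω) ⊗ ω)) (P-functional : Functional P)
             (P-injective : ∀ {p p′ k} → Maps P p k → Maps P p′ k → p ≡ p′) (P-nonzero : ∀ {p} → ¬ Maps P p ∅)
             (P-total : ∀ i j → i ∈ ω → j ∈ ω → ∃[ k ] Maps P ⟨ i , j ⟩ k) where

      private
        one : V
        one = ∅ ⨾ ∅

        -- The tag `τ` is `∅` for kept positions and `one` for moved ones. Block `∅` can receive
        -- both kinds, and the tag keeps them apart.
        Triple : V → V → V → V → Set ℓ
        Triple τ i n m = ∃[ e ] Maps₂ P i n e × Maps₂ P τ e m

        triple : Fin n → Fin n → Fin n → Fin n → Fin n → Formula n
        triple P τ i n m = ∃̇ (maps₂ (↑ P) (↑ i) (↑ n) v0 ∧̇ maps₂ (↑ P) (↑ τ) v0 (↑ m))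

        triple-injective : ∀ {τ τ′ i i′ n n′ m} → Triple τ i n m → Triple τ′ i′ n′ m → τ ≡ τ′ × i ≡ i′ × n ≡ n′
        triple-injective (e , p , q) (e′ , p′ , q′) with ⟨⟩-injective (P-injective (maps₂⁻ q) (maps₂⁻ q′))
        ... | refl , refl with ⟨⟩-injective (P-injective (maps₂⁻ p) (maps₂⁻ p′))
        ... | refl , refl = refl , refl , refl

        triple-functional : ∀ {τ i n m m′} → Triple τ i n m → Triple τ i n m′ → m ≡ m′
        triple-functional (e , p , q) (e′ , p′ , q′) with P-functional (maps₂⁻ p) (maps₂⁻ p′)
        ... | refl = P-functional (maps₂⁻ q) (maps₂⁻ q′)

        triple-total : ∀ {τ i n} → τ ∈ ω → i ∈ ω → n ∈ ω → ∃[ m ] m ∈ ω × Triple τ i n m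
        triple-total {τ} {i} {n} τ∈ i∈ n∈ =
          let e , p = P-total i n i∈ n∈
              m , q = P-total τ e τ∈ (proj₂ (maps-⊗ P⊆ p))
          in m , proj₂ (maps-⊗ P⊆ q) , e , maps₂-⟨⟩ p , maps₂-⟨⟩ q

        triple-nonzero : ∀ {τ i n} → ¬ Triple τ i n ∅
        triple-nonzero (_ , _ , q) = P-nonzero (maps₂⁻ q)

        -- k₁ < k is kept and the top block k₁ = k is moved to block ∅.
        Cell : V → V → V → V → V → V → Set ℓ
        Cell k i k₁ n k₂ m = (k₁ ∈ k × Triple ∅ i n m × k₂ ≡ k₁) ⊎ (k₁ ≡ k × Triple one i n m × k₂ ≡ ∅)

        coded : Fin n → Fin n → Fin n → Fin n → Fin n → Fin n → Fin n → Formula n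
        coded P o e l i x y = ∃̇ ∃̇ ∃̇ ∃̇ ∃̇ ∃̇ (
          isOrderedPair (s l) v5 v4 ∧̇ isOrderedPair (s x) v3 v2 ∧̇ isOrderedPair (s y) v1 v0 ∧̇
          ((v3 ∈̇ v5 ∧̇ triple (s P) (s o) (s i) v2 v0 ∧̇ v1 ≐ v3) ∨̇
           (v3 ≐ v5 ∧̇ triple (s P) (s e) (s i) v2 v0 ∧̇ v1 ≐ s o)))
          where
          s : Fin n → Fin (1+ 1+ 1+ 1+ 1+ 1+ n)
          s i = ↑ ↑ ↑ ↑ ↑ ↑ i

        χ : Formula 8
        χ = ∃̇ ∃̇ ∃̇ ∃̇ (isOrderedPair v5 v3 v2 ∧̇ isOrderedPair v4 v1 v0 ∧̇ coded v9 v10 v11 v3 v2 v1 v0)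

        cell-injective : ∀ {k i i′ k₁ k₁′ n n′ k₂ m} → Cell k i k₁ n k₂ m → Cell k i′ k₁′ n′ k₂ m →
                         i ≡ i′ × k₁ ≡ k₁′ × n ≡ n′
        cell-injective (inj₁ (_ , t , refl)) (inj₁ (_ , t′ , e)) = let _ , a , b = triple-injective t t′ in a , e , b
        cell-injective (inj₂ (e , t , _)) (inj₂ (e′ , t′ , _)) =
          let _ , a , b = triple-injective t t′ in a , trans e (sym e′) , b
        cell-injective (inj₁ (_ , t , _)) (inj₂ (_ , t′ , _)) = ⊥-elim (suc≢∅ (sym (proj₁ (triple-injective t t′))))
        cell-injective (inj₂ (_ , t , _)) (inj₁ (_ , t′ , _)) = ⊥-elim (suc≢∅ (proj₁ (triple-injective t t′)))

        cell-functional : ∀ {k i k₁ n k₂ k₂′ m m′} → Cell k i k₁ n k₂ m → Cell k i k₁ n k₂′ m′ → k₂ ≡ k₂′ × m ≡ m′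
        cell-functional (inj₁ (_ , t , e)) (inj₁ (_ , t′ , e′)) = trans e (sym e′) , triple-functional t t′
        cell-functional (inj₂ (_ , t , e)) (inj₂ (_ , t′ , e′)) = trans e (sym e′) , triple-functional t t′
        cell-functional (inj₁ (p , _)) (inj₂ (refl , _)) = ⊥-elim (∈-irrefl p)
        cell-functional (inj₂ (refl , _)) (inj₁ (p , _)) = ⊥-elim (∈-irrefl p)

      abstract
        C : V
        C = rel χ (P ∷ ∅ ∷ one ∷ []) (L ⊗ ω) (L ⊗ L)

      private abstract
        C⁺ : ∀ {k a i k₁ n k₂ m} → k ∈ κ → a ∈ ω → i ∈ ω → k₁ ∈ κ → n ∈ ω → k₂ ∈ κ → m ∈ ω → Cell k i k₁ n k₂ m →
             Code C ⟨ k , a ⟩ i ⟨ k₁ , n ⟩ ⟨ k₂ , m ⟩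
        C⁺ k∈ a∈ i∈ k₁∈ n∈ k₂∈ m∈ h = _ , _ , isOrderedPair-⟨⟩ _ _ , isOrderedPair-⟨⟩ _ _ ,
          rel-maps⁺ χ _ _ _ (⊗⁺ (⊗⁺ k∈ a∈) i∈) (⊗⁺ (⊗⁺ k₁∈ n∈) (⊗⁺ k₂∈ m∈)) λ _ →
            _ , _ , _ , _ , isOrderedPair-⟨⟩ _ _ , isOrderedPair-⟨⟩ _ _ ,
            _ , _ , _ , _ , _ , _ , isOrderedPair-⟨⟩ _ _ , isOrderedPair-⟨⟩ _ _ , isOrderedPair-⟨⟩ _ _ , h

        C⁻ : ∀ {l i x y} → Code C l i x y → ∃[ k ] ∃[ a ] ∃[ k₁ ] ∃[ n ] ∃[ k₂ ] ∃[ m ]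
             l ≡ ⟨ k , a ⟩ × x ≡ ⟨ k₁ , n ⟩ × y ≡ ⟨ k₂ , m ⟩ × l ∈ L × x ∈ L × y ∈ L × Cell k i k₁ n k₂ m
        C⁻ (p , q , e , e′ , h) with rel-maps⁻ χ _ _ _ h
        ... | p∈ , q∈ , _ , _ , _ , _ , _ , d , d′ , k , a , k₁ , n , k₂ , m , pl , px , py , c
          with orderedPair-injective e d | orderedPair-injective e′ d′ | orderedPair≡ e | orderedPair≡ e′
        ... | refl , refl | refl , refl | refl | refl =
          k , a , k₁ , n , k₂ , m , orderedPair≡ pl , orderedPair≡ px , orderedPair≡ py ,
          proj₁ (⊗⁻′ p∈) , proj₁ (⊗⁻′ q∈) , proj₂ (⊗⁻′ q∈) , c

      B : V
      B = ⁅ ∅ ⁆ ⊗ ω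

      private
        base : ∀ {n} → n ∈ ω → ⟨ ∅ , n ⟩ ∈ B
        base n∈ = ⊗⁺ (∈⁅⁆ ∅) n∈

        not-base : ∀ {k a} → ⟨ k , a ⟩ ∈ L → ¬ ⟨ k , a ⟩ ∈ B → ∅ ∈ k
        not-base l∈ l∉ = let k∈ , a∈ = ⊗⁻′ l∈ in 0∈ordinal (ordinal-∈ oκ k∈) λ { refl → l∉ (base a∈) }

        -- If `x` is not beyond `l`, its block is at most `k`, and the coding covers block `k`
        -- entirely, regardless of the position of `l` in it.
        total : ∀ {l i x} → l ∈ L → i ∈ ω → x ∈ L → ¬ Maps lex l x → ∃[ y ] Code C l i x y
        total l∈ i∈ x∈ l≮x with ⊗⁻ l∈ | ⊗⁻ x∈
        ... | k , a , refl , k∈ , a∈ | k₁ , n , refl , k₁∈ , n∈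
          with ∈-trichotomy (ordinal-∈ oκ k₁∈) (ordinal-∈ oκ k∈)
        ... | inj₁ p = let m , m∈ , t = triple-total 0∈ω i∈ n∈ in
          _ , C⁺ k∈ a∈ i∈ k₁∈ n∈ k₁∈ m∈ (inj₁ (p , t , refl))
        ... | inj₂ (inj₁ e) = let m , m∈ , t = triple-total (suc∈ω 0∈ω) i∈ n∈ in
          _ , C⁺ k∈ a∈ i∈ k₁∈ n∈ 0∈κ m∈ (inj₂ (e , t , refl))
        ... | inj₂ (inj₂ p) = ⊥-elim (l≮x (lex⁺ k∈ a∈ k₁∈ n∈ (inj₁ p)))

        injective : ∀ {l i i′ x x′ y} → Code C l i x y → Code C l i′ x′ y → i ≡ i′ × x ≡ x′
        injective c c′ with C⁻ c | C⁻ c′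
        ... | _ , _ , _ , _ , _ , _ , refl , refl , refl , _ , _ , _ , h
            | _ , _ , _ , _ , _ , _ , e , refl , e′ , _ , _ , _ , h′ with ⟨⟩-injective e | ⟨⟩-injective e′
        ... | refl , refl | refl , refl with cell-injective h h′
        ... | refl , refl , refl = refl , refl

        functional : ∀ {l i x y y′} → Code C l i x y → Code C l i x y′ → y ≡ y′
        functional c c′ with C⁻ c | C⁻ c′
        ... | _ , _ , _ , _ , _ , _ , refl , refl , refl , _ , _ , _ , h
            | _ , _ , _ , _ , _ , _ , e , e′ , refl , _ , _ , _ , h′ with ⟨⟩-injective e | ⟨⟩-injective e′
        ... | refl , refl | refl , refl with cell-functional h h′
        ... | refl , refl = refl

        -- There is no block below `∅`, so only the clause for moved positions applies, and it lands
        -- in block `∅` again.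
        range-base : ∀ {l i x y} → l ∈ B → Code C l i x y → y ∈ B
        range-base l∈ c with C⁻ c
        ... | k , a , k₁ , n , k₂ , m , refl , refl , refl , _ , _ , y∈ , inj₁ (p , _) =
          ⊥-elim (∉∅ k₁ (subst (k₁ ∈_) (∈⁅⁆⁻ (proj₁ (⊗⁻′ l∈))) p))
        ... | k , a , k₁ , n , k₂ , m , refl , refl , refl , _ , _ , y∈ , inj₂ (_ , _ , refl) = base (proj₂ (⊗⁻′ y∈))

        -- Kept positions already lie in lower blocks, and moved ones land in block `∅`, which is
        -- lower than `k` outside the base.
        range-below : ∀ {l i x y} → ¬ l ∈ B → Code C l i x y → Maps lex y l
        range-below l∉ c with C⁻ c
        ... | k , a , k₁ , n , k₂ , m , refl , refl , refl , l∈ , _ , y∈ , h =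
          let k∈ , a∈ = ⊗⁻′ l∈ ; k₂∈ , m∈ = ⊗⁻′ y∈ in lex⁺ k₂∈ m∈ k∈ a∈ (inj₁ (below h))
          where
          below : Cell k _ k₁ n k₂ m → k₂ ∈ k
          below (inj₁ (p , _ , refl)) = p
          below (inj₂ (_ , _ , refl)) = not-base l∈ l∉

        unused : ∀ {l i x} → ¬ Code C l i x ⟨ ∅ , ∅ ⟩
        unused c with C⁻ c
        ... | k , a , k₁ , n , k₂ , m , refl , refl , e , _ , _ , _ , h with ⟨⟩-injective e
        ... | refl , refl with h
        ... | inj₁ (_ , t , _) = triple-nonzero t
        ... | inj₂ (_ , t , _) = triple-nonzero t

        unused-below : ∀ {l} → l ∈ L → ¬ l ∈ B → Maps lex ⟨ ∅ , ∅ ⟩ l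
        unused-below l∈ l∉ with ⊗⁻ l∈
        ... | k , a , refl , k∈ , a∈ = lex⁺ 0∈κ 0∈ω k∈ a∈ (inj₁ (not-base l∈ l∉))

        base⊆ : B ⊆ L
        base⊆ p p∈ with ⊗⁻ p∈
        ... | k , a , refl , k∈ , a∈ with ∈⁅⁆⁻ k∈
        ... | refl = ⊗⁺ 0∈κ a∈

        range : ∀ {l i x y} → Code C l i x y → x ∈ L × y ∈ L
        range c = let _ , _ , _ , _ , _ , _ , _ , _ , _ , _ , x∈ , y∈ , _ = C⁻ c in x∈ , y∈

      abstract
        lex-coding : IsCoding (κ ⊗ ω) lex B C ⟨ ∅ , ∅ ⟩
        lex-coding = record
          { base⊆ = base⊆ ; injective = injective ; functional = functional ; total = total
          ; range = range ; range-base = range-base ; range-below = range-below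
          ; unused = unused ; unused-base = base 0∈ω ; unused-below = unused-below }

-- Hartogs' theorem: not every ordinal injects into `S`.

module Hartogs {ℓ : Level} (M : ZFModel ℓ) (S : ZFModel.V M) where
  open ZFModel M
  open Basics M
  open Ordinals M
  open Recursion M
  open FiniteSets M

  Injects : V → V → Set ℓ
  Injects j α = (∀ β → β ∈ α → ∃[ s ] s ∈ S × Maps j β s)
              × (∀ β s s′ → Maps j β s → Maps j β s′ → s ≡ s′)
              × (∀ β β′ s → Maps j β s → Maps j β′ s → β ≡ β′)

  IsImage : V → V → V → Set ℓ
  IsImage A j β = ∀ s → s ∈ A ⇔ (∃[ γ ] γ ∈ β × Maps j γ s)

  -- r is the chain of the sets j[β], β ∈ α, from which α can be recovered.
  Represents : V → V → Set ℓ
  Represents r α = IsOrdinal α × (∃[ j ] Injects j α × (∀ A → A ∈ r ⇔ (∃[ β ] β ∈ α × IsImage A j β)))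

  private
    isImage : Fin n → Fin n → Fin n → Formula n
    isImage A j β = ∀̇ (v0 ∈̇ ↑ A ⇔̇ (∃̇ (v0 ∈̇ ↑ ↑ β ∧̇ maps (↑ ↑ j) v0 v1)))

    injects : Fin n → Fin n → Fin n → Formula n
    injects S j α = (∀̇ (v0 ∈̇ ↑ α ⇒̇ (∃̇ (v0 ∈̇ ↑ ↑ S ∧̇ maps (↑ ↑ j) v1 v0))))
                 ∧̇ (∀̇ ∀̇ ∀̇ (maps (↑ ↑ ↑ j) v2 v1 ⇒̇ maps (↑ ↑ ↑ j) v2 v0 ⇒̇ v1 ≐ v0))
                 ∧̇ (∀̇ ∀̇ ∀̇ (maps (↑ ↑ ↑ j) v2 v0 ⇒̇ maps (↑ ↑ ↑ j) v1 v0 ⇒̇ v2 ≐ v1))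

    represents : Fin n → Fin n → Fin n → Formula n
    represents S r α = isOrdinal α ∧̇ (∃̇ (injects (↑ S) v0 (↑ α) ∧̇
      (∀̇ (v0 ∈̇ ↑ ↑ r ⇔̇ (∃̇ (v0 ∈̇ ↑ ↑ ↑ α ∧̇ isImage v1 v2 v0))))))

  isImage-image : ∀ {α j} → IsOrdinal α → Injects j α → ∀ β → β ∈ α → IsImage (image j β S) j β
  isImage-image {α} {j} oα (tot , fun , _) β β∈ s = mk⇔ (λ s∈ → proj₂ (image⁻ s∈)) right
    where
    right : (∃[ γ ] γ ∈ β × Maps j γ s) → s ∈ image j β S
    right (γ , γ∈ , m) = let s′ , s′∈ , m′ = tot γ (proj₁ oα β β∈ γ γ∈) in
      image⁺ γ∈ (subst (_∈ S) (fun γ s′ s m′ m) s′∈) m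

  module _ (α α′ j j′ r : V) (oα : IsOrdinal α) (oα′ : IsOrdinal α′) (ij : Injects j α) (ij′ : Injects j′ α′)
           (rj : ∀ A → A ∈ r ⇔ (∃[ β ] β ∈ α × IsImage A j β))
           (rj′ : ∀ A → A ∈ r ⇔ (∃[ β ] β ∈ α′ × IsImage A j′ β)) where

    private
      Image⊆ : V → V → V → V → Set ℓ
      Image⊆ j β j′ β′ = ∀ s → (∃[ γ ] γ ∈ β × Maps j γ s) → ∃[ γ ] γ ∈ β′ × Maps j′ γ s

      Agree : V → Set ℓ
      Agree β = β ∈ α′ × (Image⊆ j β j′ β × Image⊆ j′ β j β)

      image⊆ : Fin n → Fin n → Fin n → Fin n → Formula n
      image⊆ j β j′ β′ = ∀̇ ((∃̇ (v0 ∈̇ ↑ ↑ β ∧̇ maps (↑ ↑ j) v0 v1)) ⇒̇ (∃̇ (v0 ∈̇ ↑ ↑ β′ ∧̇ maps (↑ ↑ j′) v0 v1)))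

      image-mono : ∀ {j β γ} → (∀ δ → δ ∈ β → δ ∈ γ) → Image⊆ j β j γ
      image-mono sub s (δ , δ∈ , m) = δ , sub δ δ∈ , m

      image-trans : ∀ {j β j′ β′ j″ β″} → Image⊆ j β j′ β′ → Image⊆ j′ β′ j″ β″ → Image⊆ j β j″ β″
      image-trans h h′ s p = h′ s (h s p)

      -- The value of `j` at `γ` is in the image of `β`, but by injectivity not in that of `γ`.
      strict : ∀ {j α} → Injects j α → ∀ {β γ} → γ ∈ α → γ ∈ β → ¬ Image⊆ j β j γ
      strict (tot , _ , inj) {β} {γ} γ∈α γ∈β h with tot γ γ∈α
      ... | s , _ , m with h s (γ , γ∈β , m)
      ... | δ , δ∈ , m′ with inj _ _ _ m′ m
      ... | refl = ∈-irrefl δ∈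

      matching : ∀ {α j α′ j′} → IsOrdinal α → Injects j α → (∀ A → A ∈ r ⇔ (∃[ β ] β ∈ α × IsImage A j β)) →
                 (∀ A → A ∈ r ⇔ (∃[ β ] β ∈ α′ × IsImage A j′ β)) →
                 ∀ β → β ∈ α → ∃[ β′ ] β′ ∈ α′ × Image⊆ j β j′ β′ × Image⊆ j′ β′ j β
      matching {j = j} oα ij rj rj′ β β∈ =
        let A = image j β S
            im = isImage-image oα ij β β∈
            β′ , β′∈ , im′ = to (rj′ A) (from (rj A) (β , β∈ , im))
        in β′ , β′∈ , (λ s p → to (im′ s) (from (im s) p)) , λ s p → to (im s) (from (im′ s) p)

      -- The image of `β` under `j` is a member of the chain, hence the image under `j′` of some
      -- `β′`. Were `β` and `β′` different, trichotomy and the induction hypothesis would fit the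
      -- image of an ordinal into that of one of its elements, against `strict`.
      step : ∀ β → β ∈ α → (∀ γ → γ ∈ β → Agree γ) → Agree β
      step β β∈ ih with matching oα ij rj rj′ β β∈
      ... | β′ , β′∈ , h , h′ = subst (_∈ α′) (sym β≡β′) β′∈ ,
              subst (λ β′ → Image⊆ j β j′ β′ × Image⊆ j′ β′ j β) (sym β≡β′) (h , h′)
        where
        oβ : IsOrdinal β
        oβ = ordinal-∈ oα β∈
        oβ′ : IsOrdinal β′
        oβ′ = ordinal-∈ oα′ β′∈
        below : ∀ γ → γ ∈ β → γ ∈ β′
        below γ γ∈ with ih γ γ∈ | ∈-trichotomy (ordinal-∈ oβ γ∈) oβ′
        ... | _ | inj₁ p = p
        ... | _ , _ , k | inj₂ (inj₁ refl) = ⊥-elim (strict ij (proj₁ oα β β∈ γ γ∈) γ∈ (image-trans h k))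
        ... | γ∈α′ , _ , k | inj₂ (inj₂ p) = ⊥-elim (strict ij (proj₁ oα β β∈ γ γ∈) γ∈
                (image-trans h (image-trans (image-mono (proj₁ (ordinal-∈ oβ γ∈) β′ p)) k)))
        -- Otherwise the image of `β` under `j′` is that of some `δ` under `j`. If `δ ∈ β`, the
        -- induction hypothesis makes it the image of `δ` under `j′` too. If not, `β` is included in
        -- `δ`, and the image of `β′` under `j′` fits into that of `β`.
        β∉β′ : ¬ β ∈ β′
        β∉β′ p with proj₁ oα′ β′ β′∈ β p
        ... | β∈α′ with matching oα′ ij′ rj′ rj β β∈α′
        ... | δ , δ∈ , k , k′ with ∈-trichotomy (ordinal-∈ oα δ∈) oβ
        ... | inj₁ q = let δ∈α′ , l , _ = ih δ q in strict ij′ δ∈α′ q (image-trans k l)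
        ... | inj₂ (inj₁ refl) = strict ij′ β∈α′ p (image-trans h′ k′)
        ... | inj₂ (inj₂ q) = strict ij′ β∈α′ p
                (image-trans h′ (image-trans (image-mono (proj₁ (ordinal-∈ oα δ∈) β q)) k′))
        above : ∀ γ → γ ∈ β′ → γ ∈ β
        above γ γ∈ with ∈-trichotomy (ordinal-∈ oβ′ γ∈) oβ
        ... | inj₁ p = p
        ... | inj₂ (inj₁ refl) = ⊥-elim (β∉β′ γ∈)
        ... | inj₂ (inj₂ p) = ⊥-elim (β∉β′ (proj₁ oβ′ γ γ∈ β p))
        β≡β′ : β ≡ β′
        β≡β′ = ext below above

    represented-⊆ : ∀ β → β ∈ α → β ∈ α′
    represented-⊆ β β∈ = proj₁ (WellOrder.wf-ind (ordinal-wellOrder oα)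
      (v0 ∈̇ v1 ∧̇ (image⊆ v2 v0 v3 v0 ∧̇ image⊆ v3 v0 v2 v0)) (α′ ∷ j ∷ j′ ∷ [])
      (λ β β∈ ih → step β β∈ λ γ γ∈ → ih γ (∈-on⁺ (proj₁ oα β β∈ γ γ∈) β∈ γ∈)) β β∈)

  represents-functional : ∀ {r α α′} → Represents r α → Represents r α′ → α ≡ α′
  represents-functional (oα , j , ij , rj) (oα′ , j′ , ij′ , rj′) =
    ext (represented-⊆ _ _ j j′ _ oα oα′ ij ij′ rj rj′) (represented-⊆ _ _ j′ j _ oα′ oα ij′ ij rj′ rj)

  private
    abstract
      -- Representing chains are elements of `𝒫 (𝒫 S)` and determine their ordinals, so replacement
      -- gathers all ordinals that inject into `S` in one set.
      bounded : ∃[ b ] ∀ α → α ∈ b ⇔ (∃[ r ] r ∈ 𝒫 (𝒫 S) × Represents r α)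
      bounded = replacement (represents v2 v0 v1) (S ∷ []) (𝒫 (𝒫 S)) λ _ _ _ _ → represents-functional

  represented : ∀ {α} → IsOrdinal α → (∃[ j ] Injects j α) → ∃[ r ] r ∈ 𝒫 (𝒫 S) × Represents r α
  represented {α} oα (j , ij) = r , 𝒫⁺ (λ A A∈ → proj₁ (sep⁻ φ ρ _ A∈)) , oα , j , ij , λ A → mk⇔ (left A) (right A)
    where
    φ : Formula 3
    φ = ∃̇ (v0 ∈̇ v2 ∧̇ isImage v1 v3 v0)
    ρ : Vec V 2
    ρ = α ∷ j ∷ []
    r : V
    r = sep φ ρ (𝒫 S)
    left : ∀ A → A ∈ r → ∃[ β ] β ∈ α × IsImage A j β
    left A A∈ = proj₂ (sep⁻ φ ρ _ A∈)
    right : ∀ A → (∃[ β ] β ∈ α × IsImage A j β) → A ∈ r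
    right A (β , β∈ , im) = sep⁺ φ ρ _ (𝒫⁺ A⊆) (β , β∈ , im)
      where
      A⊆ : A ⊆ S
      A⊆ s s∈ = let γ , γ∈ , m = to (im s) s∈ ; s′ , s′∈ , m′ = proj₁ ij γ (proj₁ oα β β∈ γ γ∈) in
        subst (_∈ S) (proj₁ (proj₂ ij) γ s′ s m′ m) s′∈

  -- The Burali-Forti paradox: the set of all ordinals would be an ordinal and hence an element of
  -- itself.
  hartogs : ¬ (∀ α → IsOrdinal α → ∃[ j ] Injects j α)
  hartogs all = ∈-irrefl (Ω⁺ Ω-ordinal)
    where
    b : V
    b = proj₁ bounded
    Ω : V
    Ω = sep (isOrdinal v0) [] b
    Ω⁺ : ∀ {α} → IsOrdinal α → α ∈ Ω
    Ω⁺ {α} oα = sep⁺ (isOrdinal v0) [] b (from (proj₂ bounded α) (represented oα (all α oα))) oα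
    Ω⁻ : ∀ {α} → α ∈ Ω → IsOrdinal α
    Ω⁻ α∈ = proj₂ (sep⁻ (isOrdinal v0) [] b α∈)
    Ω-ordinal : IsOrdinal Ω
    Ω-ordinal = (λ α α∈ β β∈ → Ω⁺ (ordinal-∈ (Ω⁻ α∈) β∈)) , λ α α∈ → proj₁ (Ω⁻ α∈)

-- Every ordinal injects into `S` if `f` is a bijection.

module Contradiction {ℓ : Level} (M : ZFModel ℓ) where
  open ZFModel M
  open Basics M
  open Ordinals M
  open Recursion M
  open FiniteSets M
  open Countability M
  open Kuratowski M
  open Diagonalisation M
  open Lexicographic M

  module _ (S f : V) (f-maps : ∀ {t z} → Maps f t z → t ∈ seq S × z ∈ 𝒫 S) (f-functional : Functional f)
           (f-total : ∀ t → t ∈ seq S → ∃[ z ] Maps f t z)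
           (f-injective : ∀ {t t′ z} → Maps f t z → Maps f t′ z → t ≡ t′)
           (f-onto : ∀ z → z ⊆ S → ∃[ t ] Maps f t z) (x₀ : V) (x₀∈ : x₀ ∈ S) where

    private
      IsConstant : V → V → Set ℓ
      IsConstant t n = ∀ p → p ∈ t ⇔ (∃[ i ] i ∈ n × IsOrderedPair p i x₀)

      φ : Formula 7
      φ = ∃̇ ((∀̇ (v0 ∈̇ v1 ⇔̇ (∃̇ (v0 ∈̇ v4 ∧̇ isOrderedPair v1 v0 v8)))) ∧̇ maps v7 v0 v1)

      abstract
        -- Nonemptiness of `S` enters here through `x₀`: constant sequences of distinct lengths are
        -- distinct, and `f` turns them into distinct subsets.
        F : V
        F = rel φ (x₀ ∷ f ∷ []) ω (𝒫 S)

        F⁺ : ∀ {n t Y} → n ∈ ω → Y ∈ 𝒫 S → IsConstant t n → Maps f t Y → Maps F n Y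
        F⁺ n∈ Y∈ h m = rel-maps⁺ φ _ _ _ n∈ Y∈ λ _ → _ , h , m

        F⁻ : ∀ {n Y} → Maps F n Y → ∃[ t ] IsConstant t n × Maps f t Y
        F⁻ m = let _ , _ , _ , h = rel-maps⁻ φ _ _ _ m in h

        F⊆ : F ⊆ (ω ⊗ 𝒫 S)
        F⊆ = rel-⊆ φ _ _ _

      constant : V → V
      constant n = n ⊗ ⁅ x₀ ⁆

      constant⁻ : ∀ {n i x} → Maps (constant n) i x → i ∈ n × x ≡ x₀
      constant⁻ m = let i∈ , x∈ = ⊗⁻′ (maps⁻ m) in i∈ , ∈⁅⁆⁻ x∈

      constant⁺ : ∀ {n i} → i ∈ n → Maps (constant n) i x₀
      constant⁺ i∈ = maps⁺ (⊗⁺ i∈ (∈⁅⁆ x₀))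

      isConstant-constant : ∀ n → IsConstant (constant n) n
      isConstant-constant n p = mk⇔ left right
        where
        left : p ∈ constant n → ∃[ i ] i ∈ n × IsOrderedPair p i x₀
        left p∈ with ⊗⁻ p∈
        ... | i , x , refl , i∈ , x∈ with ∈⁅⁆⁻ x∈
        ... | refl = i , i∈ , isOrderedPair-⟨⟩ i x₀
        right : (∃[ i ] i ∈ n × IsOrderedPair p i x₀) → p ∈ constant n
        right (i , i∈ , h) = subst (_∈ constant n) (sym (orderedPair≡ h)) (⊗⁺ i∈ (∈⁅⁆ x₀))

      constant≡ : ∀ {t n} → IsConstant t n → t ≡ constant n
      constant≡ {n = n} h = ext (λ p p∈ → from (isConstant-constant n p) (to (h p) p∈))
                                (λ p p∈ → from (h p) (to (isConstant-constant n p) p∈))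

      constant-seq : ∀ {n} → n ∈ ω → constant n ∈ seq S
      constant-seq {n} n∈ = from (∈-seq S _) (n , to (∈-ω n) n∈ , pairs , (λ i i∈ → x₀ , constant⁺ i∈) ,
          λ i y y′ m m′ → trans (proj₂ (constant⁻ m)) (sym (proj₂ (constant⁻ m′))))
        where
        pairs : ∀ p → p ∈ constant n → ∃[ x ] ∃[ y ] x ∈ n × y ∈ S × IsOrderedPair p x y
        pairs p p∈ = let i , i∈ , h = to (isConstant-constant n p) p∈ in i , x₀ , i∈ , x₀∈ , h

      F-functional : Functional F
      F-functional m m′ =
        let t , h , q = F⁻ m ; t′ , h′ , q′ = F⁻ m′ in
        f-functional q (subst (λ t → Maps f t _) (trans (constant≡ h′) (sym (constant≡ h))) q′)

      F-total : ∀ n → n ∈ ω → ∃[ Y ] Maps F n Y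
      F-total n n∈ = let Y , m = f-total _ (constant-seq n∈) in
        Y , F⁺ n∈ (proj₂ (f-maps m)) (isConstant-constant n) m

      constant-injective : ∀ {m n} → constant m ≡ constant n → m ≡ n
      constant-injective e = ext (λ i i∈ → proj₁ (constant⁻ (subst (λ t → Maps t i x₀) e (constant⁺ i∈))))
                                 (λ i i∈ → proj₁ (constant⁻ (subst (λ t → Maps t i x₀) (sym e) (constant⁺ i∈))))

      F-injective : ∀ {m n Y} → Maps F m Y → Maps F n Y → m ≡ n
      F-injective m m′ =
        let t , h , q = F⁻ m ; t′ , h′ , q′ = F⁻ m′ in
        constant-injective (trans (sym (constant≡ h)) (trans (f-injective q q′) (constant≡ h′)))

    S-onto-ω : ∃[ q ] q ⊆ (S ⊗ ω) × Functional q × (∀ n → n ∈ ω → ∃[ x ] Maps q x n)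
    S-onto-ω = maps-onto-ω S F F⊆ F-functional F-total F-injective

    module _ (q₀ : V) (q₀⊆ : q₀ ⊆ (S ⊗ ω)) (q₀-functional : Functional q₀) (q₀-onto : ∀ n → n ∈ ω → ∃[ x ] Maps q₀ x n)
             (E : V) (E⊆ : E ⊆ (ω ⊗ fin ω)) (E-functional : Functional E)
             (E-onto : ∀ u → u ∈ fin ω → ∃[ m ] Maps E m u) where

      private
        base : V
        base = ⁅ ∅ ⁆ ⊗ ω

        -- Kuratowski's map `q₀` sends `s` to a number, `E` turns it into a finite set of numbers,
        -- and this set is copied into the lowest block.
        Labels : V → V → Set ℓ
        Labels s y = ∃[ m ] ∃[ w ] Maps q₀ s m × Maps E m w ×
                     (∀ z → z ∈ y ⇔ (∃[ i ] i ∈ w × IsOrderedPair z ∅ i))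

        ψ : Formula 8
        ψ = ∃̇ ∃̇ (maps v7 v3 v1 ∧̇ maps v8 v1 v0 ∧̇
              (∀̇ (v0 ∈̇ v3 ⇔̇ (∃̇ (v0 ∈̇ v2 ∧̇ isOrderedPair v1 v11 v0)))))

        abstract
          q : V
          q = rel ψ (q₀ ∷ E ∷ ∅ ∷ []) S (fin base)

          q⁺ : ∀ {s y} → s ∈ S → y ∈ fin base → Labels s y → Maps q s y
          q⁺ s∈ y∈ h = rel-maps⁺ ψ _ _ _ s∈ y∈ λ _ → h

          q⁻ : ∀ {s y} → Maps q s y → s ∈ S × Labels s y
          q⁻ m = let s∈ , _ , _ , h = rel-maps⁻ ψ _ _ _ m in s∈ , h

          second : V
          second = rel (isOrderedPair v1 v5 v0) (∅ ∷ []) base ω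

          second⁺ : ∀ {i} → i ∈ ω → Maps second ⟨ ∅ , i ⟩ i
          second⁺ i∈ = rel-maps⁺ (isOrderedPair v1 v5 v0) _ _ _ (⊗⁺ (∈⁅⁆ ∅) i∈) i∈ λ _ → isOrderedPair-⟨⟩ _ _

          second⁻ : ∀ {z i} → Maps second z i → i ∈ ω × IsOrderedPair z ∅ i
          second⁻ m = let _ , i∈ , _ , h = rel-maps⁻ (isOrderedPair v1 v5 v0) _ _ _ m in i∈ , h

        q-functional : Functional q
        q-functional {y = y} {y′} m m′ =
          let _ , k , w , a , b , h = q⁻ m
              _ , k′ , w′ , a′ , b′ , h′ = q⁻ m′
              w≡w′ = E-functional b (subst (λ k → Maps E k w′) (q₀-functional a′ a) b′)
          in ext (λ z z∈ → let i , i∈ , p = to (h z) z∈ in from (h′ z) (i , subst (i ∈_) w≡w′ i∈ , p))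
                 (λ z z∈ → let i , i∈ , p = to (h′ z) z∈ in from (h z) (i , subst (i ∈_) (sym w≡w′) i∈ , p))

        q-onto : ∀ y → y ∈ fin base → ∃[ s ] Maps q s y
        q-onto y y∈ =
          let k , e = E-onto w (fin-image second y second-functional (λ m → proj₁ (second⁻ m)) y∈)
              s , a = q₀-onto k (proj₁ (maps-⊗ E⊆ e))
          in s , q⁺ (proj₁ (maps-⊗ q₀⊆ a)) y∈ (k , w , a , e , λ z → mk⇔ (left z) (right z))
          where
          w : V
          w = image second y ω
          second-functional : Functional second
          second-functional m m′ = proj₂ (orderedPair-injective (proj₂ (second⁻ m)) (proj₂ (second⁻ m′)))
          left : ∀ z → z ∈ y → ∃[ i ] i ∈ w × IsOrderedPair z ∅ i
          left z z∈ with ⊗⁻ (fin-⊆ y∈ z z∈)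
          ... | k , i , refl , k∈ , i∈ with ∈⁅⁆⁻ k∈
          ... | refl = i , image⁺ z∈ i∈ (second⁺ i∈) , isOrderedPair-⟨⟩ ∅ i
          right : ∀ z → (∃[ i ] i ∈ w × IsOrderedPair z ∅ i) → z ∈ y
          right z (i , i∈ , h) =
            let _ , z′ , z′∈ , m = image⁻ i∈ in
            subst (_∈ y) (trans (orderedPair≡ (proj₂ (second⁻ m))) (sym (orderedPair≡ h))) z′∈

      S-onto-fin : ∃[ q ] (∀ {s y} → Maps q s y → s ∈ S) × Functional q ×
                          (∀ y → y ∈ fin (⁅ ∅ ⁆ ⊗ ω) → ∃[ s ] Maps q s y)
      S-onto-fin = q , (λ m → proj₁ (q⁻ m)) , q-functional , q-onto

    private
      -- Each `k` in `α` goes to the value of `h` at the one-element index consisting of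
      -- `⟨ k , ∅ ⟩`.
      singletons-inject : ∀ α κ → (∀ β → β ∈ α → β ∈ κ) → ∀ h →
        h ⊆ ((fin (κ ⊗ ω) − ∅) ⊗ S) → (∀ v → v ∈ fin (κ ⊗ ω) − ∅ → ∃[ s ] Maps h v s) → Functional h →
        (∀ {v w s} → Maps h v s → Maps h w s → v ≡ w) → ∃[ j ] Hartogs.Injects M S j α
      singletons-inject α κ α⊆κ h h⊆ tot fun inj = j , total , functional , injective
        where
        χ : Formula 7
        χ = ∃̇ ((∀̇ (v0 ∈̇ v1 ⇔̇ isOrderedPair v0 v3 v8)) ∧̇ maps v6 v0 v1)
        j : V
        j = rel χ (h ∷ ∅ ∷ []) α S
        IsSingleton : V → V → Set ℓ
        IsSingleton v k = ∀ z → z ∈ v ⇔ IsOrderedPair z k ∅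
        singleton≡ : ∀ {v v′ k} → IsSingleton v k → IsSingleton v′ k → v ≡ v′
        singleton≡ a b = ext (λ z z∈ → from (b z) (to (a z) z∈)) (λ z z∈ → from (a z) (to (b z) z∈))
        j⁻ : ∀ {k s} → Maps j k s → ∃[ v ] IsSingleton v k × Maps h v s
        j⁻ m = let _ , _ , _ , p = rel-maps⁻ χ _ _ _ m in p
        total : ∀ k → k ∈ α → ∃[ s ] s ∈ S × Maps j k s
        total k k∈ =
          let s , m = tot v (−⁺ (fin-⁅⁆ (⊗⁺ (α⊆κ k k∈) 0∈ω)) v≢∅)
              s∈ = proj₂ (maps-⊗ h⊆ m)
          in s , s∈ , rel-maps⁺ χ _ _ _ k∈ s∈ λ _ → v , (λ z → mk⇔ (left z) (right z)) , m
          where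
          v : V
          v = ∅ ⨾ ⟨ k , ∅ ⟩
          v≢∅ : ¬ v ≡ ∅
          v≢∅ e = ∉∅ _ (subst (⟨ k , ∅ ⟩ ∈_) e ⨾-new)
          left : ∀ z → z ∈ v → IsOrderedPair z k ∅
          left z z∈ with ⨾⁻ z∈
          ... | inj₁ p = ⊥-elim (∉∅ z p)
          ... | inj₂ refl = isOrderedPair-⟨⟩ k ∅
          right : ∀ z → IsOrderedPair z k ∅ → z ∈ v
          right z p = subst (_∈ v) (sym (orderedPair≡ p)) ⨾-new
        functional : ∀ k s s′ → Maps j k s → Maps j k s′ → s ≡ s′
        functional k s s′ m m′ = let v , a , p = j⁻ m ; v′ , b , p′ = j⁻ m′ in
          fun p (subst (λ v → Maps h v s′) (singleton≡ b a) p′)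
        injective : ∀ k k′ s → Maps j k s → Maps j k′ s → k ≡ k′
        injective k k′ s m m′ =
          let v , a , p = j⁻ m ; v′ , b , p′ = j⁻ m′
              in-v′ = subst (⟨ k , ∅ ⟩ ∈_) (inj p p′) (from (a _) (isOrderedPair-⟨⟩ k ∅))
          in proj₁ (orderedPair-injective (isOrderedPair-⟨⟩ k ∅) (to (b _) in-v′))

    ordinals-inject : ∀ α → IsOrdinal α → ∃[ j ] Hartogs.Injects M S j α
    ordinals-inject α oα =
      -- The successor of `α` contains `∅` even when `α` is empty, so the lowest block exists.
      let κ = α ⨾ α
          oκ = ordinal-suc oα
          0∈κ = 0∈ordinal oκ (λ e → ∉∅ α (subst (α ∈_) e ⨾-new))
          q₀ , q₀⊆ , q₀-functional , q₀-onto = S-onto-ω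
          E , E⊆ , E-functional , E-onto = fin-countable
          P , P⊆ , P-functional , P-injective , P-nonzero , P-total = pairing-function E E⊆ E-functional E-onto
          q , q-dom , q-functional , q-onto = S-onto-fin q₀ q₀⊆ q₀-functional q₀-onto E E⊆ E-functional E-onto
          h , h⊆ , tot , fun , inj =
            fin-injects S f (λ m → proj₁ (f-maps m)) f-functional f-injective f-onto
              (lex-wellOrder κ oκ 0∈κ)
              (lex-coding κ oκ 0∈κ P P⊆ P-functional P-injective P-nonzero P-total)
              q q-dom q-functional q-onto
      in singletons-inject α κ (λ β β∈ → ⨾-old β∈) h h⊆ tot fun inj

theorem5 : ∀ {ℓ : Level} (M : ZFModel ℓ) → let open ZFModel M in
    (S : V) → (∃[ x ] x ∈ S) → ¬ (∃[ f ] IsBijection f (seq S) (𝒫 S))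
theorem5 M S (x₀ , x₀∈) (f , (pairs , total , functional) , injective , onto) =
  Hartogs.hartogs M S (Contradiction.ordinals-inject M S f f-maps (functional _ _ _) total (injective _ _ _)
    (λ z z⊆ → onto z (Basics.𝒫⁺ M z⊆)) x₀ x₀∈)
  where
  open ZFModel M
  f-maps : ∀ {t z} → Maps f t z → t ∈ seq S × z ∈ 𝒫 S
  f-maps (p , h , p∈) with pairs p p∈
  ... | t , z , t∈ , z∈ , h′ with Basics.orderedPair-injective M h h′
  ... | refl , refl = t∈ , z∈
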